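{- For every fixed integer $r \ge 5$, as $n\to\infty$, \[ \mathrm{ex}(n, K_{r,r}) = \Omega\Big(n^{2-2/(r+1)}(\ln\ln n)^{1/(r^2-1)}\Big). \]
   Context: $\mathrm{ex}(n,H)$ denotes the largest integer $m$ such that there exists an $n$-vertex graph with $m$ edges containing no subgraph isomorphic to $H$. $K_{r,r}$ is the complete bipartite graph with both parts of size $r$. -}

module Defs where

open import Data.Nat using (ℕ; zero; suc; _+_; _*_; _^_; _≤_; _<_)
open import Data.Nat.Logarithm using (⌊log₂_⌋)
open import Data.Fin using (Fin; toℕ)
open import Data.Fin.Properties using (_<?_)
open import Data.Bool using (Bool; true; false; if_then_else_)
open import Data.List using (List; map; allFin)
open import Data.Nat.ListAction using (sum)
open import Data.Product using (_×_)
open import Relation.Binary.PropositionalEquality using (_≡_; _≢_)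
open import Relation.Nullary.Decidable using (⌊_⌋)
open import Function.Definitions using (Injective)

record SimpleGraph (n : ℕ) : Set where
  field
    adj   : Fin n → Fin n → Bool
    sym   : ∀ i j → adj i j ≡ adj j i
    irref : ∀ i → adj i i ≡ false
open SimpleGraph public

edgeCount : ∀ {n} → SimpleGraph n → ℕ
edgeCount {n} G =
  sum (map (λ i → sum (map (λ j →
         if ⌊ i <? j ⌋ then (if adj G i j then 1 else 0) else 0)
       (allFin n))) (allFin n))

record ContainsKrr {n : ℕ} (r : ℕ) (G : SimpleGraph n) : Set where
  field
    left     : Fin r → Fin n
    right    : Fin r → Fin n
    left-inj  : Injective _≡_ _≡_ left
    right-inj : Injective _≡_ _≡_ right
    disjoint  : ∀ i j → left i ≢ right j
    complete  : ∀ i j → adj G (left i) (right j) ≡ true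

-- Discrete surrogate for ln ln n (agrees with it up to a constant factor
-- for all sufficiently large n).
loglog : ℕ → ℕ
loglog n = ⌊log₂ ⌊log₂ n ⌋ ⌋

module Submission where

-- Keep each pair of K_{m,m} with probability p = D / h², where m = h^(r+1). The copies of K_{r,r} form an r²-
-- uniform hypergraph on the kept pairs, with degrees of order D^(r²-1). As K_{r,r} is strictly balanced,
-- nonbacktracking walks that revisit old vertices are rarer by a factor 1 / h, so after deleting few pairs the
-- hypergraph has no closed nonbacktracking walk of length at most 2ρ.
--
-- In such a hypergraph an independent set is selected in ρ rounds: a vertex active in a round is accepted unless
-- some hyperedge at it has all other members accepted earlier or active in the same round.  Acceptance is
-- computed with the hyperedge leading back to the parent ignored, so along the tree of walks no coordinate
-- occurs twice and the size is affine in the label distribution of each single vertex.  Its value at a product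
-- distribution is then given by the recursion for a tree, and rounding one coordinate after the other yields an
-- honest selection that is at least as large.  Independence of the selected set needs no tree-likeness.
--
-- Each vertex is accepted with probability 1 / ρ where ρ = D / g and g^(r²-1) is of order log D; the radius
-- 2ρ is affordable as long as D is a power of log n, which is where log log n comes from.

-- The gain g comes from one balance. In each round a vertex is active with probability 1 / ρ, so
-- each of its O(D^(r²-1)) hyperedges blocks it with probability O(ρ^-(r²-1)), and it survives with
-- probability exp(-O(g^(r²-1))). If this is at least 1 / ρ, then ρ rounds that each contribute ρ^-2
-- add up to acceptance with probability 1 / ρ; hence ρ is taken exponential in g^(r²-1). Summing
-- over walks of length 2ρ costs a polynomial in D and ρ to the power 2ρ against a saving of 1 / h,
-- so h is doubly exponential in g^(r²-1). The edge count is m² p / ρ = g h^(2r) up to a factor 2,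
-- with n of order h^(r+1).
--
-- No probability space is built: an expectation is a function affine in every coordinate, and a
-- lucky outcome is found by `round`. Both random choices use it, the kept pairs with one label and
-- the rounds with ρ labels. They differ in why affinity holds. For the rounds it needs the absence
-- of short closed walks. The count that produces this absence must allow walks to meet themselves;
-- it stays affine because it charges only for points not seen before.

open import Defs hiding (sym)
open import Algebra.Bundles using (CommutativeRing)
open import Data.Bool using (Bool; true; false; if_then_else_)
open import Data.Empty using (⊥; ⊥-elim)
open import Data.Fin as Fin using (Fin)
import Data.Fin.Properties as Finₚ
open import Data.List.Base using (List; []; _∷_; _++_; map; length; filter; cartesianProduct; allFin; tabulate)
open import Data.List.Membership.Propositional using (_∈_; _∉_; lose; find)
open import Data.List.Membership.Propositional.Properties
  using (∈-filter⁺; ∈-filter⁻; ∈-++⁺ˡ; ∈-++⁺ʳ; ∈-++⁻; ∈-allFin; ∈-map⁺; ∈-map⁻; ∈-cartesianProduct⁺; ∈-cartesianProduct⁻)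
open import Data.List.Properties
  using (filter-all; length-filter; length-++; length-map; filter-++; filter-notAll; filter-some; length-tabulate; map-tabulate; ≡-dec)
open import Data.List.Relation.Unary.All as All using (All; []; _∷_)
import Data.List.Relation.Unary.All.Properties as Allₚ
open import Data.List.Relation.Unary.AllPairs as AllPairs using (AllPairs; []; _∷_; allPairs?)
open import Data.List.Relation.Unary.Any using (Any; here; there)
open import Data.List.Relation.Unary.Unique.Propositional using (Unique)
open import Data.List.Relation.Unary.Unique.Propositional.Properties using (filter⁺; cartesianProduct⁺; map⁺; allFin⁺)
open import Data.Maybe using (Maybe; just; nothing)
open import Data.Nat as ℕ using (ℕ; zero; suc; _+_; _*_; _^_; _∸_; _≤_; _<_; z≤n; s≤s)
open import Data.Nat.ListAction using (sum)
open import Data.Nat.Logarithm using (⌊log₂_⌋; ⌊log₂⌋-mono-≤; ⌊log₂[2^n]⌋≡n)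
import Data.Nat.Properties as ℕₚ
open import Data.Nat.Tactic.RingSolver using (solve-∀)
open import Data.Product using (Σ; ∃; _×_; _,_; proj₁; proj₂)
import Data.Product.Properties as Productₚ
open import Data.Rational using (ℚ; 0ℚ; 1ℚ; 1/_; nonNegative; positive)
  renaming (_+_ to _+ℚ_; _*_ to _*ℚ_; _-_ to _-ℚ_; -_ to negℚ; _≤_ to _≤ℚ_; _<_ to _<ℚ_; _<?_ to _<ℚ?_)
import Data.Rational.Properties as ℚₚ
open import Data.Rational.Solver using (module +-*-Solver)
open +-*-Solver using (solve; _:=_; _:+_; _:*_; _:-_; con)
open import Algebra.Properties.CommutativeSemiring.Exp (CommutativeRing.commutativeSemiring ℚₚ.+-*-commutativeRing)
  using (^-homo-*; ^-assocʳ) renaming (_^_ to _^ℚ_; ^-distrib-* to *-^)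
open import Data.Sum as Sum using (_⊎_; inj₁; inj₂)
import Data.Sum.Properties as Sumₚ
open import Function using (_∘_; id)
open import Function.Definitions using (Injective)
open import Relation.Binary.Definitions using (DecidableEquality; tri<; tri≈; tri>)
open import Relation.Binary.PropositionalEquality
  using (_≡_; _≢_; refl; sym; trans; cong; cong₂; subst; subst₂; module ≡-Reasoning)
open import Relation.Nullary using (¬_; ¬?; Dec; yes; no; does; contradiction)
open import Relation.Nullary.Decidable using (⌊_⌋; _×-dec_; _→-dec_; decidable-stable)
open import Relation.Unary using (Decidable)

-- Rational arithmetic, finite sums and products

0≤1 : 0ℚ ≤ℚ 1ℚ
0≤1 = ℚₚ.nonNegative⁻¹ 1ℚ

*-mono : ∀ {a b c d} → 0ℚ ≤ℚ a → 0ℚ ≤ℚ d → a ≤ℚ b → c ≤ℚ d → a *ℚ c ≤ℚ b *ℚ d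
*-mono {a} {b} {c} {d} 0≤a 0≤d a≤b c≤d = ℚₚ.≤-trans
  (ℚₚ.*-monoˡ-≤-nonNeg a {{nonNegative 0≤a}} c≤d) (ℚₚ.*-monoʳ-≤-nonNeg d {{nonNegative 0≤d}} a≤b)

*-monoˡ : ∀ {a} {c d} → 0ℚ ≤ℚ a → c ≤ℚ d → a *ℚ c ≤ℚ a *ℚ d
*-monoˡ {a} 0≤a = ℚₚ.*-monoˡ-≤-nonNeg a {{nonNegative 0≤a}}

*-monoʳ : ∀ {a} {c d} → 0ℚ ≤ℚ a → c ≤ℚ d → c *ℚ a ≤ℚ d *ℚ a
*-monoʳ {a} 0≤a = ℚₚ.*-monoʳ-≤-nonNeg a {{nonNegative 0≤a}}

*-nonneg : ∀ {a b} → 0ℚ ≤ℚ a → 0ℚ ≤ℚ b → 0ℚ ≤ℚ a *ℚ b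
*-nonneg {a} {b} 0≤a 0≤b = subst (_≤ℚ a *ℚ b) (ℚₚ.*-zeroʳ a) (*-monoˡ 0≤a 0≤b)

+-nonneg : ∀ {a b} → 0ℚ ≤ℚ a → 0ℚ ≤ℚ b → 0ℚ ≤ℚ a +ℚ b
+-nonneg 0≤a 0≤b = ℚₚ.+-mono-≤ 0≤a 0≤b

p≤p+q : ∀ {p q} → 0ℚ ≤ℚ q → p ≤ℚ p +ℚ q
p≤p+q {p} {q} 0≤q = subst (_≤ℚ p +ℚ q) (ℚₚ.+-identityʳ p) (ℚₚ.+-monoʳ-≤ p 0≤q)

p≤q+p : ∀ {p q} → 0ℚ ≤ℚ q → p ≤ℚ q +ℚ p
p≤q+p {p} {q} 0≤q = subst (p ≤ℚ_) (ℚₚ.+-comm p q) (p≤p+q 0≤q)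

p≤q⇒0≤q-p : ∀ {p q} → p ≤ℚ q → 0ℚ ≤ℚ q -ℚ p
p≤q⇒0≤q-p {p} {q} p≤q = subst (_≤ℚ q -ℚ p) (ℚₚ.+-inverseʳ p) (ℚₚ.+-monoˡ-≤ (negℚ p) p≤q)

0≤q-p⇒p≤q : ∀ {p q} → 0ℚ ≤ℚ q -ℚ p → p ≤ℚ q
0≤q-p⇒p≤q {p} {q} h = subst (p ≤ℚ_) (solve 2 (λ p q → p :+ (q :- p) := q) refl p q) (p≤p+q h)

p-q≤p : ∀ {p q} → 0ℚ ≤ℚ q → p -ℚ q ≤ℚ p
p-q≤p {p} {q} 0≤q = 0≤q-p⇒p≤q (subst (0ℚ ≤ℚ_) (solve 2 (λ p q → q := p :- (p :- q)) refl p q) 0≤q)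

sub-mono : ∀ {a b c d} → a ≤ℚ b → c ≤ℚ d → a -ℚ d ≤ℚ b -ℚ c
sub-mono a≤b c≤d = ℚₚ.+-mono-≤ a≤b (ℚₚ.neg-antimono-≤ c≤d)

0≤^ : ∀ {p} n → 0ℚ ≤ℚ p → 0ℚ ≤ℚ p ^ℚ n
0≤^ zero    0≤p = 0≤1
0≤^ (suc n) 0≤p = *-nonneg 0≤p (0≤^ n 0≤p)

^-mono : ∀ {p q} n → 0ℚ ≤ℚ p → p ≤ℚ q → p ^ℚ n ≤ℚ q ^ℚ n
^-mono zero    0≤p p≤q = ℚₚ.≤-refl
^-mono (suc n) 0≤p p≤q = *-mono 0≤p (0≤^ n (ℚₚ.≤-trans 0≤p p≤q)) p≤q (^-mono n 0≤p p≤q)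

1^ : ∀ n → 1ℚ ^ℚ n ≡ 1ℚ
1^ zero    = refl
1^ (suc n) = trans (ℚₚ.*-identityˡ _) (1^ n)

^≤1 : ∀ {p} n → 0ℚ ≤ℚ p → p ≤ℚ 1ℚ → p ^ℚ n ≤ℚ 1ℚ
^≤1 {p} n 0≤p p≤1 = subst (p ^ℚ n ≤ℚ_) (1^ n) (^-mono n 0≤p p≤1)

1≤^ : ∀ {p} n → 1ℚ ≤ℚ p → 1ℚ ≤ℚ p ^ℚ n
1≤^ {p} n 1≤p = subst (_≤ℚ p ^ℚ n) (1^ n) (^-mono n 0≤1 1≤p)

^-antitone : ∀ {p m n} → 0ℚ ≤ℚ p → p ≤ℚ 1ℚ → m ≤ n → p ^ℚ n ≤ℚ p ^ℚ m
^-antitone {n = n} 0≤p p≤1 z≤n       = ^≤1 n 0≤p p≤1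
^-antitone         0≤p p≤1 (s≤s m≤n) = *-monoˡ 0≤p (^-antitone 0≤p p≤1 m≤n)

^-monotone : ∀ {p m n} → 1ℚ ≤ℚ p → m ≤ n → p ^ℚ m ≤ℚ p ^ℚ n
^-monotone {n = n} 1≤p z≤n       = 1≤^ n 1≤p
^-monotone         1≤p (s≤s m≤n) = *-monoˡ (ℚₚ.≤-trans 0≤1 1≤p) (^-monotone 1≤p m≤n)

ι : ℕ → ℚ
ι zero    = 0ℚ
ι (suc n) = 1ℚ +ℚ ι n

0≤ι : ∀ n → 0ℚ ≤ℚ ι n
0≤ι zero    = ℚₚ.≤-refl
0≤ι (suc n) = +-nonneg 0≤1 (0≤ι n)

ι-+ : ∀ m n → ι (m + n) ≡ ι m +ℚ ι n
ι-+ zero    n = sym (ℚₚ.+-identityˡ (ι n))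
ι-+ (suc m) n = trans (cong (1ℚ +ℚ_) (ι-+ m n)) (sym (ℚₚ.+-assoc 1ℚ (ι m) (ι n)))

ι-* : ∀ m n → ι (m * n) ≡ ι m *ℚ ι n
ι-* zero    n = sym (ℚₚ.*-zeroˡ (ι n))
ι-* (suc m) n = trans (ι-+ n (m * n)) (trans (cong (ι n +ℚ_) (ι-* m n))
  (solve 2 (λ a b → b :+ a :* b := (con 1ℚ :+ a) :* b) refl (ι m) (ι n)))

ι-^ : ∀ m n → ι (m ^ n) ≡ ι m ^ℚ n
ι-^ m zero    = refl
ι-^ m (suc n) = trans (ι-* m (m ^ n)) (cong (ι m *ℚ_) (ι-^ m n))

ι-mono : ∀ {m n} → m ≤ n → ι m ≤ℚ ι n
ι-mono {n = n} z≤n = 0≤ι n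
ι-mono (s≤s m≤n)   = ℚₚ.+-monoʳ-≤ 1ℚ (ι-mono m≤n)

ι-reflect : ∀ {m n} → ι m ≤ℚ ι n → m ≤ n
ι-reflect {m} {n} ιm≤ιn with m ℕ.≤? n
... | yes m≤n = m≤n
... | no  m≰n = ⊥-elim (ℚₚ.<-irrefl refl (ℚₚ.<-≤-trans
  (subst (_<ℚ 1ℚ +ℚ ι n) (ℚₚ.+-identityˡ (ι n)) (ℚₚ.+-monoˡ-< (ι n) (ℚₚ.positive⁻¹ 1ℚ)))
  (ℚₚ.≤-trans (ι-mono (ℕₚ.≰⇒> m≰n)) ιm≤ιn)))

1≤ι : ∀ {n} → 1 ≤ n → 1ℚ ≤ℚ ι n
1≤ι 1≤n = ι-mono 1≤n

-- A reciprocal is carried as an element x with ι n * x ≡ 1, so that no division occurs later.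
reciprocal : ∀ n → 1 ≤ n → ∃ λ x → 0ℚ ≤ℚ x × ι n *ℚ x ≡ 1ℚ
reciprocal n 1≤n = 1/ι , ℚₚ.<⇒≤ (ℚₚ.positive⁻¹ 1/ι {{ℚₚ.1/pos⇒pos (ι n) {{pos}}}}) , ℚₚ.*-inverseʳ (ι n) {{≢0}}
  where
  pos = positive (ℚₚ.<-≤-trans (ℚₚ.positive⁻¹ 1ℚ) (1≤ι 1≤n))
  ≢0  = ℚₚ.pos⇒nonZero (ι n) {{pos}}
  1/ι = (1/ ι n) {{≢0}}

x≤1 : ∀ {n x} → 1 ≤ n → 0ℚ ≤ℚ x → ι n *ℚ x ≡ 1ℚ → x ≤ℚ 1ℚ
x≤1 {n} {x} 1≤n 0≤x nx≡1 = subst₂ _≤ℚ_ (ℚₚ.*-identityˡ x) nx≡1 (*-monoʳ 0≤x (1≤ι 1≤n))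

⟦_⟧ : ∀ {P : Set} → Dec P → ℚ
⟦ yes _ ⟧ = 1ℚ
⟦ no _ ⟧  = 0ℚ

⟦⟧-nonneg : ∀ {P : Set} (d : Dec P) → 0ℚ ≤ℚ ⟦ d ⟧
⟦⟧-nonneg (yes _) = 0≤1
⟦⟧-nonneg (no _)  = ℚₚ.≤-refl

⟦⟧-yes : ∀ {P : Set} (d : Dec P) → P → ⟦ d ⟧ ≡ 1ℚ
⟦⟧-yes (yes _) p = refl
⟦⟧-yes (no ¬p) p = contradiction p ¬p

⟦⟧-no : ∀ {P : Set} (d : Dec P) → ¬ P → ⟦ d ⟧ ≡ 0ℚ
⟦⟧-no (yes p) ¬p = contradiction p ¬p
⟦⟧-no (no _)  ¬p = refl

bernoulli : ∀ {e} n → 0ℚ ≤ℚ e → e ≤ℚ 1ℚ → 1ℚ -ℚ ι n *ℚ e ≤ℚ (1ℚ -ℚ e) ^ℚ n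
bernoulli {e} zero    0≤e e≤1 = ℚₚ.≤-reflexive (solve 1 (λ e → con 1ℚ :- con 0ℚ :* e := con 1ℚ) refl e)
bernoulli {e} (suc n) 0≤e e≤1 = ℚₚ.≤-trans
  (0≤q-p⇒p≤q (subst (0ℚ ≤ℚ_)
    (solve 2 (λ e a → a :* (e :* e) := (con 1ℚ :- e) :* (con 1ℚ :- a :* e) :- (con 1ℚ :- (con 1ℚ :+ a) :* e)) refl e (ι n))
    (*-nonneg (0≤ι n) (*-nonneg 0≤e 0≤e))))
  (*-monoˡ (p≤q⇒0≤q-p e≤1) (bernoulli n 0≤e e≤1))

private variable
  A B : Set

∑ : List A → (A → ℚ) → ℚ
∑ []       f = 0ℚ
∑ (x ∷ xs) f = f x +ℚ ∑ xs f

∏ : List A → (A → ℚ) → ℚ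
∏ []       f = 1ℚ
∏ (x ∷ xs) f = f x *ℚ ∏ xs f

∑-cong : ∀ (xs : List A) {f g : A → ℚ} → (∀ {x} → x ∈ xs → f x ≡ g x) → ∑ xs f ≡ ∑ xs g
∑-cong []       h = refl
∑-cong (x ∷ xs) h = cong₂ _+ℚ_ (h (here refl)) (∑-cong xs (h ∘ there))

∏-cong : ∀ (xs : List A) {f g : A → ℚ} → (∀ {x} → x ∈ xs → f x ≡ g x) → ∏ xs f ≡ ∏ xs g
∏-cong []       h = refl
∏-cong (x ∷ xs) h = cong₂ _*ℚ_ (h (here refl)) (∏-cong xs (h ∘ there))

∑-mono : ∀ (xs : List A) {f g : A → ℚ} → (∀ {x} → x ∈ xs → f x ≤ℚ g x) → ∑ xs f ≤ℚ ∑ xs g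
∑-mono []       h = ℚₚ.≤-refl
∑-mono (x ∷ xs) h = ℚₚ.+-mono-≤ (h (here refl)) (∑-mono xs (h ∘ there))

∑-nonneg : ∀ (xs : List A) {f : A → ℚ} → (∀ {x} → x ∈ xs → 0ℚ ≤ℚ f x) → 0ℚ ≤ℚ ∑ xs f
∑-nonneg []       h = ℚₚ.≤-refl
∑-nonneg (x ∷ xs) h = +-nonneg (h (here refl)) (∑-nonneg xs (h ∘ there))

∑-const : ∀ (xs : List A) c → ∑ xs (λ _ → c) ≡ ι (length xs) *ℚ c
∑-const []       c = sym (ℚₚ.*-zeroˡ c)
∑-const (x ∷ xs) c rewrite ∑-const xs c = solve 2 (λ c n → c :+ n :* c := (con 1ℚ :+ n) :* c) refl c (ι (length xs))

∑-*ˡ : ∀ (xs : List A) c (f : A → ℚ) → ∑ xs (λ x → c *ℚ f x) ≡ c *ℚ ∑ xs f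
∑-*ˡ []       c f = sym (ℚₚ.*-zeroʳ c)
∑-*ˡ (x ∷ xs) c f rewrite ∑-*ˡ xs c f = sym (ℚₚ.*-distribˡ-+ c (f x) (∑ xs f))

∑-*ʳ : ∀ (xs : List A) c (f : A → ℚ) → ∑ xs (λ x → f x *ℚ c) ≡ ∑ xs f *ℚ c
∑-*ʳ xs c f = trans (∑-cong xs (λ _ → ℚₚ.*-comm _ c)) (trans (∑-*ˡ xs c f) (ℚₚ.*-comm c _))

∑-+ : ∀ (xs : List A) (f g : A → ℚ) → ∑ xs (λ x → f x +ℚ g x) ≡ ∑ xs f +ℚ ∑ xs g
∑-+ []       f g = refl
∑-+ (x ∷ xs) f g rewrite ∑-+ xs f g =
  solve 4 (λ a b c d → (a :+ b) :+ (c :+ d) := (a :+ c) :+ (b :+ d)) refl (f x) (g x) (∑ xs f) (∑ xs g)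

∑-++ : ∀ (xs ys : List A) (f : A → ℚ) → ∑ (xs ++ ys) f ≡ ∑ xs f +ℚ ∑ ys f
∑-++ []       ys f = sym (ℚₚ.+-identityˡ _)
∑-++ (x ∷ xs) ys f = trans (cong (f x +ℚ_) (∑-++ xs ys f)) (sym (ℚₚ.+-assoc (f x) _ _))

∑-map : ∀ (xs : List A) (k : A → B) (f : B → ℚ) → ∑ (map k xs) f ≡ ∑ xs (f ∘ k)
∑-map []       k f = refl
∑-map (x ∷ xs) k f = cong (f (k x) +ℚ_) (∑-map xs k f)

∑-swap : ∀ (xs : List A) (ys : List B) (f : A → B → ℚ) → ∑ xs (λ x → ∑ ys (f x)) ≡ ∑ ys (λ y → ∑ xs (λ x → f x y))
∑-swap []       ys f = sym (trans (∑-const ys 0ℚ) (ℚₚ.*-zeroʳ (ι (length ys))))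
∑-swap (x ∷ xs) ys f = trans (cong (∑ ys (f x) +ℚ_) (∑-swap xs ys f)) (sym (∑-+ ys (f x) (λ y → ∑ xs (λ x′ → f x′ y))))

∑-cartesianProduct : ∀ (xs : List A) (ys : List B) (f : A × B → ℚ) →
  ∑ (cartesianProduct xs ys) f ≡ ∑ xs (λ x → ∑ ys (λ y → f (x , y)))
∑-cartesianProduct []       ys f = refl
∑-cartesianProduct (x ∷ xs) ys f = trans (∑-++ (map (x ,_) ys) _ f)
  (cong₂ _+ℚ_ (∑-map ys (x ,_) f) (∑-cartesianProduct xs ys f))

∑-filter-≤ : ∀ {P : A → Set} (P? : Decidable P) (xs : List A) {f : A → ℚ} → (∀ x → 0ℚ ≤ℚ f x) → ∑ (filter P? xs) f ≤ℚ ∑ xs f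
∑-filter-≤ P? []       h = ℚₚ.≤-refl
∑-filter-≤ P? (x ∷ xs) {f} h with does (P? x)
... | true  = ℚₚ.+-monoʳ-≤ (f x) (∑-filter-≤ P? xs h)
... | false = ℚₚ.≤-trans (∑-filter-≤ P? xs h) (p≤q+p {∑ xs f} (h x))

term≤∑ : ∀ {xs : List A} {f : A → ℚ} → (∀ {y} → y ∈ xs → 0ℚ ≤ℚ f y) → ∀ {x} → x ∈ xs → f x ≤ℚ ∑ xs f
term≤∑ {xs = y ∷ xs} h (here refl) = p≤p+q (∑-nonneg xs (h ∘ there))
term≤∑ {xs = y ∷ xs} h (there x∈) = ℚₚ.≤-trans (term≤∑ (h ∘ there) x∈) (p≤q+p (h (here refl)))

∏-nonneg : ∀ (xs : List A) {f : A → ℚ} → (∀ {x} → x ∈ xs → 0ℚ ≤ℚ f x) → 0ℚ ≤ℚ ∏ xs f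
∏-nonneg []       h = 0≤1
∏-nonneg (x ∷ xs) h = *-nonneg (h (here refl)) (∏-nonneg xs (h ∘ there))

∏-mono : ∀ (xs : List A) {f g : A → ℚ} → (∀ {x} → x ∈ xs → 0ℚ ≤ℚ f x) → (∀ {x} → x ∈ xs → f x ≤ℚ g x) →
  ∏ xs f ≤ℚ ∏ xs g
∏-mono []       0≤f f≤g = ℚₚ.≤-refl
∏-mono (x ∷ xs) 0≤f f≤g = *-mono (0≤f (here refl))
  (∏-nonneg xs (λ x∈ → ℚₚ.≤-trans (0≤f (there x∈)) (f≤g (there x∈)))) (f≤g (here refl)) (∏-mono xs (0≤f ∘ there) (f≤g ∘ there))

∏-const : ∀ (xs : List A) c → ∏ xs (λ _ → c) ≡ c ^ℚ length xs
∏-const []       c = refl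
∏-const (x ∷ xs) c = cong (c *ℚ_) (∏-const xs c)

∏≤1 : ∀ (xs : List A) {f : A → ℚ} → (∀ {x} → x ∈ xs → 0ℚ ≤ℚ f x) → (∀ {x} → x ∈ xs → f x ≤ℚ 1ℚ) → ∏ xs f ≤ℚ 1ℚ
∏≤1 xs {f} 0≤f f≤1 = subst (∏ xs f ≤ℚ_) (trans (∏-const xs 1ℚ) (1^ (length xs))) (∏-mono xs 0≤f f≤1)

∏≡1 : ∀ (xs : List A) {f : A → ℚ} → (∀ {x} → x ∈ xs → f x ≡ 1ℚ) → ∏ xs f ≡ 1ℚ
∏≡1 xs h = trans (∏-cong xs h) (trans (∏-const xs 1ℚ) (1^ (length xs)))

∏-factor-0 : ∀ {xs : List A} {f : A → ℚ} {x} → x ∈ xs → f x ≡ 0ℚ → ∏ xs f ≡ 0ℚ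
∏-factor-0 {xs = _ ∷ xs} {f} (here refl) eq = trans (cong (_*ℚ ∏ xs f) eq) (ℚₚ.*-zeroˡ (∏ xs f))
∏-factor-0 {xs = y ∷ xs} {f} (there x∈) eq = trans (cong (f y *ℚ_) (∏-factor-0 x∈ eq)) (ℚₚ.*-zeroʳ (f y))

-- Affine functions of probability vectors and rounding

∑< : ℕ → (ℕ → ℚ) → ℚ
∑< zero    f = 0ℚ
∑< (suc n) f = ∑< n f +ℚ f n

∑<-cong : ∀ n {f g} → (∀ {i} → i < n → f i ≡ g i) → ∑< n f ≡ ∑< n g
∑<-cong zero    h = refl
∑<-cong (suc n) h = cong₂ _+ℚ_ (∑<-cong n (h ∘ ℕₚ.m<n⇒m<1+n)) (h (ℕₚ.n<1+n n))

∑<-mono : ∀ n {f g} → (∀ {i} → i < n → f i ≤ℚ g i) → ∑< n f ≤ℚ ∑< n g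
∑<-mono zero    h = ℚₚ.≤-refl
∑<-mono (suc n) h = ℚₚ.+-mono-≤ (∑<-mono n (h ∘ ℕₚ.m<n⇒m<1+n)) (h (ℕₚ.n<1+n n))

∑<-monoˡ : ∀ {m n f} → (∀ i → 0ℚ ≤ℚ f i) → m ≤ n → ∑< m f ≤ℚ ∑< n f
∑<-monoˡ {m} {n} {f} 0≤f m≤n = go (ℕₚ.≤⇒≤′ m≤n)
  where
  go : ∀ {n} → m ℕ.≤′ n → ∑< m f ≤ℚ ∑< n f
  go ℕ.≤′-refl     = ℚₚ.≤-refl
  go (ℕ.≤′-step p) = ℚₚ.≤-trans (go p) (p≤p+q (0≤f _))

∑<-*ʳ : ∀ n f c → ∑< n (λ i → f i *ℚ c) ≡ ∑< n f *ℚ c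
∑<-*ʳ zero    f c = sym (ℚₚ.*-zeroˡ c)
∑<-*ʳ (suc n) f c rewrite ∑<-*ʳ n f c = sym (ℚₚ.*-distribʳ-+ c (∑< n f) (f n))

∑<-const : ∀ n c → ∑< n (λ _ → c) ≡ ι n *ℚ c
∑<-const zero    c = sym (ℚₚ.*-zeroˡ c)
∑<-const (suc n) c rewrite ∑<-const n c = solve 2 (λ n c → n :* c :+ c := (con 1ℚ :+ n) :* c) refl (ι n) c

∑<-+ : ∀ n f g → ∑< n (λ i → f i +ℚ g i) ≡ ∑< n f +ℚ ∑< n g
∑<-+ zero    f g = refl
∑<-+ (suc n) f g rewrite ∑<-+ n f g =
  solve 4 (λ a b c d → (a :+ b) :+ (c :+ d) := (a :+ c) :+ (b :+ d)) refl (∑< n f) (∑< n g) (f n) (g n)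

∑<-0 : ∀ n {f} → (∀ {i} → i < n → f i ≡ 0ℚ) → ∑< n f ≡ 0ℚ
∑<-0 zero    h = refl
∑<-0 (suc n) h rewrite ∑<-0 n (h ∘ ℕₚ.m<n⇒m<1+n) | h (ℕₚ.n<1+n n) = refl

-- A point carries the probabilities of the labels 0, ..., ρ-1; the remaining mass is that of "no label",
-- represented by the vertex e ρ, which vanishes below ρ.
Point : Set
Point = ℕ → ℚ

opaque
  e : ℕ → Point
  e l i = ⟦ i ℕ.≟ l ⟧

  e-diag : ∀ l → e l l ≡ 1ℚ
  e-diag l = ⟦⟧-yes (l ℕ.≟ l) refl

  e-off : ∀ l i → i ≢ l → e l i ≡ 0ℚ
  e-off l i = ⟦⟧-no (i ℕ.≟ l)

  e-nonneg : ∀ l i → 0ℚ ≤ℚ e l i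
  e-nonneg l i = ⟦⟧-nonneg (i ℕ.≟ l)

∑<-delta : ∀ n (w : Point) i → i < n → ∑< n (λ l → w l *ℚ e l i) ≡ w i
∑<-delta (suc n) w i i<1+n with i ℕ.≟ n
... | yes refl = trans (cong₂ _+ℚ_ (∑<-0 n (λ {l} l<n → trans (cong (w l *ℚ_) (e-off l n (ℕₚ.<⇒≢ l<n ∘ sym))) (ℚₚ.*-zeroʳ (w l))))
                                   (trans (cong (w i *ℚ_) (e-diag i)) (ℚₚ.*-identityʳ (w i)))) (ℚₚ.+-identityˡ (w i))
... | no i≢n = trans (cong₂ _+ℚ_ (∑<-delta n w i (ℕₚ.≤∧≢⇒< (ℕ.s≤s⁻¹ i<1+n) i≢n)) (trans (cong (w n *ℚ_) (e-off n i i≢n)) (ℚₚ.*-zeroʳ (w n)))) (ℚₚ.+-identityʳ (w i))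

∑<-e≤1 : ∀ n l → ∑< n (e l) ≤ℚ 1ℚ
∑<-e≤1 n l with l ℕ.<? n
... | yes l<n = ℚₚ.≤-reflexive (trans (∑<-cong n (λ {i} _ → trans (e-sym i l) (sym (ℚₚ.*-identityˡ _)))) (∑<-delta n (λ _ → 1ℚ) l l<n))
  where
  e-sym : ∀ i l → e l i ≡ e i l
  e-sym i l with i ℕ.≟ l
  ... | yes refl = refl
  ... | no i≢l   = trans (e-off l i i≢l) (sym (e-off i l (i≢l ∘ sym)))
... | no l≮n = subst (_≤ℚ 1ℚ) (sym (∑<-0 n {e l} (λ {i} i<n → e-off l i (λ { refl → l≮n i<n })))) 0≤1

module Affine (ρ : ℕ) where

  Subprobability : Point → Set
  Subprobability w = (∀ i → 0ℚ ≤ℚ w i) × ∑< ρ w ≤ℚ 1ℚ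

  e-subprobability : ∀ l → Subprobability (e l)
  e-subprobability l = e-nonneg l , ∑<-e≤1 ρ l

  -- The expectation of `f (e l)` for a label l drawn from w, with `e ρ` drawn when there is no
  -- label.
  mix : Point → (Point → ℚ) → ℚ
  mix w f = (1ℚ -ℚ ∑< ρ w) *ℚ f (e ρ) +ℚ ∑< ρ (λ l → w l *ℚ f (e l))

  Aff Const : (Point → ℚ) → Set
  Aff f   = ∀ {w} → Subprobability w → f w ≡ mix w f
  Const f = ∀ w w′ → f w ≡ f w′

  -- A mean is at most the largest value. The search `best` starts from `e ρ`, so that the outcome
  -- without a label competes as well.
  mix-bound : ∀ {w} f → Subprobability w → ∃ λ l → mix w f ≤ℚ f (e l)
  mix-bound {w} f (0≤w , ∑w≤1) with best ρ
    where
    best : ∀ n → ∃ λ l → f (e ρ) ≤ℚ f (e l) × (∀ {i} → i < n → f (e i) ≤ℚ f (e l))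
    best zero    = ρ , ℚₚ.≤-refl , λ ()
    best (suc n) with best n
    ... | l , ρ≤l , below with ℚₚ.≤-total (f (e n)) (f (e l))
    ... | inj₁ n≤l = l , ρ≤l , below′
      where
      below′ : ∀ {i} → i < suc n → f (e i) ≤ℚ f (e l)
      below′ {i} i<1+n with i ℕ.≟ n
      ... | yes refl = n≤l
      ... | no i≢n   = below (ℕₚ.≤∧≢⇒< (ℕ.s≤s⁻¹ i<1+n) i≢n)
    ... | inj₂ l≤n = n , ℚₚ.≤-trans ρ≤l l≤n , below′
      where
      below′ : ∀ {i} → i < suc n → f (e i) ≤ℚ f (e n)
      below′ {i} i<1+n with i ℕ.≟ n
      ... | yes refl = ℚₚ.≤-refl
      ... | no i≢n   = ℚₚ.≤-trans (below (ℕₚ.≤∧≢⇒< (ℕ.s≤s⁻¹ i<1+n) i≢n)) l≤n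
  ... | l , ρ≤l , below = l , ℚₚ.≤-trans
    (ℚₚ.+-mono-≤ (*-monoˡ (p≤q⇒0≤q-p ∑w≤1) ρ≤l)
      (ℚₚ.≤-trans (∑<-mono ρ (λ i<ρ → *-monoˡ (0≤w _) (below i<ρ))) (ℚₚ.≤-reflexive (∑<-*ʳ ρ w (f (e l))))))
    (ℚₚ.≤-reflexive (solve 2 (λ s c → (con 1ℚ :- s) :* c :+ s :* c := c) refl (∑< ρ w) (f (e l))))

  const⇒aff : ∀ {f} → Const f → Aff f
  const⇒aff {f} h {w} _ = sym (trans
    (cong₂ _+ℚ_ (cong ((1ℚ -ℚ ∑< ρ w) *ℚ_) (h (e ρ) w))
      (trans (∑<-cong ρ (λ {i} _ → cong (w i *ℚ_) (h (e i) w))) (∑<-*ʳ ρ w (f w))))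
    (solve 2 (λ s c → (con 1ℚ :- s) :* c :+ s :* c := c) refl (∑< ρ w) (f w)))

  aff-coordinate : ∀ {i} → i < ρ → Aff (λ w → w i)
  aff-coordinate {i} i<ρ {w} _ = sym (trans
    (cong₂ _+ℚ_ (trans (cong ((1ℚ -ℚ ∑< ρ w) *ℚ_) (e-off ρ i (ℕₚ.<⇒≢ i<ρ))) (ℚₚ.*-zeroʳ (1ℚ -ℚ ∑< ρ w))) (∑<-delta ρ w i i<ρ))
    (ℚₚ.+-identityˡ (w i)))

  aff-+ : ∀ {f g} → Aff f → Aff g → Aff (λ w → f w +ℚ g w)
  aff-+ {f} {g} af ag {w} sw = trans (cong₂ _+ℚ_ (af sw) (ag sw)) (sym (trans
    (cong ((1ℚ -ℚ ∑< ρ w) *ℚ (f (e ρ) +ℚ g (e ρ)) +ℚ_)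
      (trans (∑<-cong ρ (λ {l} _ → ℚₚ.*-distribˡ-+ (w l) (f (e l)) (g (e l))))
        (∑<-+ ρ (λ l → w l *ℚ f (e l)) (λ l → w l *ℚ g (e l)))))
    (solve 5 (λ s a b c d → s :* (a :+ b) :+ (c :+ d) := (s :* a :+ c) :+ (s :* b :+ d)) refl
      (1ℚ -ℚ ∑< ρ w) (f (e ρ)) (g (e ρ)) (∑< ρ (λ l → w l *ℚ f (e l))) (∑< ρ (λ l → w l *ℚ g (e l))))))

  aff-*ʳ : ∀ {f g} → Aff f → Const g → Aff (λ w → f w *ℚ g w)
  aff-*ʳ {f} {g} af cg {w} sw = trans (cong (_*ℚ g w) (af sw)) (sym (trans
    (cong₂ _+ℚ_ (cong (λ z → (1ℚ -ℚ ∑< ρ w) *ℚ (f (e ρ) *ℚ z)) (cg (e ρ) w))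
      (trans (∑<-cong ρ (λ {l} _ → trans (cong (λ z → w l *ℚ (f (e l) *ℚ z)) (cg (e l) w)) (sym (ℚₚ.*-assoc (w l) (f (e l)) (g w)))))
        (∑<-*ʳ ρ _ (g w))))
    (solve 4 (λ s a b c → s :* (a :* c) :+ b :* c := (s :* a :+ b) :* c) refl
      (1ℚ -ℚ ∑< ρ w) (f (e ρ)) (∑< ρ (λ l → w l *ℚ f (e l))) (g w))))

  aff-ext : ∀ {f g} → (∀ w → f w ≡ g w) → Aff f → Aff g
  aff-ext {f} {g} h af {w} sw = trans (sym (h w)) (trans (af sw)
    (cong₂ _+ℚ_ (cong ((1ℚ -ℚ ∑< ρ w) *ℚ_) (h (e ρ))) (∑<-cong ρ (λ {l} _ → cong (w l *ℚ_) (h (e l))))))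

  aff-*ˡ : ∀ {f g} → Const f → Aff g → Aff (λ w → f w *ℚ g w)
  aff-*ˡ {f} {g} cf ag = aff-ext (λ w → ℚₚ.*-comm (g w) (f w)) (aff-*ʳ ag cf)

  aff-1- : ∀ {f} → Aff f → Aff (λ w → 1ℚ -ℚ f w)
  aff-1- {f} af = aff-ext (λ w → solve 1 (λ x → con 1ℚ :+ con (negℚ 1ℚ) :* x := con 1ℚ :- x) refl (f w))
    (aff-+ {f = λ _ → 1ℚ} (const⇒aff (λ _ _ → refl)) (aff-*ˡ {f = λ _ → negℚ 1ℚ} (λ _ _ → refl) af))

  aff-∑ : ∀ {A : Set} (xs : List A) {f : A → Point → ℚ} → (∀ {a} → a ∈ xs → Aff (f a)) → Aff (λ w → ∑ xs (λ a → f a w))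
  aff-∑ []       h = const⇒aff (λ _ _ → refl)
  aff-∑ (x ∷ xs) h = aff-+ (h (here refl)) (aff-∑ xs (h ∘ there))

  -- W is evidence produced when f may genuinely depend on the coordinate under consideration.
  Dependence : (Point → ℚ) → Set → Set
  Dependence f W = Const f ⊎ (Aff f × W)

  dependence⇒aff : ∀ {f W} → Dependence f W → Aff f
  dependence⇒aff (inj₁ cf)       = const⇒aff cf
  dependence⇒aff (inj₂ (af , _)) = af

  dep-map : ∀ {f W W′} → (W → W′) → Dependence f W → Dependence f W′
  dep-map h (inj₁ cf)       = inj₁ cf
  dep-map h (inj₂ (af , w)) = inj₂ (af , h w)

  dep-+ : ∀ {f g W} → Dependence f W → Dependence g W → Dependence (λ w → f w +ℚ g w) W
  dep-+ (inj₁ cf)       (inj₁ cg)       = inj₁ (λ w w′ → cong₂ _+ℚ_ (cf w w′) (cg w w′))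
  dep-+ (inj₁ cf)       (inj₂ (ag , w)) = inj₂ (aff-+ (const⇒aff cf) ag , w)
  dep-+ (inj₂ (af , w)) dg              = inj₂ (aff-+ af (dependence⇒aff dg) , w)

  -- A product of two affine functions of one coordinate is quadratic in general. The last argument
  -- excludes that both factors vary; for the rounds this is where tree-likeness enters.
  dep-* : ∀ {f g V W} → Dependence f V → Dependence g W → (V → W → ⊥) → Dependence (λ w → f w *ℚ g w) (V ⊎ W)
  dep-* (inj₁ cf)       (inj₁ cg)       ⊥-VW = inj₁ (λ w w′ → cong₂ _*ℚ_ (cf w w′) (cg w w′))
  dep-* (inj₁ cf)       (inj₂ (ag , w)) ⊥-VW = inj₂ (aff-*ˡ cf ag , inj₂ w)
  dep-* (inj₂ (af , v)) (inj₁ cg)       ⊥-VW = inj₂ (aff-*ʳ af cg , inj₁ v)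
  dep-* (inj₂ (af , v)) (inj₂ (ag , w)) ⊥-VW = ⊥-elim (⊥-VW v w)

  dep-1- : ∀ {f W} → Dependence f W → Dependence (λ w → 1ℚ -ℚ f w) W
  dep-1- (inj₁ cf)       = inj₁ (λ w w′ → cong (1ℚ -ℚ_) (cf w w′))
  dep-1- (inj₂ (af , w)) = inj₂ (aff-1- af , w)

  dep-∏ : ∀ {A : Set} (xs : List A) {f : A → Point → ℚ} (W : A → Set) → Unique xs →
    (∀ {a} → a ∈ xs → Dependence (f a) (W a)) →
    (∀ {a b} → a ∈ xs → b ∈ xs → a ≢ b → W a → W b → ⊥) →
    Dependence (λ w → ∏ xs (λ a → f a w)) (∃ λ a → a ∈ xs × W a)
  dep-∏ []       W _           d excl = inj₁ (λ _ _ → refl)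
  dep-∏ (x ∷ xs) W (x∉ ∷ uniq) d excl = dep-map
    (λ { (inj₁ w) → x , here refl , w ; (inj₂ (a , a∈ , w)) → a , there a∈ , w })
    (dep-* (d (here refl)) (dep-∏ xs W uniq (d ∘ there) (λ a∈ b∈ → excl (there a∈) (there b∈)))
      (λ { wx (a , a∈ , wa) → excl (here refl) (there a∈) (All.lookup x∉ a∈) wx wa }))

  module _ {V : Set} (_≟_ : DecidableEquality V) where

    _[_≔_] : (V → Point) → V → Point → V → Point
    (x [ u ≔ w ]) v = if does (v ≟ u) then w else x v

    ≔-same : ∀ x u w → (x [ u ≔ w ]) u ≡ w
    ≔-same x u w with u ≟ u
    ... | yes _  = refl
    ... | no u≢u = contradiction refl u≢u

    ≔-other : ∀ x {u v} w → v ≢ u → (x [ u ≔ w ]) v ≡ x v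
    ≔-other x {u} {v} w v≢u with v ≟ u
    ... | yes v≡u = contradiction v≡u v≢u
    ... | no _    = refl

    ≔-self : ∀ x u v → (x [ u ≔ x u ]) v ≡ x v
    ≔-self x u v with v ≟ u
    ... | yes refl = refl
    ... | no _     = refl

    ≔-all : ∀ (P : Point → Set) {x u w} → (∀ v → P (x v)) → P w → ∀ v → P ((x [ u ≔ w ]) v)
    ≔-all P {u = u} px pw v with v ≟ u
    ... | yes _ = pw
    ... | no _  = px v

    Vertex : Point → Set
    Vertex w = ∃ λ l → w ≡ e l

    -- A function that is affine in every coordinate does not decrease when the coordinates are moved, one
    -- after the other, to the best vertex; this replaces taking expectations.
    round : (F : (V → Point) → ℚ) → (∀ {x y} → (∀ v → x v ≡ y v) → F x ≡ F y) →
      (∀ x u → Aff (λ w → F (x [ u ≔ w ]))) →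
      ∀ us x → (∀ v → Subprobability (x v)) →
      ∃ λ y → F x ≤ℚ F y × (∀ v → v ∈ us ⊎ Vertex (x v) → Vertex (y v))
    round F ext aff []       x sx = x , ℚₚ.≤-refl , λ { v (inj₂ vx) → vx }
    round F ext aff (u ∷ us) x sx =
      let l , ≤l = mix-bound (λ w → F (x [ u ≔ w ])) (sx u)
          y , ≤y , vertex = round F ext aff us (x [ u ≔ e l ]) (≔-all Subprobability sx (e-subprobability l))
      in y , ℚₚ.≤-trans (ℚₚ.≤-reflexive (trans (sym (ext (≔-self x u))) (aff x u (sx u)))) (ℚₚ.≤-trans ≤l ≤y) ,
         λ v h → vertex v (step l v h)
      where
      step : ∀ l v → v ∈ u ∷ us ⊎ Vertex (x v) → v ∈ us ⊎ Vertex ((x [ u ≔ e l ]) v)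
      step l v (inj₁ (here refl)) = inj₂ (l , ≔-same x v (e l))
      step l v (inj₁ (there v∈))  = inj₁ v∈
      step l v (inj₂ (l′ , eq)) with v ≟ u
      ... | yes _ = inj₂ (l , refl)
      ... | no _  = inj₂ (l′ , eq)

-- Independent sets in locally tree-like hypergraphs

-- Without repetitions at most one factor disappears, and it is at least 1/2. Applied to the
-- hyperedge leading back to the parent: ignoring it at most doubles a survival probability.
∏-filter-≢ : ∀ {A : Set} (_≟_ : DecidableEquality A) a (xs : List A) {f : A → ℚ} → Unique xs →
  (∀ {x} → x ∈ xs → 0ℚ ≤ℚ f x) → (∀ {x} → x ∈ xs → 1ℚ ≤ℚ f x +ℚ f x) →
  ∏ (filter (λ x → ¬? (x ≟ a)) xs) f ≤ℚ ∏ xs f +ℚ ∏ xs f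
∏-filter-≢ _≟_ a []       _           0≤f ½≤f = p≤p+q 0≤1
∏-filter-≢ _≟_ a (x ∷ xs) {f} (x∉ ∷ uniq) 0≤f ½≤f with x ≟ a
... | yes refl = ℚₚ.≤-trans
  (ℚₚ.≤-reflexive (trans (cong (λ ys → ∏ ys f) (filter-all (λ x → ¬? (x ≟ a)) (All.map (λ a≢y y≡a → a≢y (sym y≡a)) x∉)))
    (sym (ℚₚ.*-identityˡ (∏ xs f)))))
  (ℚₚ.≤-trans (*-monoʳ (∏-nonneg xs (0≤f ∘ there)) (½≤f (here refl))) (ℚₚ.≤-reflexive (ℚₚ.*-distribʳ-+ (∏ xs f) (f x) (f x))))
... | no _ = ℚₚ.≤-trans (*-monoˡ (0≤f (here refl)) (∏-filter-≢ _≟_ a xs uniq (0≤f ∘ there) (½≤f ∘ there)))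
  (ℚₚ.≤-reflexive (ℚₚ.*-distribˡ-+ (f x) (∏ xs f) (∏ xs f)))

Bit : ℚ → Set
Bit q = q ≡ 0ℚ ⊎ q ≡ 1ℚ

∏-bit : ∀ {A : Set} (xs : List A) {f : A → ℚ} → (∀ {x} → x ∈ xs → Bit (f x)) → Bit (∏ xs f)
∏-bit []       h = inj₂ refl
∏-bit (x ∷ xs) {f} h with h (here refl) | ∏-bit xs {f} (h ∘ there)
... | inj₁ p | _      = inj₁ (trans (cong (_*ℚ ∏ xs f) p) (ℚₚ.*-zeroˡ (∏ xs f)))
... | inj₂ p | inj₁ q = inj₁ (trans (cong (f x *ℚ_) q) (ℚₚ.*-zeroʳ (f x)))
... | inj₂ p | inj₂ q = inj₂ (cong₂ _*ℚ_ p q)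

0≮0 : ∀ {q} → q ≡ 0ℚ → 0ℚ <ℚ q → ⊥
0≮0 refl = ℚₚ.<-irrefl refl

module Hypergraph {V E : Set} (_≟V_ : DecidableEquality V) (_≟E_ : DecidableEquality E)
  (mem : E → List V) (Es : List E) (Es-unique : Unique Es) (mem-unique : ∀ {K} → K ∈ Es → Unique (mem K)) where

  open import Data.List.Membership.DecPropositional _≟V_ using (_∈?_)

  -- The first argument is the hyperedge through which v was reached, `nothing` at the root.
  inc : Maybe E → V → List E
  inc nothing   v = filter (λ K → v ∈? mem K) Es
  inc (just K₀) v = filter (λ K → ¬? (K ≟E K₀)) (inc nothing v)

  oth : E → V → List V
  oth K v = filter (λ u → ¬? (u ≟V v)) (mem K)

  inc⇒ : ∀ K₀ {v K} → K ∈ inc K₀ v → K ∈ inc nothing v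
  inc⇒ nothing   K∈ = K∈
  inc⇒ (just K₀) K∈ = proj₁ (∈-filter⁻ (λ K → ¬? (K ≟E K₀)) K∈)

  inc-∈Es : ∀ K₀ {v K} → K ∈ inc K₀ v → K ∈ Es
  inc-∈Es K₀ {v} K∈ = proj₁ (∈-filter⁻ (λ K → v ∈? mem K) (inc⇒ K₀ K∈))

  inc-∈mem : ∀ K₀ {v K} → K ∈ inc K₀ v → v ∈ mem K
  inc-∈mem K₀ {v} K∈ = proj₂ (∈-filter⁻ (λ K → v ∈? mem K) {xs = Es} (inc⇒ K₀ K∈))

  inc-≢ : ∀ {K₀ v K} → K ∈ inc (just K₀) v → K ≢ K₀
  inc-≢ {K₀} {v} K∈ = proj₂ (∈-filter⁻ (λ K → ¬? (K ≟E K₀)) {xs = inc nothing v} K∈)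

  ∈-inc : ∀ {v K} → K ∈ Es → v ∈ mem K → K ∈ inc nothing v
  ∈-inc {v} = ∈-filter⁺ (λ K → v ∈? mem K)

  ∈-inc-just : ∀ {K₀ v K} → K ∈ Es → v ∈ mem K → K ≢ K₀ → K ∈ inc (just K₀) v
  ∈-inc-just {K₀} K∈ v∈ = ∈-filter⁺ (λ K → ¬? (K ≟E K₀)) (∈-inc K∈ v∈)

  inc-unique : ∀ K₀ v → Unique (inc K₀ v)
  inc-unique nothing   v = filter⁺ (λ K → v ∈? mem K) Es-unique
  inc-unique (just K₀) v = filter⁺ (λ K → ¬? (K ≟E K₀)) (inc-unique nothing v)

  oth-∈mem : ∀ {K v u} → u ∈ oth K v → u ∈ mem K
  oth-∈mem {K} {v} u∈ = proj₁ (∈-filter⁻ (λ u → ¬? (u ≟V v)) u∈)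

  oth-≢ : ∀ {K v u} → u ∈ oth K v → u ≢ v
  oth-≢ {K} {v} u∈ = proj₂ (∈-filter⁻ (λ u → ¬? (u ≟V v)) {xs = mem K} u∈)

  ∈-oth : ∀ {K v u} → u ∈ mem K → u ≢ v → u ∈ oth K v
  ∈-oth {v = v} = ∈-filter⁺ (λ u → ¬? (u ≟V v))

  oth-unique : ∀ {K} v → K ∈ Es → Unique (oth K v)
  oth-unique v K∈ = filter⁺ (λ u → ¬? (u ≟V v)) (mem-unique K∈)

  -- Only the immediate reuse of a hyperedge is forbidden; vertices may repeat, so a closed walk is
  -- the obstruction to be excluded.
  data Walk : Maybe E → V → V → ℕ → Set where
    nil  : ∀ {K₀ v} → Walk K₀ v v 0
    step : ∀ {K₀ v K u w n} → K ∈ inc K₀ v → u ∈ oth K v → Walk (just K) u w n → Walk K₀ v w (suc n)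

  -- Reversing p : u ⇝ w and continuing through K to z yields a nonbacktracking walk w ⇝ z.
  reverse-append : ∀ {K u w z v n m} → K ∈ Es → u ∈ mem K → v ∈ oth K u → Walk (just K) u w n → Walk (just K) v z m →
    Walk nothing w z (n + suc m)
  reverse-append K∈ u∈ v∈ nil q = step (∈-inc K∈ u∈) v∈ q
  reverse-append {n = suc n} {m} K∈ u∈ v∈ (step K₁∈ u₁∈ p) q = subst (Walk nothing _ _) (ℕₚ.+-suc n (suc m))
    (reverse-append (inc-∈Es (just _) K₁∈) (oth-∈mem u₁∈)
      (∈-oth (inc-∈mem (just _) K₁∈) (λ eq → oth-≢ u₁∈ (sym eq))) p
      (step (∈-inc-just K∈ u∈ (λ eq → inc-≢ K₁∈ (sym eq))) v∈ q))

  -- The tree recursion: if the branches at v were independent, this would be the probability that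
  -- no hyperedge at v is completed, where `a` is activity in the current round and `c` acceptance
  -- in earlier ones. A member u is evaluated with K ignored because K leads back to v.
  survival : (V → ℚ) → (Maybe E → V → ℚ) → Maybe E → V → ℚ
  survival a c K₀ v = ∏ (inc K₀ v) (λ K → 1ℚ -ℚ ∏ (oth K v) (λ u → c (just K) u +ℚ a u))

  -- At a vertex point, cum x i K₀ v tells whether v has been accepted in one of the first i rounds when the
  -- hyperedge K₀ is ignored: v is accepted in its round unless some hyperedge at v has all other members
  -- accepted before or active in the same round.
  cum : (V → Point) → ℕ → Maybe E → V → ℚ
  cum x zero    K₀ v = 0ℚ
  cum x (suc i) K₀ v = cum x i K₀ v +ℚ x v i *ℚ survival (λ u → x u i) (cum x i) K₀ v

  survival-cong : ∀ {a a′ c c′} → (∀ u → a u ≡ a′ u) → (∀ K u → c K u ≡ c′ K u) → ∀ K₀ v →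
    survival a c K₀ v ≡ survival a′ c′ K₀ v
  survival-cong ha hc K₀ v = ∏-cong (inc K₀ v) (λ {K} _ → cong (1ℚ -ℚ_) (∏-cong (oth K v) (λ {u} _ → cong₂ _+ℚ_ (hc (just K) u) (ha u))))

  cum-cong : ∀ {x y} → (∀ v → x v ≡ y v) → ∀ i K₀ v → cum x i K₀ v ≡ cum y i K₀ v
  cum-cong h zero    K₀ v = refl
  cum-cong h (suc i) K₀ v = cong₂ _+ℚ_ (cum-cong h i K₀ v)
    (cong₂ _*ℚ_ (cong (λ w → w i) (h v)) (survival-cong (λ u → cong (λ w → w i) (h u)) (cum-cong h i) K₀ v))

  survival-bounds : ∀ {a c} → (∀ K u → 0ℚ ≤ℚ c K u +ℚ a u × c K u +ℚ a u ≤ℚ 1ℚ) → ∀ K₀ v →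
    0ℚ ≤ℚ survival a c K₀ v × survival a c K₀ v ≤ℚ 1ℚ
  survival-bounds {a} {c} h K₀ v = ∏-nonneg (inc K₀ v) (λ {K} _ → 0≤f K) , ∏≤1 (inc K₀ v) (λ {K} _ → 0≤f K) (λ {K} _ → f≤1 K)
    where
    0≤f : ∀ K → 0ℚ ≤ℚ 1ℚ -ℚ ∏ (oth K v) (λ u → c (just K) u +ℚ a u)
    0≤f K = p≤q⇒0≤q-p (∏≤1 (oth K v) (λ {u} _ → proj₁ (h (just K) u)) (λ {u} _ → proj₂ (h (just K) u)))
    f≤1 : ∀ K → 1ℚ -ℚ ∏ (oth K v) (λ u → c (just K) u +ℚ a u) ≤ℚ 1ℚ
    f≤1 K = p-q≤p (∏-nonneg (oth K v) (λ {u} _ → proj₁ (h (just K) u)))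

  module Rounds (ρ : ℕ) where
    open Affine ρ

    -- Acceptance never exceeds the label mass spent so far, so adding the activity of the next
    -- round stays below the total mass 1. This keeps every survival factor in the unit interval.
    cum-bounds : ∀ {x} → (∀ v → Subprobability (x v)) → ∀ i → i ≤ ρ → ∀ K₀ v →
      0ℚ ≤ℚ cum x i K₀ v × cum x i K₀ v ≤ℚ ∑< i (x v)
    cum-bounds {x} sx zero    _   K₀ v = ℚₚ.≤-refl , ℚₚ.≤-refl
    cum-bounds {x} sx (suc i) i<ρ K₀ v =
      +-nonneg (proj₁ (ih K₀ v)) (*-nonneg (proj₁ (sx v) i) (proj₁ surv)) ,
      ℚₚ.+-mono-≤ (proj₂ (ih K₀ v)) (subst (x v i *ℚ survival (λ u → x u i) (cum x i) K₀ v ≤ℚ_) (ℚₚ.*-identityʳ (x v i))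
        (*-monoˡ (proj₁ (sx v) i) (proj₂ surv)))
      where
      ih = cum-bounds sx i (ℕₚ.<⇒≤ i<ρ)
      surv = survival-bounds {λ u → x u i} {cum x i} (λ K u → +-nonneg (proj₁ (ih K u)) (proj₁ (sx u) i) ,
        ℚₚ.≤-trans (ℚₚ.+-monoˡ-≤ (x u i) (proj₂ (ih K u))) (ℚₚ.≤-trans (∑<-monoˡ (proj₁ (sx u)) i<ρ) (proj₂ (sx u)))) K₀ v

    cum≤1 : ∀ {x} → (∀ v → Subprobability (x v)) → ∀ K₀ v → cum x ρ K₀ v ≤ℚ 1ℚ
    cum≤1 sx K₀ v = ℚₚ.≤-trans (proj₂ (cum-bounds sx ρ ℕₚ.≤-refl K₀ v)) (proj₂ (sx v))

    module _ (no-cycle : ∀ {v n} → suc n ≤ ρ + ρ → Walk nothing v v (suc n) → ⊥)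
             (x : V → Point) (u₀ : V) where

      -- The evidence for `Dependence`: the value at v after i rounds can feel the coordinate of u₀
      -- only along such a walk.
      Reach : Maybe E → V → ℕ → Set
      Reach K₀ v i = ∃ λ n → n ≤ i × Walk K₀ v u₀ n

      -- Reversing one walk, crossing K and following the other closes up at u₀ after n + 1 + m
      -- steps, which is at most 2ρ.
      no-branching : ∀ {i K u u′} → suc i ≤ ρ → K ∈ Es → u ∈ mem K → u′ ∈ mem K → u ≢ u′ →
        Reach (just K) u i → Reach (just K) u′ i → ⊥
      no-branching {i} i<ρ K∈ u∈ u′∈ u≢u′ (n , n≤i , p) (m , m≤i , q) = no-cycle
        (subst (_≤ ρ + ρ) (ℕₚ.+-suc n m) (ℕₚ.+-mono-≤ (ℕₚ.≤-trans n≤i (ℕₚ.<⇒≤ i<ρ)) (ℕₚ.≤-trans (s≤s m≤i) i<ρ)))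
        (subst (Walk nothing u₀ u₀) (ℕₚ.+-suc n m) (reverse-append K∈ u∈ (∈-oth u′∈ (λ eq → u≢u′ (sym eq))) p q))

      -- Three kinds of products occur: over the members of one hyperedge, over the hyperedges at v,
      -- and between the label of v and its survival. Whenever two factors both feel u₀, their walks
      -- combine to a closed nonbacktracking walk at u₀ of length at most 2ρ.
      cum-dependence : ∀ i → i ≤ ρ → ∀ K₀ v → Dependence (λ w → cum (_[_≔_] _≟V_ x u₀ w) i K₀ v) (Reach K₀ v i)
      coordinate-dependence : ∀ i → i < ρ → ∀ v → Dependence (λ w → _[_≔_] _≟V_ x u₀ w v i) (v ≡ u₀)
      coordinate-dependence i i<ρ v with v ≟V u₀
      ... | yes v≡u₀ = inj₂ (aff-coordinate i<ρ , v≡u₀)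
      ... | no _     = inj₁ (λ _ _ → refl)

      cum-dependence zero    _   K₀ v = inj₁ (λ _ _ → refl)
      cum-dependence (suc i) i<ρ K₀ v = dep-+
        (dep-map (λ { (n , n≤i , p) → n , ℕₚ.m≤n⇒m≤1+n n≤i , p }) (cum-dependence i i≤ρ K₀ v))
        (dep-map (λ { (inj₁ refl) → 0 , z≤n , nil
                    ; (inj₂ (K , K∈ , u , u∈ , n , n≤i , p)) → suc n , s≤s n≤i , step K∈ u∈ p })
          (dep-* (coordinate-dependence i i<ρ v)
            (dep-∏ (inc K₀ v) (λ K → ∃ λ u → u ∈ oth K v × Reach (just K) u i) (inc-unique K₀ v)
              (λ {K} K∈ → dep-1- (dep-∏ (oth K v) (λ u → Reach (just K) u i) (oth-unique v (inc-∈Es K₀ K∈))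
                (λ {u} u∈ → dep-+ (cum-dependence i i≤ρ (just K) u)
                  (dep-map (λ { refl → 0 , z≤n , nil }) (coordinate-dependence i i<ρ u)))
                (λ u∈ u′∈ u≢u′ → no-branching i<ρ (inc-∈Es K₀ K∈) (oth-∈mem u∈) (oth-∈mem u′∈) u≢u′)))
              (λ { K∈ K′∈ K≢K′ (u , u∈ , n , n≤i , p) (u′ , u′∈ , m , m≤i , q) →
                no-cycle (ℕₚ.+-mono-≤ (ℕₚ.≤-trans (s≤s n≤i) i<ρ) (ℕₚ.≤-trans (s≤s m≤i) i<ρ))
                  (subst (Walk nothing u₀ u₀) (ℕₚ.+-suc n (suc m))
                    (reverse-append (inc-∈Es K₀ K∈) (oth-∈mem u∈) (∈-oth (inc-∈mem K₀ K∈) (λ eq → oth-≢ u∈ (sym eq))) p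
                      (step (∈-inc-just (inc-∈Es K₀ K′∈) (inc-∈mem K₀ K′∈) (λ eq → K≢K′ (sym eq))) u′∈ q))) }))
            (λ { refl (K , K∈ , u , u∈ , n , n≤i , p) →
              no-cycle (ℕₚ.≤-trans (s≤s n≤i) (ℕₚ.≤-trans i<ρ (ℕₚ.m≤m+n ρ ρ))) (step (inc⇒ K₀ K∈) u∈ p) })))
        where
        i≤ρ = ℕₚ.<⇒≤ i<ρ

    module Independent (x : V → Point) (ℓ : V → ℕ) (x≡e : ∀ v → x v ≡ e (ℓ v)) where

      private
        surv : ℕ → Maybe E → V → ℚ
        surv i = survival (λ u → x u i) (cum x i)

        x-diag : ∀ v → x v (ℓ v) ≡ 1ℚ
        x-diag v rewrite x≡e v = e-diag (ℓ v)

        x-off : ∀ v i → i ≢ ℓ v → x v i ≡ 0ℚ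
        x-off v i i≢ rewrite x≡e v = e-off (ℓ v) i i≢

      cum-before : ∀ i K₀ v → i ≤ ℓ v → cum x i K₀ v ≡ 0ℚ
      cum-before zero    K₀ v _   = refl
      cum-before (suc i) K₀ v i<ℓ = cong₂ _+ℚ_ (cum-before i K₀ v (ℕₚ.<⇒≤ i<ℓ))
        (trans (cong (_*ℚ surv i K₀ v) (x-off v i (ℕₚ.<⇒≢ i<ℓ))) (ℚₚ.*-zeroˡ (surv i K₀ v)))

      cum-unchanged : ∀ i K₀ v → i ≢ ℓ v → cum x (suc i) K₀ v ≡ cum x i K₀ v
      cum-unchanged i K₀ v i≢ℓ = trans
        (cong (cum x i K₀ v +ℚ_) (trans (cong (_*ℚ surv i K₀ v) (x-off v i i≢ℓ)) (ℚₚ.*-zeroˡ (surv i K₀ v))))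
        (ℚₚ.+-identityʳ (cum x i K₀ v))

      cum-after : ∀ i K₀ v → ℓ v < i → cum x i K₀ v ≡ surv (ℓ v) K₀ v
      cum-after (suc i) K₀ v ℓ<1+i with i ℕ.≟ ℓ v
      ... | yes refl = trans
        (cong₂ _+ℚ_ (cum-before i K₀ v ℕₚ.≤-refl)
          (trans (cong (_*ℚ surv i K₀ v) (x-diag v)) (ℚₚ.*-identityˡ (surv i K₀ v))))
        (ℚₚ.+-identityˡ (surv i K₀ v))
      ... | no i≢ℓ = trans (cum-unchanged i K₀ v i≢ℓ)
        (cum-after i K₀ v (ℕₚ.≤∧≢⇒< (ℕ.s≤s⁻¹ ℓ<1+i) (λ eq → i≢ℓ (sym eq))))

      survival-factor-bit : ∀ i → (∀ K u → Bit (cum x i K u)) → ∀ K v → Bit (1ℚ -ℚ ∏ (oth K v) (λ u → cum x i (just K) u +ℚ x u i))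
      survival-factor-bit i h K v with ∏-bit (oth K v) {λ u → cum x i (just K) u +ℚ x u i} (λ {u} _ → z-bit u)
        where
        z-bit : ∀ u → Bit (cum x i (just K) u +ℚ x u i)
        z-bit u with i ℕ.≟ ℓ u
        ... | yes refl = inj₂ (cong₂ _+ℚ_ (cum-before i (just K) u ℕₚ.≤-refl) (x-diag u))
        ... | no i≢ℓ with h (just K) u
        ... | inj₁ p = inj₁ (cong₂ _+ℚ_ p (x-off u i i≢ℓ))
        ... | inj₂ p = inj₂ (cong₂ _+ℚ_ p (x-off u i i≢ℓ))
      ... | inj₁ p = inj₂ (cong (1ℚ -ℚ_) p)
      ... | inj₂ p = inj₁ (cong (1ℚ -ℚ_) p)

      cum-bit : ∀ i K₀ v → Bit (cum x i K₀ v)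
      surv-bit : ∀ i K₀ v → Bit (surv i K₀ v)
      surv-bit i K₀ v = ∏-bit (inc K₀ v) (λ {K} _ → survival-factor-bit i (cum-bit i) K v)
      cum-bit zero    K₀ v = inj₁ refl
      cum-bit (suc i) K₀ v with i ℕ.≟ ℓ v
      ... | yes i≡ℓ  = subst Bit (sym (cum-after (suc i) K₀ v (s≤s (ℕₚ.≤-reflexive (sym i≡ℓ)))))
                      (subst (λ j → Bit (surv j K₀ v)) i≡ℓ (surv-bit i K₀ v))
      ... | no i≢ℓ   = subst Bit (sym (cum-unchanged i K₀ v i≢ℓ)) (cum-bit i K₀ v)

      survived : ∀ {v} → 0ℚ <ℚ cum x ρ nothing v → ℓ v < ρ × 0ℚ <ℚ surv (ℓ v) nothing v
      survived {v} pos with ℓ v ℕ.<? ρ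
      ... | yes ℓ<ρ = ℓ<ρ , subst (0ℚ <ℚ_) (cum-after ρ nothing v ℓ<ρ) pos
      ... | no ℓ≮ρ  = ⊥-elim (0≮0 (cum-before ρ nothing v (ℕₚ.≮⇒≥ ℓ≮ρ)) pos)

      survived-factor : ∀ i {K v} → 0ℚ <ℚ surv i nothing v → K ∈ inc nothing v →
        1ℚ -ℚ ∏ (oth K v) (λ u → cum x i (just K) u +ℚ x u i) ≡ 1ℚ
      survived-factor i {K} {v} pos K∈ with survival-factor-bit i (cum-bit i) K v
      ... | inj₁ p = ⊥-elim (0≮0 (∏-factor-0 K∈ p) pos)
      ... | inj₂ p = p

      survived-just : ∀ i {K v} → 0ℚ <ℚ surv i nothing v → surv i (just K) v ≡ 1ℚ
      survived-just i {K} {v} pos = ∏≡1 (inc (just K) v) (λ {K′} K′∈ → survived-factor i pos (inc⇒ (just K) K′∈))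

      latest : ∀ v (vs : List V) → ∃ λ u → u ∈ v ∷ vs × (∀ {w} → w ∈ v ∷ vs → ℓ w ≤ ℓ u)
      latest v []        = v , here refl , λ { (here refl) → ℕₚ.≤-refl }
      latest v (v′ ∷ vs) with latest v′ vs
      ... | u , u∈ , max with ℕₚ.≤-total (ℓ v) (ℓ u)
      ... | inj₁ v≤u = u , there u∈ , λ { (here refl) → v≤u ; (there w∈) → max w∈ }
      ... | inj₂ u≤v = v , here refl , λ { (here refl) → ℕₚ.≤-refl ; (there w∈) → ℕₚ.≤-trans (max w∈) u≤v }

      -- Take the member v of K with the largest label. Every other member is active in the same
      -- round or was accepted earlier; in the latter case it is accepted also with K ignored, since
      -- dropping a hyperedge removes a factor that is 1. So the factor of K in the survival of v is
      -- 1 - 1, and v was not accepted.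
      independent : ∀ {K v} → K ∈ Es → v ∈ mem K → ¬ (∀ {u} → u ∈ mem K → 0ℚ <ℚ cum x ρ nothing u)
      independent {K} K∈ v∈ pos with mem K in eq
      ... | v₀ ∷ vs with latest v₀ vs
      ... | v , v∈K , max = contradiction (trans (sym (survived-factor (ℓ v) (proj₂ (survived (pos v∈K))) (∈-inc K∈ (subst (v ∈_) (sym eq) v∈K))))
              (cong (1ℚ -ℚ_) (∏≡1 (oth K v) (λ {u} u∈ → all-chosen u (subst (u ∈_) eq (oth-∈mem u∈)))))) (λ ())
        where
        all-chosen : ∀ u → u ∈ v₀ ∷ vs → cum x (ℓ v) (just K) u +ℚ x u (ℓ v) ≡ 1ℚ
        all-chosen u u∈ with ℓ v ℕ.≟ ℓ u
        ... | yes eq = trans (cong₂ _+ℚ_ (cum-before (ℓ v) (just K) u (ℕₚ.≤-reflexive eq)) (trans (cong (x u) eq) (x-diag u))) refl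
        ... | no ℓv≢ℓu = cong₂ _+ℚ_
          (trans (cum-after (ℓ v) (just K) u (ℕₚ.≤∧≢⇒< (max u∈) (λ eq → ℓv≢ℓu (sym eq)))) (survived-just (ℓ u) (proj₂ (survived (pos u∈)))))
          (x-off u (ℓ v) ℓv≢ℓu)

    module Fractional (Γ : ℚ) (0≤Γ : 0ℚ ≤ℚ Γ) (ρΓ≡1 : ι ρ *ℚ Γ ≡ 1ℚ) (Δ k : ℕ)
      (degree≤Δ : ∀ v → length (inc nothing v) ≤ Δ)
      (k≤oth : ∀ {K v} → K ∈ inc nothing v → k ≤ length (oth K v)) where

      -- The five Γ are the bound 2Γ on acceptance, doubled for the ignored hyperedge, plus Γ for
      -- current activity. `ε` then bounds the probability that one hyperedge blocks.
      ζ ε : ℚ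
      ζ = ((Γ +ℚ Γ) +ℚ (Γ +ℚ Γ)) +ℚ Γ
      ε = ζ ^ℚ k

      module _ (ζ≤1 : ζ ≤ℚ 1ℚ) (ε≤½ : ε +ℚ ε ≤ℚ 1ℚ) (Γ≤survival : Γ ≤ℚ (1ℚ -ℚ ε) ^ℚ Δ) where

        -- A vertex is active with probability Γ in every round until it has been accepted with total
        -- probability Γ.  This keeps all acceptance probabilities of the same order, whatever the degrees are.
        opaque
          active : (Maybe E → V → ℚ) → V → ℚ
          active c v = ⟦ c nothing v <ℚ? Γ ⟧ *ℚ Γ

          active-cases : ∀ c v → (c nothing v <ℚ Γ × active c v ≡ Γ) ⊎ (Γ ≤ℚ c nothing v × active c v ≡ 0ℚ)
          active-cases c v with c nothing v <ℚ? Γ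
          ... | yes c<Γ = inj₁ (c<Γ , ℚₚ.*-identityˡ Γ)
          ... | no c≮Γ  = inj₂ (ℚₚ.≮⇒≥ c≮Γ , ℚₚ.*-zeroˡ Γ)

        -- The activity of a round is read off from the acceptance probabilities reached before it,
        -- so both are defined together. It consults only the value at `nothing`, which makes
        -- `fractional` depend on v alone.
        accepted : ℕ → Maybe E → V → ℚ
        accepted zero    K₀ v = 0ℚ
        accepted (suc i) K₀ v = accepted i K₀ v +ℚ active (accepted i) v *ℚ survival (active (accepted i)) (accepted i) K₀ v

        fractional : V → Point
        fractional v i = active (accepted i) v

        accepted≡cum : ∀ i K₀ v → accepted i K₀ v ≡ cum fractional i K₀ v
        accepted≡cum zero    K₀ v = refl
        accepted≡cum (suc i) K₀ v = cong₂ _+ℚ_ (accepted≡cum i K₀ v)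
          (cong (active (accepted i) v *ℚ_) (survival-cong (λ _ → refl) (accepted≡cum i) K₀ v))

        active-nonneg : ∀ c v → 0ℚ ≤ℚ active c v
        active-nonneg c v with active-cases c v
        ... | inj₁ (_ , eq) = ℚₚ.≤-trans 0≤Γ (ℚₚ.≤-reflexive (sym eq))
        ... | inj₂ (_ , eq) = ℚₚ.≤-reflexive (sym eq)

        active≤Γ : ∀ c v → active c v ≤ℚ Γ
        active≤Γ c v with active-cases c v
        ... | inj₁ (_ , eq) = ℚₚ.≤-reflexive eq
        ... | inj₂ (_ , eq) = ℚₚ.≤-trans (ℚₚ.≤-reflexive eq) 0≤Γ

        0≤ζ : 0ℚ ≤ℚ ζ
        0≤ζ = +-nonneg (+-nonneg (+-nonneg 0≤Γ 0≤Γ) (+-nonneg 0≤Γ 0≤Γ)) 0≤Γ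

        -- `≤2Γ` allows for one overshoot: the last increment starts below Γ and is at most Γ. `≤2c`
        -- is the price of one ignored hyperedge, whose factor is at least 1/2.
        record Controlled (c : Maybe E → V → ℚ) : Set where
          field
            nonneg : ∀ K₀ v → 0ℚ ≤ℚ c K₀ v
            ≤2Γ    : ∀ v → c nothing v ≤ℚ Γ +ℚ Γ
            ≤2c    : ∀ K₀ v → c K₀ v ≤ℚ c nothing v +ℚ c nothing v

          factor : V → E → ℚ
          factor v K = 1ℚ -ℚ ∏ (oth K v) (λ u → c (just K) u +ℚ active c u)

          z-nonneg : ∀ K u → 0ℚ ≤ℚ c (just K) u +ℚ active c u
          z-nonneg K u = +-nonneg (nonneg (just K) u) (active-nonneg c u)

          z≤ζ : ∀ K u → c (just K) u +ℚ active c u ≤ℚ ζ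
          z≤ζ K u = ℚₚ.+-mono-≤ (ℚₚ.≤-trans (≤2c (just K) u) (ℚₚ.+-mono-≤ (≤2Γ u) (≤2Γ u))) (active≤Γ c u)

          blocked≤ε : ∀ {K v} → K ∈ inc nothing v → ∏ (oth K v) (λ u → c (just K) u +ℚ active c u) ≤ℚ ε
          blocked≤ε {K} {v} K∈ = ℚₚ.≤-trans (∏-mono (oth K v) (λ {u} _ → z-nonneg K u) (λ {u} _ → z≤ζ K u))
            (ℚₚ.≤-trans (ℚₚ.≤-reflexive (∏-const (oth K v) ζ)) (^-antitone 0≤ζ ζ≤1 (k≤oth K∈)))

          ε≤1 : ε ≤ℚ 1ℚ
          ε≤1 = ^≤1 k 0≤ζ ζ≤1

          1-ε≤factor : ∀ {K v} → K ∈ inc nothing v → 1ℚ -ℚ ε ≤ℚ factor v K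
          1-ε≤factor K∈ = sub-mono {1ℚ} ℚₚ.≤-refl (blocked≤ε K∈)

          factor-nonneg : ∀ {K v} → K ∈ inc nothing v → 0ℚ ≤ℚ factor v K
          factor-nonneg K∈ = ℚₚ.≤-trans (p≤q⇒0≤q-p ε≤1) (1-ε≤factor K∈)

          1≤2factor : ∀ {K v} → K ∈ inc nothing v → 1ℚ ≤ℚ factor v K +ℚ factor v K
          1≤2factor K∈ = ℚₚ.≤-trans
            (0≤q-p⇒p≤q (subst (0ℚ ≤ℚ_) (solve 1 (λ e → con 1ℚ :- (e :+ e) := (con 1ℚ :- e) :+ (con 1ℚ :- e) :- con 1ℚ) refl ε)
              (p≤q⇒0≤q-p ε≤½)))
            (ℚₚ.+-mono-≤ (1-ε≤factor K∈) (1-ε≤factor K∈))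

          surv : Maybe E → V → ℚ
          surv = survival (active c) c

          surv-nonneg : ∀ K₀ v → 0ℚ ≤ℚ surv K₀ v
          surv-nonneg K₀ v = ∏-nonneg (inc K₀ v) (λ K∈ → factor-nonneg (inc⇒ K₀ K∈))

          surv≤1 : ∀ K₀ v → surv K₀ v ≤ℚ 1ℚ
          surv≤1 K₀ v = ∏≤1 (inc K₀ v) (λ K∈ → factor-nonneg (inc⇒ K₀ K∈))
            (λ {K} _ → p-q≤p (∏-nonneg (oth K v) (λ {u} _ → z-nonneg K u)))

          surv≤2surv : ∀ K₀ v → surv K₀ v ≤ℚ surv nothing v +ℚ surv nothing v
          surv≤2surv nothing   v = p≤p+q (surv-nonneg nothing v)
          surv≤2surv (just K₀) v = ∏-filter-≢ _≟E_ K₀ (inc nothing v) (inc-unique nothing v) factor-nonneg 1≤2factor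

          Γ≤surv : ∀ v → Γ ≤ℚ surv nothing v
          Γ≤surv v = ℚₚ.≤-trans Γ≤survival (ℚₚ.≤-trans
            (^-antitone (p≤q⇒0≤q-p ε≤1) (p-q≤p (0≤^ k 0≤ζ)) (degree≤Δ v))
            (ℚₚ.≤-trans (ℚₚ.≤-reflexive (sym (∏-const (inc nothing v) (1ℚ -ℚ ε))))
              (∏-mono (inc nothing v) (λ _ → p≤q⇒0≤q-p ε≤1) 1-ε≤factor)))

        controlled : ∀ i → Controlled (accepted i)
        controlled zero = record { nonneg = λ _ _ → ℚₚ.≤-refl ; ≤2Γ = λ _ → +-nonneg 0≤Γ 0≤Γ ; ≤2c = λ _ _ → ℚₚ.≤-refl }
        controlled (suc i) = record
          { nonneg = λ K₀ v → +-nonneg (nonneg K₀ v) (*-nonneg (active-nonneg c v) (surv-nonneg K₀ v))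
          ; ≤2Γ    = next≤2Γ
          ; ≤2c    = λ K₀ v → ℚₚ.≤-trans
              (ℚₚ.+-mono-≤ (≤2c K₀ v) (*-monoˡ (active-nonneg c v) (surv≤2surv K₀ v)))
              (ℚₚ.≤-reflexive (solve 3 (λ a b s → (a :+ a) :+ b :* (s :+ s) := (a :+ b :* s) :+ (a :+ b :* s)) refl
                (c nothing v) (active c v) (surv nothing v)))
          }
          where
          open Controlled (controlled i)
          c = accepted i
          next≤2Γ : ∀ v → accepted (suc i) nothing v ≤ℚ Γ +ℚ Γ
          next≤2Γ v with active-cases c v
          ... | inj₁ (c<Γ , eq) = ℚₚ.+-mono-≤ (ℚₚ.<⇒≤ c<Γ) (ℚₚ.≤-trans (ℚₚ.≤-reflexive (cong (_*ℚ surv nothing v) eq))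
            (ℚₚ.≤-trans (*-monoˡ 0≤Γ (surv≤1 nothing v)) (ℚₚ.≤-reflexive (ℚₚ.*-identityʳ Γ))))
          ... | inj₂ (_ , eq) = ℚₚ.≤-trans (ℚₚ.≤-reflexive (trans
            (cong (c nothing v +ℚ_) (trans (cong (_*ℚ surv nothing v) eq) (ℚₚ.*-zeroˡ (surv nothing v))))
            (ℚₚ.+-identityʳ (c nothing v)))) (≤2Γ v)

        fractional-subprobability : ∀ v → Subprobability (fractional v)
        fractional-subprobability v = (λ i → active-nonneg (accepted i) v) ,
          ℚₚ.≤-trans (∑<-mono ρ (λ {i} _ → active≤Γ (accepted i) v)) (ℚₚ.≤-reflexive (trans (∑<-const ρ Γ) ρΓ≡1))

        -- An active round adds Γ times a survival of at least Γ, and a vertex becomes inactive only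
        -- after reaching Γ. After ρ rounds both alternatives give Γ, as ρ Γ² = Γ.
        progress : ∀ i v → Γ ≤ℚ accepted i nothing v ⊎ ι i *ℚ (Γ *ℚ Γ) ≤ℚ accepted i nothing v
        progress zero    v = inj₂ (ℚₚ.≤-reflexive (ℚₚ.*-zeroˡ (Γ *ℚ Γ)))
        progress (suc i) v with active-cases (accepted i) v
        ... | inj₂ (Γ≤c , _) = inj₁ (ℚₚ.≤-trans Γ≤c (p≤p+q (*-nonneg (active-nonneg (accepted i) v) (surv-nonneg nothing v))))
          where open Controlled (controlled i)
        ... | inj₁ (c<Γ , eq) with progress i v
        ... | inj₁ Γ≤c = ⊥-elim (ℚₚ.<-irrefl refl (ℚₚ.<-≤-trans c<Γ Γ≤c))
        ... | inj₂ h = inj₂ (ℚₚ.≤-trans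
                (ℚₚ.≤-reflexive (solve 2 (λ n q → (con 1ℚ :+ n) :* q := n :* q :+ q) refl (ι i) (Γ *ℚ Γ)))
                (ℚₚ.+-mono-≤ h (ℚₚ.≤-trans (*-monoˡ 0≤Γ (Γ≤surv v))
                  (ℚₚ.≤-reflexive (cong (_*ℚ surv nothing v) (sym eq))))))
          where
          open Controlled (controlled i)

        Γ≤accepted : ∀ v → Γ ≤ℚ accepted ρ nothing v
        Γ≤accepted v with progress ρ v
        ... | inj₁ h = h
        ... | inj₂ h = subst (_≤ℚ accepted ρ nothing v)
          (trans (sym (ℚₚ.*-assoc (ι ρ) Γ Γ)) (trans (cong (_*ℚ Γ) ρΓ≡1) (ℚₚ.*-identityˡ Γ))) h

        independent-set : (us : List V) → (∀ v → v ∈ us) → (vs : List V) →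
          (∀ {v n} → suc n ≤ ρ + ρ → Walk nothing v v (suc n) → ⊥) →
          ∃ λ (c : V → ℚ) → (∀ v → c v ≤ℚ 1ℚ) ×
            (∀ {K v} → K ∈ Es → v ∈ mem K → ¬ (∀ {u} → u ∈ mem K → 0ℚ <ℚ c u)) ×
            ι (length vs) *ℚ Γ ≤ℚ ∑ vs c
        independent-set us all∈us vs no-cycle =
          let y , F≤ , vertex = round _≟V_ F (λ {x} {x′} h → ∑-cong vs (λ {v} _ → cum-cong h ρ nothing v))
                (λ x u → aff-∑ vs (λ {v} _ → dependence⇒aff (cum-dependence no-cycle x u ρ ℕₚ.≤-refl nothing v)))
                us fractional fractional-subprobability
              ℓ  = λ v → proj₁ (vertex v (inj₁ (all∈us v)))
              y≡ = λ v → proj₂ (vertex v (inj₁ (all∈us v)))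
          in (λ v → cum y ρ nothing v) ,
             (λ v → cum≤1 (λ u → subst Subprobability (sym (y≡ u)) (e-subprobability (ℓ u))) nothing v) ,
             Independent.independent y ℓ y≡ ,
             ℚₚ.≤-trans (ℚₚ.≤-reflexive (sym (∑-const vs Γ)))
               (ℚₚ.≤-trans (∑-mono vs (λ {v} _ → subst (Γ ≤ℚ_) (accepted≡cum ρ nothing v) (Γ≤accepted v))) F≤)
          where
          F : (V → Point) → ℚ
          F x = ∑ vs (cum x ρ nothing)

-- Making a hypergraph locally tree-like

∑≤length-filter : ∀ {A : Set} {P : A → Set} (P? : Decidable P) (xs : List A) {f : A → ℚ} →
  (∀ {x} → x ∈ xs → f x ≤ℚ ⟦ P? x ⟧) → ∑ xs f ≤ℚ ι (length (filter P? xs))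
∑≤length-filter P? []       h = ℚₚ.≤-refl
∑≤length-filter P? (x ∷ xs) {f} h with P? x | h (here refl)
... | yes _ | f≤1 = ℚₚ.+-mono-≤ f≤1 (∑≤length-filter P? xs (h ∘ there))
... | no _  | f≤0 = subst (f x +ℚ ∑ xs f ≤ℚ_) (ℚₚ.+-identityˡ (ι (length (filter P? xs)))) (ℚₚ.+-mono-≤ f≤0 (∑≤length-filter P? xs (h ∘ there)))

length-filter≤∑ : ∀ {A : Set} {P : A → Set} (P? : Decidable P) (xs : List A) {f : A → ℚ} →
  (∀ {x} → x ∈ xs → ⟦ P? x ⟧ ≤ℚ f x) → ι (length (filter P? xs)) ≤ℚ ∑ xs f
length-filter≤∑ P? []       h = ℚₚ.≤-refl
length-filter≤∑ P? (x ∷ xs) {f} h with P? x | h (here refl)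
... | yes _ | 1≤f = ℚₚ.+-mono-≤ 1≤f (length-filter≤∑ P? xs (h ∘ there))
... | no _  | 0≤f = subst (_≤ℚ f x +ℚ ∑ xs f) (ℚₚ.+-identityˡ (ι (length (filter P? xs)))) (ℚₚ.+-mono-≤ 0≤f (length-filter≤∑ P? xs (h ∘ there)))

filter-swap : ∀ {A : Set} {P Q : A → Set} (P? : Decidable P) (Q? : Decidable Q) (xs : List A) →
  filter P? (filter Q? xs) ≡ filter Q? (filter P? xs)
filter-swap P? Q? []       = refl
filter-swap P? Q? (x ∷ xs) with does (P? x) in p | does (Q? x) in q
... | true  | true  rewrite p | q = cong (x ∷_) (filter-swap P? Q? xs)
... | true  | false rewrite q = filter-swap P? Q? xs
... | false | true  rewrite p = filter-swap P? Q? xs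
... | false | false = filter-swap P? Q? xs

branch : ∀ {P : Set} → Dec P → ℚ → ℚ → ℚ
branch (yes _) a b = a
branch (no _)  a b = b

-- `Generic K S v` abstracts that K, entered at v, meets the points S seen so far in the expected
-- way only. Its one required consequence here is that the other members of K are fresh.
module Sparsification {V E : Set} (_≟V_ : DecidableEquality V) (_≟E_ : DecidableEquality E)
  (mem : E → List V) (Es : List E) (Es-unique : Unique Es) (mem-unique : ∀ {K} → K ∈ Es → Unique (mem K))
  (Generic : E → List V → V → Set) (generic? : ∀ K S v → Dec (Generic K S v))
  (generic-fresh : ∀ {K S v u} → Generic K S v → v ∈ S → u ∈ mem K → u ≢ v → u ∉ S) where

  open Hypergraph _≟V_ _≟E_ mem Es Es-unique mem-unique
  open import Data.List.Membership.DecPropositional _≟V_ using (_∈?_; _∉?_)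
  -- One label suffices: label 0 means that the point is kept, `e 1` that it is dropped.
  open Affine 1

  new : E → List V → List V
  new K S = filter (_∉? S) (mem K)

  new-∉ : ∀ {K S u} → u ∈ new K S → u ∉ S
  new-∉ {K} {S} u∈ = proj₂ (∈-filter⁻ (_∉? S) {xs = mem K} u∈)

  new-∈ : ∀ {K S u} → u ∈ new K S → u ∈ mem K
  new-∈ {K} {S} u∈ = proj₁ (∈-filter⁻ (_∉? S) {xs = mem K} u∈)

  -- The probability that all of K is kept, given that S is.
  weight : (V → Point) → E → List V → ℚ
  weight x K S = ∏ (new K S) (λ u → x u 0)

  -- The sum over the nonbacktracking walks from v of at most n hyperedges whose last step, and no earlier one,
  -- fails to be generic; S is the set of points seen so far.
  bad : (V → Point) → ℕ → List V → Maybe E → V → ℚ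
  bad x zero    S K₀ v = 0ℚ
  bad x (suc n) S K₀ v = ∑ (inc K₀ v) (λ K → weight x K S *ℚ
    branch (generic? K S v) (∑ (oth K v) (bad x n (mem K ++ S) (just K))) 1ℚ)

  deg : (V → Point) → V → ℚ
  deg x v = ∑ (inc nothing v) (λ K → weight x K (v ∷ []))

  weight-local : ∀ {x y S} K → (∀ {u} → u ∉ S → x u ≡ y u) → weight x K S ≡ weight y K S
  weight-local {S = S} K h = ∏-cong (new K S) (λ u∈ → cong (λ w → w 0) (h (new-∉ {K} u∈)))

  -- Points of S have been charged for already and contribute no further factor, however often a
  -- walk returns to them.
  bad-local : ∀ {x y} n S K₀ v → (∀ {u} → u ∉ S → x u ≡ y u) → bad x n S K₀ v ≡ bad y n S K₀ v
  bad-local zero    S K₀ v h = refl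
  bad-local {x} {y} (suc n) S K₀ v h = ∑-cong (inc K₀ v) (λ {K} _ → cong₂ _*ℚ_ (weight-local K h) (continue K))
    where
    continue : ∀ K → branch (generic? K S v) (∑ (oth K v) (bad x n (mem K ++ S) (just K))) 1ℚ
                   ≡ branch (generic? K S v) (∑ (oth K v) (bad y n (mem K ++ S) (just K))) 1ℚ
    continue K with generic? K S v
    ... | yes _ = ∑-cong (oth K v) (λ {u} _ → bad-local n (mem K ++ S) (just K) u (λ u∉ → h (u∉ ∘ ∈-++⁺ʳ (mem K))))
    ... | no _  = refl

  weight-nonneg : ∀ {x} → (∀ v → Subprobability (x v)) → ∀ K S → 0ℚ ≤ℚ weight x K S
  weight-nonneg sx K S = ∏-nonneg (new K S) (λ {u} _ → proj₁ (sx u) 0)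

  bad-nonneg : ∀ {x} → (∀ v → Subprobability (x v)) → ∀ n S K₀ v → 0ℚ ≤ℚ bad x n S K₀ v
  bad-nonneg sx zero    S K₀ v = ℚₚ.≤-refl
  bad-nonneg {x} sx (suc n) S K₀ v = ∑-nonneg (inc K₀ v) (λ {K} _ → *-nonneg (weight-nonneg sx K S) (continue K))
    where
    continue : ∀ K → 0ℚ ≤ℚ branch (generic? K S v) (∑ (oth K v) (bad x n (mem K ++ S) (just K))) 1ℚ
    continue K with generic? K S v
    ... | yes _ = ∑-nonneg (oth K v) (λ {u} _ → bad-nonneg sx n (mem K ++ S) (just K) u)
    ... | no _  = 0≤1

  module _ (x : V → Point) (u₀ : V) where

    private
      x[_] : Point → V → Point
      x[ w ] = _[_≔_] _≟V_ x u₀ w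

      agree : ∀ {w w′ u} → u ≢ u₀ → x[ w ] u ≡ x[ w′ ] u
      agree {w} {w′} u≢u₀ = trans (≔-other _≟V_ x w u≢u₀) (sym (≔-other _≟V_ x w′ u≢u₀))

      agree-off : ∀ {S w w′} → u₀ ∈ S → ∀ {u} → u ∉ S → x[ w ] u ≡ x[ w′ ] u
      agree-off {S} u₀∈S u∉S = agree (λ eq → u∉S (subst (_∈ S) (sym eq) u₀∈S))

    weight-aff : ∀ {K} S → K ∈ Es → Aff (λ w → weight x[ w ] K S)
    weight-aff {K} S K∈ = dependence⇒aff (dep-∏ (new K S) (_≡ u₀) (filter⁺ (_∉? S) (mem-unique K∈)) coordinate
      (λ { _ _ u≢u′ refl refl → u≢u′ refl }))
      where
      coordinate : ∀ {v} → v ∈ new K S → Dependence (λ w → x[ w ] v 0) (v ≡ u₀)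
      coordinate {v} _ with v ≟V u₀
      ... | yes eq = inj₂ (aff-coordinate (s≤s z≤n) , eq)
      ... | no _   = inj₁ (λ _ _ → refl)

    -- If u₀ lies in K, the continuation counts it among the seen points and does not vary with it;
    -- otherwise the weight of K does not. So no tree-likeness is assumed here.
    bad-aff : ∀ n S K₀ v → Aff (λ w → bad x[ w ] n S K₀ v)
    bad-aff zero    S K₀ v = const⇒aff (λ _ _ → refl)
    bad-aff (suc n) S K₀ v = aff-∑ (inc K₀ v) term-aff
      where
      term-aff : ∀ {K} → K ∈ inc K₀ v → Aff (λ w → weight x[ w ] K S *ℚ
        branch (generic? K S v) (∑ (oth K v) (bad x[ w ] n (mem K ++ S) (just K))) 1ℚ)
      term-aff {K} K∈ with generic? K S v
      ... | no _ = aff-*ʳ (weight-aff S (inc-∈Es K₀ K∈)) (λ _ _ → refl)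
      ... | yes _ with u₀ ∈? mem K
      ...   | yes u₀∈K = aff-*ʳ (weight-aff S (inc-∈Es K₀ K∈)) (λ w w′ → ∑-cong (oth K v) (λ {u} _ →
                bad-local n (mem K ++ S) (just K) u (agree-off (∈-++⁺ˡ u₀∈K))))
      ...   | no u₀∉K  = aff-*ˡ (λ w w′ → ∏-cong (new K S) (λ {u} u∈ →
                  cong (λ w → w 0) (agree (λ eq → u₀∉K (subst (_∈ mem K) eq (new-∈ {K} {S} u∈))))))
                (aff-∑ (oth K v) (λ {u} _ → bad-aff n (mem K ++ S) (just K) u))

    deg-aff : ∀ v → Aff (λ w → deg x[ w ] v)
    deg-aff v = aff-∑ (inc nothing v) (λ K∈ → weight-aff (v ∷ []) (inc-∈Es nothing K∈))

    -- Both counts start with v already seen, hence are constant in the coordinate of v and may be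
    -- multiplied by it.
    penalty-aff : ∀ (δ : ℚ) L v →
      Aff (λ w → x[ w ] v 0 *ℚ (1ℚ -ℚ (bad x[ w ] L (v ∷ []) nothing v +ℚ δ *ℚ deg x[ w ] v)))
    penalty-aff δ L v with v ≟V u₀
    ... | yes refl = aff-*ʳ (aff-coordinate (s≤s z≤n)) (λ w w′ → cong (1ℚ -ℚ_) (cong₂ _+ℚ_
            (bad-local L (v ∷ []) nothing v (agree-off (here refl)))
            (cong (δ *ℚ_) (∑-cong (inc nothing v) (λ {K} _ → weight-local K (agree-off (here refl)))))))
    ... | no _ = aff-*ˡ {f = λ _ → x v 0} (λ _ _ → refl)
            (aff-1- (aff-+ (bad-aff L (v ∷ []) nothing v) (aff-*ˡ {f = λ _ → δ} (λ _ _ → refl) (deg-aff v))))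

  -- A hyperedge whose members are all kept has weight 1, and all terms are nonnegative, so its own
  -- term is below 1. The term of a nongeneric one would be exactly 1.
  bad-step : ∀ {x} → (∀ v → Subprobability (x v)) → ∀ {n S K₀ v K} → bad x (suc n) S K₀ v <ℚ 1ℚ → K ∈ inc K₀ v →
    (∀ {u} → u ∈ mem K → x u 0 ≡ 1ℚ) → Generic K S v × (∀ {u} → u ∈ oth K v → bad x n (mem K ++ S) (just K) u <ℚ 1ℚ)
  bad-step {x} sx {n} {S} {K₀} {v} {K} bad<1 K∈ present = conclude (ℚₚ.≤-<-trans
    (subst (_≤ℚ bad x (suc n) S K₀ v) (trans (cong (_*ℚ term K) (∏≡1 (new K S) (λ u∈ → present (new-∈ {K} {S} u∈)))) (ℚₚ.*-identityˡ (term K)))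
      (term≤∑ {f = λ K → weight x K S *ℚ term K} (λ {K} _ → *-nonneg (weight-nonneg sx K S) (term-nonneg K)) K∈)) bad<1)
    where
    term : E → ℚ
    term K = branch (generic? K S v) (∑ (oth K v) (bad x n (mem K ++ S) (just K))) 1ℚ
    term-nonneg : ∀ K → 0ℚ ≤ℚ term K
    term-nonneg K with generic? K S v
    ... | yes _ = ∑-nonneg (oth K v) (λ {u} _ → bad-nonneg sx n (mem K ++ S) (just K) u)
    ... | no _  = 0≤1
    conclude : term K <ℚ 1ℚ → Generic K S v × (∀ {u} → u ∈ oth K v → bad x n (mem K ++ S) (just K) u <ℚ 1ℚ)
    conclude term<1 with generic? K S v
    ... | yes generic = generic , λ u∈ → ℚₚ.≤-<-trans
            (term≤∑ (λ {u} _ → bad-nonneg sx n (mem K ++ S) (just K) u) u∈) term<1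
    ... | no _ = ⊥-elim (ℚₚ.<-irrefl refl term<1)

  module Good (x : V → Point) (x-vertex : ∀ v → Vertex _≟V_ (x v)) (L : ℕ) (δ : ℚ) (0≤δ : 0ℚ ≤ℚ δ) where

    sx : ∀ v → Subprobability (x v)
    sx v = subst Subprobability (sym (proj₂ (x-vertex v))) (e-subprobability (proj₁ (x-vertex v)))

    penalty : V → ℚ
    penalty v = bad x L (v ∷ []) nothing v +ℚ δ *ℚ deg x v

    deg-nonneg : ∀ v → 0ℚ ≤ℚ deg x v
    deg-nonneg v = ∑-nonneg (inc nothing v) (λ {K} _ → weight-nonneg sx K (v ∷ []))

    -- At a vertex point `bad` and `deg` are numbers of present walks and hyperedges. A penalty
    -- below 1 therefore excludes bad walks from v and bounds its degree by 1 / δ at the same time.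
    good : V → Set
    good v = x v 0 ≡ 1ℚ × penalty v <ℚ 1ℚ

    good? : ∀ v → Dec (good v)
    good? v = (x v 0 ℚₚ.≟ 1ℚ) ×-dec (penalty v <ℚ? 1ℚ)

    bad<1 : ∀ {v} → good v → bad x L (v ∷ []) nothing v <ℚ 1ℚ
    bad<1 {v} (_ , h) = ℚₚ.≤-<-trans (p≤p+q (*-nonneg 0≤δ (deg-nonneg v))) h

    δdeg<1 : ∀ {v} → good v → δ *ℚ deg x v <ℚ 1ℚ
    δdeg<1 {v} (_ , h) = ℚₚ.≤-<-trans (p≤q+p (bad-nonneg sx L (v ∷ []) nothing v)) h

    -- A kept point that is not good contributes at most 0, so the affine objective is a lower bound
    -- for the number of good points.
    term≤good : ∀ v → x v 0 *ℚ (1ℚ -ℚ penalty v) ≤ℚ ⟦ good? v ⟧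
    term≤good v with proj₁ (x-vertex v) ℕ.≟ 0
    ... | no l≢0 = ℚₚ.≤-trans (ℚₚ.≤-reflexive (trans (cong (_*ℚ (1ℚ -ℚ penalty v))
            (trans (cong (λ w → w 0) (proj₂ (x-vertex v))) (e-off (proj₁ (x-vertex v)) 0 (λ eq → l≢0 (sym eq)))))
            (ℚₚ.*-zeroˡ (1ℚ -ℚ penalty v)))) (⟦⟧-nonneg (good? v))
    ... | yes l≡0 = by-cases (penalty v <ℚ? 1ℚ)
      where
      x≡1 : x v 0 ≡ 1ℚ
      x≡1 = trans (cong (λ w → w 0) (proj₂ (x-vertex v))) (trans (cong (λ l → e l 0) l≡0) (e-diag 0))
      by-cases : Dec (penalty v <ℚ 1ℚ) → x v 0 *ℚ (1ℚ -ℚ penalty v) ≤ℚ ⟦ good? v ⟧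
      by-cases (yes pen<1) = ℚₚ.≤-trans
        (ℚₚ.≤-reflexive (trans (cong (_*ℚ (1ℚ -ℚ penalty v)) x≡1) (ℚₚ.*-identityˡ (1ℚ -ℚ penalty v))))
        (ℚₚ.≤-trans (p-q≤p (+-nonneg (bad-nonneg sx L (v ∷ []) nothing v) (*-nonneg 0≤δ (deg-nonneg v))))
          (ℚₚ.≤-reflexive (sym (⟦⟧-yes (good? v) (x≡1 , pen<1)))))
      by-cases (no pen≮1) = ℚₚ.≤-trans
        (*-monoˡ (proj₁ (sx v) 0) (sub-mono {1ℚ} ℚₚ.≤-refl (ℚₚ.≮⇒≥ pen≮1)))
        (ℚₚ.≤-trans (ℚₚ.≤-reflexive (ℚₚ.*-zeroʳ (x v 0))) (⟦⟧-nonneg (good? v)))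

    all-good? : ∀ K → Dec (All good (mem K))
    all-good? K = All.all? good? (mem K)

    Es′ : List E
    Es′ = filter all-good? Es

    Es′⊆Es : ∀ {K} → K ∈ Es′ → K ∈ Es
    Es′⊆Es K∈ = proj₁ (∈-filter⁻ all-good? K∈)

    Es′-good : ∀ {K u} → K ∈ Es′ → u ∈ mem K → good u
    Es′-good {K} K∈ = All.lookup (proj₂ (∈-filter⁻ all-good? {xs = Es} K∈))

    module H′ = Hypergraph _≟V_ _≟E_ mem Es′ (filter⁺ all-good? Es-unique) (λ K∈ → mem-unique (Es′⊆Es K∈))

    inc′⊆inc : ∀ K₀ {v K} → K ∈ H′.inc K₀ v → K ∈ inc K₀ v
    inc′⊆inc nothing   K∈ = ∈-inc (Es′⊆Es (H′.inc-∈Es nothing K∈)) (H′.inc-∈mem nothing K∈)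
    inc′⊆inc (just K₀) K∈ = ∈-inc-just (Es′⊆Es (H′.inc-∈Es (just K₀) K∈)) (H′.inc-∈mem (just K₀) K∈) (H′.inc-≢ K∈)

    degree-bound : ∀ Δ → δ *ℚ ι Δ ≡ 1ℚ → ∀ v → length (H′.inc nothing v) ≤ Δ
    degree-bound Δ δΔ≡1 v = cases (H′.inc nothing v) refl
      where
      bound : good v → length (H′.inc nothing v) ≤ Δ
      bound gv = ι-reflect (ℚₚ.≤-trans
        (subst (λ Ks → ι (length Ks) ≤ℚ deg x v) (sym (filter-swap (λ K → v ∈? mem K) all-good? Es))
          (length-filter≤∑ all-good? (inc nothing v) (λ {K} _ → present K)))
        (ℚₚ.≤-trans (ℚₚ.≤-reflexive (trans (sym (ℚₚ.*-identityˡ (deg x v))) (cong (_*ℚ deg x v) (sym δΔ≡1))))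
          (ℚₚ.≤-trans (ℚₚ.≤-reflexive (solve 3 (λ a b c → (a :* b) :* c := b :* (a :* c)) refl δ (ι Δ) (deg x v)))
            (ℚₚ.≤-trans (*-monoˡ (0≤ι Δ) (ℚₚ.<⇒≤ (δdeg<1 gv))) (ℚₚ.≤-reflexive (ℚₚ.*-identityʳ (ι Δ)))))))
        where
        present : ∀ K → ⟦ all-good? K ⟧ ≤ℚ weight x K (v ∷ [])
        present K with all-good? K
        ... | yes all-good = ℚₚ.≤-reflexive (sym (∏≡1 (new K (v ∷ [])) (λ u∈ → proj₁ (All.lookup all-good (new-∈ {K} {v ∷ []} u∈)))))
        ... | no _ = weight-nonneg sx K (v ∷ [])
      cases : ∀ Ks → H′.inc nothing v ≡ Ks → length (H′.inc nothing v) ≤ Δ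
      -- A point that is not good lies in no hyperedge of `Es′`; the expected degree is consulted
      -- only when there is a hyperedge.
      cases []       eq = subst (λ Ks → length Ks ≤ Δ) (sym eq) z≤n
      cases (K ∷ Ks) eq = bound (Es′-good (H′.inc-∈Es nothing K∈) (H′.inc-∈mem nothing K∈))
        where
        K∈ : K ∈ H′.inc nothing v
        K∈ = subst (K ∈_) (sym eq) (here refl)

    -- The walk consists of present hyperedges, so each of its steps is generic and ends outside all
    -- points seen. The target w stays among these, so it is never reached.
    cycle-free : ∀ n S K₀ v {w l} → bad x n S K₀ v <ℚ 1ℚ → v ∈ S → w ∈ S → suc l ≤ n → H′.Walk K₀ v w (suc l) → ⊥
    cycle-free (suc n) S K₀ v bad<1 v∈S w∈S (s≤s l≤n) (H′.step {K = K} {u = u} K∈ u∈ p) = continue p l≤n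
      where
      next = bad-step sx {n} {S} {K₀} bad<1 (inc′⊆inc K₀ K∈) (λ u∈K → proj₁ (Es′-good (H′.inc-∈Es K₀ K∈) u∈K))
      continue : ∀ {l} → H′.Walk (just K) u _ l → l ≤ n → ⊥
      continue H′.nil _ = generic-fresh (proj₁ next) v∈S (H′.oth-∈mem u∈) (H′.oth-≢ u∈) w∈S
      continue {suc l} q l≤n = cycle-free n (mem K ++ S) (just K) u (proj₂ next u∈) (∈-++⁺ˡ (H′.oth-∈mem u∈)) (∈-++⁺ʳ (mem K) w∈S) l≤n q

  module Selection (p δ Γ : ℚ) (0≤p : 0ℚ ≤ℚ p) (p≤1 : p ≤ℚ 1ℚ) (0≤δ : 0ℚ ≤ℚ δ) (0≤Γ : 0ℚ ≤ℚ Γ)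
    (ρ Δ k : ℕ) (δΔ≡1 : δ *ℚ ι Δ ≡ 1ℚ) (ρΓ≡1 : ι ρ *ℚ Γ ≡ 1ℚ)
    (k≤oth : ∀ {K v} → K ∈ inc nothing v → k ≤ length (oth K v))
    (us : List V) (all∈us : ∀ v → v ∈ us) where

    uniform : V → Point
    uniform _ _ = p

    uniform-subprobability : ∀ v → Subprobability (uniform v)
    uniform-subprobability v = (λ _ → 0≤p) , ℚₚ.≤-trans (ℚₚ.≤-reflexive (ℚₚ.+-identityˡ p)) p≤1

    uniform-penalty : V → ℚ
    uniform-penalty v = bad uniform (ρ + ρ) (v ∷ []) nothing v +ℚ δ *ℚ deg uniform v

    objective : (V → Point) → ℚ
    objective x = ∑ us (λ v → x v 0 *ℚ (1ℚ -ℚ (bad x (ρ + ρ) (v ∷ []) nothing v +ℚ δ *ℚ deg x v)))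

    objective-ext : ∀ {x y} → (∀ v → x v ≡ y v) → objective x ≡ objective y
    objective-ext h = ∑-cong us (λ {v} _ → cong₂ (λ a b → a *ℚ (1ℚ -ℚ b)) (cong (λ w → w 0) (h v))
      (cong₂ _+ℚ_ (bad-local (ρ + ρ) (v ∷ []) nothing v (λ {u} _ → h u))
        (cong (δ *ℚ_) (∑-cong (inc nothing v) (λ {K} _ → weight-local K (λ {u} _ → h u))))))

    Outcome : Set₁
    Outcome = Σ (V → Set) λ I → Σ (∀ v → Dec (I v)) λ I? →
      (∀ K v → K ∈ Es → v ∈ mem K → ¬ (∀ {u} → u ∈ mem K → I u)) ×
      ι (length us) *ℚ (p *ℚ Γ) ≤ℚ ι (length (filter I? us)) +ℚ ι (length (filter I? us))

    -- Two roundings in succession: after the first, at least half of the expected number of kept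
    -- points are good, because the penalty is at most 1/2; the second selects at least Γ times as
    -- many.
    independent-set : let ζ = ((Γ +ℚ Γ) +ℚ (Γ +ℚ Γ)) +ℚ Γ in
      ζ ≤ℚ 1ℚ → ζ ^ℚ k +ℚ ζ ^ℚ k ≤ℚ 1ℚ → Γ ≤ℚ (1ℚ -ℚ ζ ^ℚ k) ^ℚ Δ →
      (∀ v → uniform-penalty v +ℚ uniform-penalty v ≤ℚ 1ℚ) →
      Outcome
    independent-set ζ≤1 ε≤½ Γ≤survival penalty≤½ =
      let y , F≤ , vertex = round _≟V_ objective objective-ext
            (λ x u → aff-∑ us (λ {v} _ → penalty-aff x u δ (ρ + ρ) v)) us uniform uniform-subprobability
      in conclude y F≤ (λ v → vertex v (inj₁ (all∈us v)))
      where
      conclude : ∀ y → objective uniform ≤ℚ objective y → (∀ v → Vertex _≟V_ (y v)) → Outcome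
      conclude y F≤ vertex = I , I? , independent , bound
        where
        open Good y vertex (ρ + ρ) δ 0≤δ
        kept = filter good? us
        second = H′.Rounds.Fractional.independent-set ρ Γ 0≤Γ ρΓ≡1 Δ k (degree-bound Δ δΔ≡1)
          (λ K∈ → k≤oth (inc′⊆inc nothing K∈)) ζ≤1 ε≤½ Γ≤survival us all∈us kept no-cycle
          where
          no-cycle : ∀ {v n} → suc n ≤ ρ + ρ → H′.Walk nothing v v (suc n) → ⊥
          no-cycle {v} n≤ w@(H′.step K∈ _ _) = cycle-free (ρ + ρ) (v ∷ []) nothing v
            (bad<1 (Es′-good (H′.inc-∈Es nothing K∈) (H′.inc-∈mem nothing K∈))) (here refl) (here refl) n≤ w
        c = proj₁ second
        I : V → Set
        I v = good v × 0ℚ <ℚ c v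
        I? : ∀ v → Dec (I v)
        I? v = good? v ×-dec (0ℚ <ℚ? c v)
        independent : ∀ K v → K ∈ Es → v ∈ mem K → ¬ (∀ {u} → u ∈ mem K → I u)
        -- A hyperedge with all members selected has all members good, so it is one of `Es′`:
        -- deleting hyperedges with a bad member loses nothing.
        independent K v K∈ v∈ all-I = proj₁ (proj₂ (proj₂ second))
          (∈-filter⁺ all-good? K∈ (All.tabulate (λ u∈ → proj₁ (all-I u∈)))) v∈ (λ u∈ → proj₂ (all-I u∈))
        count : ∑ kept c ≤ℚ ι (length (filter I? us))
        count = ℚₚ.≤-trans (∑≤length-filter I? kept below)
          (ι-mono (subst (λ zs → length zs ≤ length (filter I? us)) (filter-swap good? I? us) (length-filter good? (filter I? us))))
          where
          below : ∀ {v} → v ∈ kept → c v ≤ℚ ⟦ I? v ⟧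
          below {v} v∈ = by-cases (0ℚ <ℚ? c v)
            where
            by-cases : Dec (0ℚ <ℚ c v) → c v ≤ℚ ⟦ I? v ⟧
            by-cases (yes 0<c) = ℚₚ.≤-trans (proj₁ (proj₂ second) v)
              (ℚₚ.≤-reflexive (sym (⟦⟧-yes (I? v) (proj₂ (∈-filter⁻ good? {xs = us} v∈) , 0<c))))
            by-cases (no 0≮c) = ℚₚ.≤-trans (ℚₚ.≮⇒≥ 0≮c) (⟦⟧-nonneg (I? v))
        many-kept : ι (length us) *ℚ p ≤ℚ ι (length kept) +ℚ ι (length kept)
        many-kept = ℚₚ.≤-trans
          (ℚₚ.≤-trans (ℚₚ.≤-reflexive (sym (∑-const us p)))
            (ℚₚ.≤-trans (∑-mono us {λ _ → p} {λ v → term v +ℚ term v} (λ {v} _ → 0≤q-p⇒p≤q (subst (0ℚ ≤ℚ_)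
                (solve 2 (λ p q → p :* (con 1ℚ :- (q :+ q)) := (p :* (con 1ℚ :- q) :+ p :* (con 1ℚ :- q)) :- p) refl p (uniform-penalty v))
                (*-nonneg 0≤p (p≤q⇒0≤q-p (penalty≤½ v))))))
              (ℚₚ.≤-reflexive (∑-+ us term term))))
          (ℚₚ.+-mono-≤ enough enough)
          where
          term : V → ℚ
          term v = p *ℚ (1ℚ -ℚ uniform-penalty v)
          enough : objective uniform ≤ℚ ι (length kept)
          enough = ℚₚ.≤-trans F≤ (∑≤length-filter good? us (λ {v} _ → term≤good v))
        bound : ι (length us) *ℚ (p *ℚ Γ) ≤ℚ ι (length (filter I? us)) +ℚ ι (length (filter I? us))
        bound = ℚₚ.≤-trans (ℚₚ.≤-reflexive (sym (ℚₚ.*-assoc (ι (length us)) p Γ)))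
          (ℚₚ.≤-trans (*-monoʳ 0≤Γ many-kept)
            (ℚₚ.≤-trans (ℚₚ.≤-reflexive (ℚₚ.*-distribʳ-+ Γ (ι (length kept)) (ι (length kept))))
              (ℚₚ.+-mono-≤ kept≤ kept≤)))
          where
          kept≤ : ι (length kept) *ℚ Γ ≤ℚ ι (length (filter I? us))
          kept≤ = ℚₚ.≤-trans (proj₂ (proj₂ (proj₂ second))) count

-- The hypergraph of copies of K_{r,r}

length-cartesianProduct : ∀ {A B : Set} (xs : List A) (ys : List B) → length (cartesianProduct xs ys) ≡ length xs * length ys
length-cartesianProduct []       ys = refl
length-cartesianProduct (x ∷ xs) ys = trans (length-++ (map (x ,_) ys))
  (cong₂ _+_ (length-map (x ,_) ys) (length-cartesianProduct xs ys))

length-filter-≢ : ∀ {A : Set} (_≟_ : DecidableEquality A) a {xs : List A} → Unique xs →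
  length xs ≤ suc (length (filter (λ x → ¬? (x ≟ a)) xs))
length-filter-≢ _≟_ a {[]}     _ = z≤n
length-filter-≢ _≟_ a {x ∷ xs} (x∉ ∷ uniq) with x ≟ a
... | yes refl = s≤s (ℕₚ.≤-reflexive (sym (cong length (filter-all (λ y → ¬? (y ≟ a)) (All.map (λ a≢y y≡a → a≢y (sym y≡a)) x∉)))))
... | no _ = s≤s (length-filter-≢ _≟_ a uniq)

∑-⟦≟⟧≤1 : ∀ {A : Set} (_≟_ : DecidableEquality A) a {xs : List A} → Unique xs → ∑ xs (λ x → ⟦ x ≟ a ⟧) ≤ℚ 1ℚ
∑-⟦≟⟧≤1 _≟_ a {[]}     _ = 0≤1
∑-⟦≟⟧≤1 _≟_ a {x ∷ xs} (x∉ ∷ uniq) with x ≟ a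
... | yes refl = ℚₚ.≤-reflexive (trans (cong (1ℚ +ℚ_) (trans
        (∑-cong xs (λ {y} y∈ → ⟦⟧-no (y ≟ a) (λ y≡a → All.lookup x∉ y∈ (sym y≡a)))) (trans (∑-const xs 0ℚ) (ℚₚ.*-zeroʳ (ι (length xs))))))
        (ℚₚ.+-identityʳ 1ℚ))
... | no _ = ℚₚ.≤-trans (ℚₚ.≤-reflexive (ℚₚ.+-identityˡ _)) (∑-⟦≟⟧≤1 _≟_ a uniq)

two-members : ∀ {A : Set} {a b : A} {xs : List A} → a ≢ b → a ∈ xs → b ∈ xs → 2 ≤ length xs
two-members a≢b (here refl) (here refl) = contradiction refl a≢b
two-members {xs = _ ∷ _ ∷ _} a≢b _ _ = s≤s (s≤s z≤n)
two-members {xs = _ ∷ []} a≢b (here _) (there ())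
two-members {xs = _ ∷ []} a≢b (there ()) _

length-filter-+ : ∀ {A : Set} {P : A → Set} (P? : Decidable P) (xs : List A) →
  length (filter P? xs) + length (filter (λ x → ¬? (P? x)) xs) ≡ length xs
length-filter-+ P? []       = refl
length-filter-+ P? (x ∷ xs) with does (P? x)
... | true  = cong suc (length-filter-+ P? xs)
... | false = trans (ℕₚ.+-suc (length (filter P? xs)) _) (cong suc (length-filter-+ P? xs))

-- Increasing lists represent subsets with equality of lists as equality of sets, so that each copy
-- of K_{r,r} is a single hyperedge.
Increasing : ∀ {m} → List (Fin m) → Set
Increasing = AllPairs Fin._<_

increasing⇒unique : ∀ {m} {xs : List (Fin m)} → Increasing xs → Unique xs
increasing⇒unique = AllPairs.map Finₚ.<⇒≢

increasing-⊆ : ∀ {m} {xs ys : List (Fin m)} → Increasing xs → Increasing ys → (∀ {x} → x ∈ xs → x ∈ ys) →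
  length xs ≤ length ys × (length xs ≡ length ys → xs ≡ ys)
increasing-⊆ {xs = []} {[]}    _ _ _   = z≤n , λ _ → refl
increasing-⊆ {xs = []} {_ ∷ _} _ _ _   = z≤n , λ ()
increasing-⊆ {xs = x ∷ xs} {[]} _ _ xs⊆ys with () ← xs⊆ys (here refl)
increasing-⊆ {xs = x ∷ xs} {y ∷ ys} (x< ∷ ixs) (y< ∷ iys) xs⊆ys with xs⊆ys (here refl)
... | here refl =
      let ≤len , eq = increasing-⊆ ixs iys (λ z∈ → tail z∈ (xs⊆ys (there z∈)))
      in s≤s ≤len , λ len≡ → cong (x ∷_) (eq (ℕₚ.suc-injective len≡))
      where
      tail : ∀ {z} → z ∈ xs → z ∈ x ∷ ys → z ∈ ys
      tail z∈ (here refl) = contradiction (All.lookup x< z∈) (Finₚ.<-irrefl refl)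
      tail z∈ (there z∈ys) = z∈ys
... | there x∈ys =
      let ≤len , _ = increasing-⊆ {xs = x ∷ xs} {ys} (x< ∷ ixs) iys tail
      in ℕₚ.m≤n⇒m≤1+n ≤len , λ len≡ → contradiction (subst (_≤ length ys) len≡ ≤len) ℕₚ.1+n≰n
      where
      y<x = All.lookup y< x∈ys
      tail : ∀ {z} → z ∈ x ∷ xs → z ∈ ys
      tail (here refl) = x∈ys
      tail {z} (there z∈) with xs⊆ys (there z∈)
      ... | here refl   = contradiction (Finₚ.<-trans y<x (All.lookup x< z∈)) (Finₚ.<-irrefl refl)
      ... | there z∈ys = z∈ys

words : ∀ m → ℕ → List (List (Fin m))
words m zero    = [] ∷ []
words m (suc n) = map (λ { (x , xs) → x ∷ xs }) (cartesianProduct (allFin m) (words m n))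

∈-words : ∀ {m} (xs : List (Fin m)) → xs ∈ words m (length xs)
∈-words []       = here refl
∈-words (x ∷ xs) = ∈-map⁺ (λ { (x , xs) → x ∷ xs }) (∈-cartesianProduct⁺ (∈-allFin x) (∈-words xs))

words-length : ∀ {m} n {xs : List (Fin m)} → xs ∈ words m n → length xs ≡ n
words-length zero    (here refl) = refl
words-length {m} (suc n) xs∈ with ∈-map⁻ (λ { (x , xs) → x ∷ xs }) xs∈
... | (x , xs) , x∷xs∈ , refl = cong suc (words-length n (proj₂ (∈-cartesianProduct⁻ (allFin m) (words m n) x∷xs∈)))

words-unique : ∀ m n → Unique (words m n)
words-unique m zero    = [] ∷ []
words-unique m (suc n) = map⁺ (λ { {x , xs} {y , ys} refl → refl }) (cartesianProduct⁺ (allFin⁺ m) (words-unique m n))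

-- The reason for overcounting r-subsets by words: the sum over words factors into a power.
∑-words : ∀ m n (ω : Fin m → ℚ) → ∑ (words m n) (λ X → ∏ X ω) ≡ ∑ (allFin m) ω ^ℚ n
∑-words m zero    ω = refl
∑-words m (suc n) ω = trans (∑-map (cartesianProduct (allFin m) (words m n)) (λ { (x , xs) → x ∷ xs }) (λ X → ∏ X ω))
  (trans (∑-cartesianProduct (allFin m) (words m n) (λ { (x , xs) → ω x *ℚ ∏ xs ω }))
    (trans (∑-cong (allFin m) (λ {x} _ → ∑-*ˡ (words m n) (ω x) (λ X → ∏ X ω)))
      (trans (∑-*ʳ (allFin m) (∑ (words m n) (λ X → ∏ X ω)) ω) (cong (∑ (allFin m) ω *ℚ_) (∑-words m n ω)))))

module Copies (m r : ℕ) (2≤r : 2 ≤ r) where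

  V E : Set
  V = Fin m × Fin m
  E = List (Fin m) × List (Fin m)

  _≟V_ : DecidableEquality V
  _≟V_ = Productₚ.≡-dec Fin._≟_ Fin._≟_

  _≟E_ : DecidableEquality E
  _≟E_ = Productₚ.≡-dec (≡-dec Fin._≟_) (≡-dec Fin._≟_)

  mem : E → List V
  mem (X , Y) = cartesianProduct X Y

  copy? : ∀ (K : E) → Dec (Increasing (proj₁ K) × Increasing (proj₂ K))
  copy? (X , Y) = allPairs? Fin._<?_ X ×-dec allPairs? Fin._<?_ Y

  pairs : List E
  pairs = cartesianProduct (words m r) (words m r)

  copies : List E
  copies = filter copy? pairs

  record IsCopy (K : E) : Set where
    field
      increasing₁ : Increasing (proj₁ K)
      increasing₂ : Increasing (proj₂ K)
      length₁     : length (proj₁ K) ≡ r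
      length₂     : length (proj₂ K) ≡ r

  isCopy : ∀ {K} → K ∈ copies → IsCopy K
  isCopy {K} K∈ = let K∈pairs , inc = ∈-filter⁻ copy? {xs = pairs} K∈
                      X∈ , Y∈ = ∈-cartesianProduct⁻ (words m r) (words m r) K∈pairs
    in record { increasing₁ = proj₁ inc ; increasing₂ = proj₂ inc ; length₁ = words-length r X∈ ; length₂ = words-length r Y∈ }

  ∈-copies : ∀ {X Y} → Increasing X → Increasing Y → length X ≡ r → length Y ≡ r → (X , Y) ∈ copies
  ∈-copies {X} {Y} iX iY lX lY = ∈-filter⁺ copy? (∈-cartesianProduct⁺ (word X lX) (word Y lY)) (iX , iY)
    where
    word : ∀ Z → length Z ≡ r → Z ∈ words m r
    word Z eq = subst (λ n → Z ∈ words m n) eq (∈-words Z)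

  copies-unique : Unique copies
  copies-unique = filter⁺ copy? (cartesianProduct⁺ (words-unique m r) (words-unique m r))

  mem-unique : ∀ {K} → K ∈ copies → Unique (mem K)
  mem-unique K∈ = cartesianProduct⁺ (increasing⇒unique increasing₁) (increasing⇒unique increasing₂)
    where open IsCopy (isCopy K∈)

  length-mem : ∀ {K} → K ∈ copies → length (mem K) ≡ r * r
  length-mem {X , Y} K∈ = trans (length-cartesianProduct X Y) (cong₂ _*_ length₁ length₂)
    where open IsCopy (isCopy K∈)

  rows columns : List V → List (Fin m)
  rows    = map proj₁
  columns = map proj₂

  -- Phrased by rows and columns rather than by points: how many copies are expected depends on how
  -- many of their rows and columns are free, even where no point is repeated.
  Generic : E → List V → V → Set
  Generic (X , Y) S (a , b) = All (λ x → x ∈ rows S → x ≡ a) X × All (λ y → y ∈ columns S → y ≡ b) Y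

  open import Data.List.Membership.DecPropositional (Fin._≟_ {m}) using () renaming (_∈?_ to _∈F?_)
  open import Data.List.Membership.DecPropositional _≟V_ using (_∈?_; _∉?_)

  generic? : ∀ K S v → Dec (Generic K S v)
  generic? (X , Y) S (a , b) = All.all? (λ x → (x ∈F? rows S) →-dec (x Fin.≟ a)) X ×-dec All.all? (λ y → (y ∈F? columns S) →-dec (y Fin.≟ b)) Y

  generic-fresh : ∀ {K S v u} → Generic K S v → v ∈ S → u ∈ mem K → u ≢ v → u ∉ S
  generic-fresh {X , Y} {S} (gX , gY) _ u∈ u≢v u∈S =
    let x∈ , y∈ = ∈-cartesianProduct⁻ X Y u∈
    in u≢v (cong₂ _,_ (All.lookup gX x∈ (∈-map⁺ proj₁ u∈S)) (All.lookup gY y∈ (∈-map⁺ proj₂ u∈S)))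

  open Hypergraph _≟V_ _≟E_ mem copies copies-unique mem-unique public
  open Sparsification _≟V_ _≟E_ mem copies copies-unique mem-unique Generic generic? generic-fresh public

  k≤oth : ∀ {K v} → K ∈ inc nothing v → r * r ∸ 1 ≤ length (oth K v)
  k≤oth {K} {v} K∈ = ℕₚ.∸-monoˡ-≤ 1 (subst (_≤ suc (length (oth K v))) (length-mem (inc-∈Es nothing K∈))
    (length-filter-≢ _≟V_ v (mem-unique (inc-∈Es nothing K∈))))

  another : ∀ {X : List (Fin m)} b → Unique X → length X ≡ r → ∃ λ y → y ∈ X × y ≢ b
  another {x ∷ y ∷ X} b ((x≢y ∷ _) ∷ _) _ with x Fin.≟ b
  ... | yes refl = y , there (here refl) , λ y≡x → x≢y (sym y≡x)
  ... | no x≢b   = x , here refl , x≢b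
  another {[]}     b _ eq = contradiction (subst (2 ≤_) (sym eq) 2≤r) (λ ())
  another {_ ∷ []} b _ eq = contradiction (subst (2 ≤_) (sym eq) 2≤r) (λ { (s≤s ()) })

  -- A copy made of seen points only has weight 1 and would not gain the factor η. Escaping supplies
  -- the one new point needed when all rows and columns are old.
  Escaping : List V → Maybe E → V → Set
  Escaping S K₀ v = ∀ {K} → K ∈ inc K₀ v → Any (_∉ S) (mem K)

  escaping-start : ∀ v → Escaping (v ∷ []) nothing v
  escaping-start (a , b) {X , Y} K∈ =
    let x , x∈ , x≢a = another a (increasing⇒unique increasing₁) length₁
        _ , b∈ = ∈-cartesianProduct⁻ X Y (inc-∈mem nothing K∈)
    in lose (∈-cartesianProduct⁺ x∈ b∈) (λ { (here eq) → x≢a (cong proj₁ eq) })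
    where open IsCopy (isCopy (inc-∈Es nothing K∈))

  -- A copy through a new point u of the generic copy K that lies in S and K must agree with K: the new row of u
  -- forces its columns into those of K, and a column of it outside S then forces its rows into those of K.
  escaping-step : ∀ {K S K₀ v u} → K ∈ inc K₀ v → Generic K S v → u ∈ oth K v → Escaping (mem K ++ S) (just K) u
  escaping-step {X , Y} {S} {K₀} {a , b} {x , y} K∈ (gX , gY) u∈ {X′ , Y′} K′∈ =
    (Allₚ.¬All⇒Any¬ (_∈? (mem (X , Y) ++ S)) (mem (X′ , Y′)) contained)
    where
    module K  = IsCopy (isCopy (inc-∈Es K₀ K∈))
    module K′ = IsCopy (isCopy (inc-∈Es (just (X , Y)) K′∈))
    x∈X  = proj₁ (∈-cartesianProduct⁻ X Y (oth-∈mem {X , Y} u∈))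
    y∈Y  = proj₂ (∈-cartesianProduct⁻ X Y (oth-∈mem {X , Y} u∈))
    x∈X′ = proj₁ (∈-cartesianProduct⁻ X′ Y′ (inc-∈mem (just (X , Y)) K′∈))
    y∈Y′ = proj₂ (∈-cartesianProduct⁻ X′ Y′ (inc-∈mem (just (X , Y)) K′∈))
    contained : ¬ All (_∈ mem (X , Y) ++ S) (mem (X′ , Y′))
    contained all = inc-≢ K′∈ (cong₂ _,_
        (proj₂ (increasing-⊆ K′.increasing₁ K.increasing₁ (proj₁ both)) (trans K′.length₁ (sym K.length₁)))
        (proj₂ (increasing-⊆ K′.increasing₂ K.increasing₂ (proj₂ both)) (trans K′.length₂ (sym K.length₂))))
      where
      inside : ∀ {x y} → x ∈ X′ → y ∈ Y′ → (x , y) ∉ S → x ∈ X × y ∈ Y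
      inside x∈ y∈ ∉S with ∈-++⁻ (mem (X , Y)) (All.lookup all (∈-cartesianProduct⁺ x∈ y∈))
      ... | inj₁ ∈K = ∈-cartesianProduct⁻ X Y ∈K
      ... | inj₂ ∈S = contradiction ∈S ∉S
      new-row : ∀ {x y} → x ∈ X → x ≢ a → (x , y) ∉ S
      new-row x∈ x≢a ∈S = x≢a (All.lookup gX x∈ (∈-map⁺ proj₁ ∈S))
      new-column : ∀ {x y} → y ∈ Y → y ≢ b → (x , y) ∉ S
      new-column y∈ y≢b ∈S = y≢b (All.lookup gY y∈ (∈-map⁺ proj₂ ∈S))
      both : (∀ {z} → z ∈ X′ → z ∈ X) × (∀ {z} → z ∈ Y′ → z ∈ Y)
      both with x Fin.≟ a
      ... | no x≢a =
        let Y′⊆Y = λ {z} (z∈ : z ∈ Y′) → proj₂ (inside x∈X′ z∈ (new-row x∈X x≢a))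
            y₁ , y₁∈ , y₁≢b = another b (increasing⇒unique K′.increasing₂) K′.length₂
        in (λ z∈ → proj₁ (inside z∈ y₁∈ (new-column (Y′⊆Y y₁∈) y₁≢b))) , Y′⊆Y
      ... | yes refl =
        let y≢b = λ y≡b → oth-≢ {X , Y} u∈ (cong (x ,_) y≡b)
            X′⊆X = λ {z} (z∈ : z ∈ X′) → proj₁ (inside z∈ y∈Y′ (new-column y∈Y y≢b))
            x₁ , x₁∈ , x₁≢a = another a (increasing⇒unique K′.increasing₁) K′.length₁
        in X′⊆X , (λ z∈ → proj₂ (inside x₁∈ z∈ (new-row (X′⊆X x₁∈) x₁≢a)))

-- Expected number of walks

-- The identity behind the strict balancedness of K_{r,r}: with r = 1 + a + s′ = 1 + b + t′, a copy meeting
-- the old rows in 1 + a and the old columns in 1 + b places has N ≥ r² − (1 + a)(1 + b) new points.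
balance : ∀ a b s′ t′ N → a + s′ ≡ b + t′ → (1 + (a + s′)) * (1 + (b + t′)) ≤ N + (1 + a) * (1 + b) →
  (2 + (a + s′)) * (s′ + t′) + (a * t′ + b * s′) ≤ N + N
balance a b s′ t′ N eq h = ℕₚ.+-cancelʳ-≤ (q + q) _ _ (begin
  (2 + (a + s′)) * (s′ + t′) + (a * t′ + b * s′) + (q + q)
    ≡⟨ cong (λ z → z + (a * t′ + b * s′) + (q + q)) (trans (ℕₚ.*-distribˡ-+ (2 + (a + s′)) s′ t′)
         (cong (λ z → (2 + z) * s′ + (2 + (a + s′)) * t′) eq)) ⟩
  (2 + (b + t′)) * s′ + (2 + (a + s′)) * t′ + (a * t′ + b * s′) + (q + q)
    ≡⟨ identity a b s′ t′ ⟩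
  (1 + (a + s′)) * (1 + (b + t′)) + (1 + (a + s′)) * (1 + (b + t′))
    ≤⟨ ℕₚ.+-mono-≤ h h ⟩
  (N + q) + (N + q)
    ≡⟨ rearrange N q ⟩
  N + N + (q + q) ∎)
  where
  open ℕₚ.≤-Reasoning
  q = (1 + a) * (1 + b)
  identity : ∀ a b s t → (2 + (b + t)) * s + (2 + (a + s)) * t + (a * t + b * s) + ((1 + a) * (1 + b) + (1 + a) * (1 + b))
    ≡ (1 + (a + s)) * (1 + (b + t)) + (1 + (a + s)) * (1 + (b + t))
  identity = solve-∀
  rearrange : ∀ n q → (n + q) + (n + q) ≡ n + n + (q + q)
  rearrange = solve-∀

-- Strictness for nongeneric copies (c = 1) gives the factor η that makes their expected number negligible.
strictly-balanced : ∀ {r N} s s′ t t′ c → s + s′ ≡ r → t + t′ ≡ r → 1 ≤ s → 1 ≤ t → 1 ≤ N → r * r ≤ N + s * t →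
  (c ≡ 0 ⊎ (c ≡ 1 × (2 ≤ s ⊎ 2 ≤ t))) → suc r * (s′ + t′) + c ≤ N + N
strictly-balanced {N = N} (suc a) s′ (suc b) t′ c refl t≡ _ _ 1≤N h c-case = surplus c-case
  where
  a+s′≡b+t′ : a + s′ ≡ b + t′
  a+s′≡b+t′ = sym (ℕₚ.suc-injective t≡)
  main : (2 + (a + s′)) * (s′ + t′) + (a * t′ + b * s′) ≤ N + N
  main = balance a b s′ t′ N a+s′≡b+t′
    (subst (λ z → suc (a + s′) * suc z ≤ N + suc a * suc b) a+s′≡b+t′ h)
  when-positive : 1 ≤ a * t′ + b * s′ → (2 + (a + s′)) * (s′ + t′) + 1 ≤ N + N
  when-positive 1≤ = ℕₚ.≤-trans (ℕₚ.+-monoʳ-≤ _ 1≤) main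
  cases : ∀ a s′ b t′ → a + s′ ≡ b + t′ → 1 ≤ a ⊎ 1 ≤ b → (s′ + t′ ≡ 0) ⊎ (1 ≤ a * t′ + b * s′)
  cases a zero b zero eq _ = inj₁ refl
  cases (suc a) zero b (suc t′) eq _ = inj₂ (s≤s z≤n)
  cases zero zero b (suc t′) eq _ with () ← trans eq (ℕₚ.+-suc b t′)
  cases a (suc s′) (suc b) t′ eq _ = inj₂ (ℕₚ.≤-trans (s≤s z≤n) (ℕₚ.m≤n+m (suc b * suc s′) (a * t′)))
  cases (suc a) (suc s′) zero (suc t′) eq _ = inj₂ (s≤s z≤n)
  cases (suc a) (suc s′) zero zero () _
  cases zero (suc s′) zero t′ eq (inj₁ ())
  cases zero (suc s′) zero t′ eq (inj₂ ())
  surplus : (c ≡ 0 ⊎ (c ≡ 1 × (2 ≤ suc a ⊎ 2 ≤ suc b))) → (2 + (a + s′)) * (s′ + t′) + c ≤ N + N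
  surplus (inj₁ refl) = ℕₚ.≤-trans (ℕₚ.+-monoʳ-≤ _ z≤n) main
  surplus (inj₂ (refl , two)) with cases a s′ b t′ a+s′≡b+t′ (Sum.map ℕ.s≤s⁻¹ ℕ.s≤s⁻¹ two)
  ... | inj₂ 1≤ = when-positive 1≤
  -- No row or column is new; the surplus then comes from the new point itself.
  ... | inj₁ 0≡ = subst (λ z → (2 + (a + s′)) * z + 1 ≤ N + N) (sym 0≡)
          (subst (λ z → z + 1 ≤ N + N) (sym (ℕₚ.*-zeroʳ (2 + (a + s′)))) (ℕₚ.≤-trans 1≤N (ℕₚ.m≤m+n N N)))

-- Points that are not new lie in old rows and old columns, hence in a rectangle of known size.
length-new : ∀ {A B : Set} {P : A → Set} {Q : B → Set} {R : A × B → Set}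
  (P? : Decidable P) (Q? : Decidable Q) (R? : Decidable R) → (∀ {x y} → ¬ R (x , y) → P x × Q y) → ∀ xs ys →
  length xs * length ys ≤ length (filter R? (cartesianProduct xs ys)) + length (filter P? xs) * length (filter Q? ys)
length-new P? Q? R? old []       ys = z≤n
length-new {P = P} {Q} {R} P? Q? R? old (x ∷ xs) ys = begin
  length ys + length xs * length ys
    ≤⟨ ℕₚ.+-mono-≤ (row ys) (length-new P? Q? R? old xs ys) ⟩
  (length (filter R? (map (x ,_) ys)) + p) + (length (filter R? (cartesianProduct xs ys)) + length (filter P? xs) * length (filter Q? ys))
    ≡⟨ rearrange (length (filter R? (map (x ,_) ys))) p (length (filter R? (cartesianProduct xs ys))) _ ⟩
  (length (filter R? (map (x ,_) ys)) + length (filter R? (cartesianProduct xs ys))) + (p + length (filter P? xs) * length (filter Q? ys))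
    ≡⟨ cong₂ _+_ (sym (trans (cong length (filter-++ R? (map (x ,_) ys) (cartesianProduct xs ys))) (length-++ (filter R? (map (x ,_) ys))))) p-step ⟩
  length (filter R? (map (x ,_) ys ++ cartesianProduct xs ys)) + length (filter P? (x ∷ xs)) * length (filter Q? ys) ∎
  where
  open ℕₚ.≤-Reasoning
  p : ℕ
  p = if does (P? x) then length (filter Q? ys) else 0
  p-step : p + length (filter P? xs) * length (filter Q? ys) ≡ length (filter P? (x ∷ xs)) * length (filter Q? ys)
  p-step with does (P? x)
  ... | true  = refl
  ... | false = refl
  rearrange : ∀ a b c d → (a + b) + (c + d) ≡ (a + c) + (b + d)
  rearrange = solve-∀
  row : ∀ ys → length ys ≤ length (filter R? (map (x ,_) ys)) + (if does (P? x) then length (filter Q? ys) else 0)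
  row [] = z≤n
  row (y ∷ ys) with row ys
  ... | ih with R? (x , y) | P? x | Q? y
  ... | yes _ | yes _ | yes _ = s≤s (ℕₚ.≤-trans ih (ℕₚ.+-monoʳ-≤ _ (ℕₚ.n≤1+n _)))
  ... | yes _ | yes _ | no _  = s≤s ih
  ... | yes _ | no _  | _     = s≤s ih
  ... | no ¬R | yes _ | yes _ = ℕₚ.≤-trans (s≤s ih) (ℕₚ.≤-reflexive (sym (ℕₚ.+-suc _ _)))
  ... | no ¬R | yes _ | no ¬Q = contradiction (proj₂ (old ¬R)) ¬Q
  ... | no ¬R | no ¬P | _     = contradiction (proj₁ (old ¬R)) ¬P

module Weights (m r : ℕ) (2≤r : 2 ≤ r) (D η μ p : ℚ) (1≤D : 1ℚ ≤ℚ D) (0≤η : 0ℚ ≤ℚ η) (η≤1 : η ≤ℚ 1ℚ)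
  (μ≡ : μ ≡ η ^ℚ suc r) (mμ≡1 : ι m *ℚ μ ≡ 1ℚ) (p≡ : p ≡ D *ℚ (η *ℚ η)) where

  open Copies m r 2≤r public
  open import Data.List.Membership.DecPropositional (Fin._≟_ {m}) using () renaming (_∈?_ to _∈F?_)
  open import Data.List.Membership.DecPropositional _≟V_ using (_∉?_)

  -- A new row or column is charged 1 / m, an old one 1; the total over all m is then at most 1 plus
  -- the number of old entries.
  ω : List (Fin m) → Fin m → ℚ
  ω A a = branch (a ∈F? A) 1ℚ μ

  0≤μ : 0ℚ ≤ℚ μ
  0≤μ = subst (0ℚ ≤ℚ_) (sym μ≡) (0≤^ (suc r) 0≤η)

  ω-nonneg : ∀ A a → 0ℚ ≤ℚ ω A a
  ω-nonneg A a with a ∈F? A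
  ... | yes _ = 0≤1
  ... | no _  = 0≤μ

  ∏-ω : ∀ A (X : List (Fin m)) → ∏ X (ω A) ≡ μ ^ℚ length (filter (λ x → ¬? (x ∈F? A)) X)
  ∏-ω A []      = refl
  ∏-ω A (x ∷ X) with x ∈F? A
  ... | yes _ = trans (ℚₚ.*-identityˡ (∏ X (ω A))) (∏-ω A X)
  ... | no _  = cong (μ *ℚ_) (∏-ω A X)

  ∑-ω : ∀ A → ∑ (allFin m) (ω A) ≤ℚ ι (suc (length A))
  ∑-ω A = ℚₚ.≤-trans (∑-mono (allFin m) (λ {a} _ → bound a))
    (ℚₚ.≤-trans (ℚₚ.≤-reflexive (∑-+ (allFin m) (λ _ → μ) (λ a → ∑ A (λ b → ⟦ a Fin.≟ b ⟧))))
      (ℚₚ.+-mono-≤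
        (ℚₚ.≤-reflexive (trans (∑-const (allFin m) μ) (trans (cong (λ n → ι n *ℚ μ) {length (allFin m)} {m} (length-tabulate (id {A = Fin m}))) mμ≡1)))
        (ℚₚ.≤-trans (ℚₚ.≤-reflexive (∑-swap (allFin m) A (λ a b → ⟦ a Fin.≟ b ⟧)))
          (ℚₚ.≤-trans (∑-mono A (λ {b} _ → ∑-⟦≟⟧≤1 Fin._≟_ b (allFin⁺ m)))
            (ℚₚ.≤-reflexive (trans (∑-const A 1ℚ) (ℚₚ.*-identityʳ (ι (length A)))))))))
    where
    bound : ∀ a → ω A a ≤ℚ μ +ℚ ∑ A (λ b → ⟦ a Fin.≟ b ⟧)
    bound a with a ∈F? A
    ... | no _ = p≤p+q (∑-nonneg A (λ {b} _ → ⟦⟧-nonneg (a Fin.≟ b)))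
    ... | yes a∈A = ℚₚ.≤-trans (ℚₚ.≤-reflexive (sym (⟦⟧-yes (a Fin.≟ a) refl)))
            (ℚₚ.≤-trans (term≤∑ {f = λ b → ⟦ a Fin.≟ b ⟧} (λ {b} _ → ⟦⟧-nonneg (a Fin.≟ b)) a∈A) (p≤q+p 0≤μ))

  Dᵏ : ℚ
  Dᵏ = D ^ℚ (r * r ∸ 1)

  0≤D : 0ℚ ≤ℚ D
  0≤D = ℚₚ.≤-trans 0≤1 1≤D

  0≤Dᵏ : 0ℚ ≤ℚ Dᵏ
  0≤Dᵏ = 0≤^ (r * r ∸ 1) 0≤D

  uniform : V → Point
  uniform _ _ = p

  profile : List V → E → ℚ
  profile S (X , Y) = ∏ X (ω (rows S)) *ℚ ∏ Y (ω (columns S))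

  profile-nonneg : ∀ S K → 0ℚ ≤ℚ profile S K
  profile-nonneg S (X , Y) = *-nonneg (∏-nonneg X (λ {x} _ → ω-nonneg (rows S) x)) (∏-nonneg Y (λ {y} _ → ω-nonneg (columns S) y))

  -- The weight is D^N η^(2N) for N new points. Since v is old, N is at most r² - 1; by strict
  -- balancedness 2N pays η^(r+1) = 1 / m for each new row and column and, for nongeneric copies,
  -- one more η.
  weight-bound : ∀ {K S v} c → K ∈ inc nothing v → v ∈ S → Any (_∉ S) (mem K) → (c ≡ 0 ⊎ (c ≡ 1 × ¬ Generic K S v)) →
    weight uniform K S ≤ℚ (Dᵏ *ℚ η ^ℚ c) *ℚ profile S K
  weight-bound {X , Y} {S} {a , b} c K∈ v∈S escaping c-case = ℚₚ.≤-trans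
    (ℚₚ.≤-reflexive (trans (∏-const (new (X , Y) S) p) (trans (cong (_^ℚ N) p≡)
      (trans (*-^ D (η *ℚ η) N) (cong (D ^ℚ N *ℚ_) (trans (*-^ η η N) (sym (^-homo-* η N N))))))))
    (ℚₚ.≤-trans (*-mono (0≤^ N 0≤D) (0≤^ (suc r * (s′ + t′) + c) 0≤η)
        (^-monotone 1≤D (ℕₚ.∸-monoˡ-≤ 1 N<r²)) (^-antitone 0≤η η≤1 exponents))
      (ℚₚ.≤-reflexive (trans (cong (Dᵏ *ℚ_) η-power)
        (solve 4 (λ d x y z → d :* ((x :* y) :* z) := (d :* z) :* (x :* y)) refl Dᵏ (∏ X (ω (rows S))) (∏ Y (ω (columns S))) (η ^ℚ c)))))
    where
    open IsCopy (isCopy (inc-∈Es nothing K∈))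
    v∈K = inc-∈mem nothing K∈
    a∈X = proj₁ (∈-cartesianProduct⁻ X Y v∈K)
    b∈Y = proj₂ (∈-cartesianProduct⁻ X Y v∈K)
    a∈S = ∈-map⁺ proj₁ v∈S
    b∈S = ∈-map⁺ proj₂ v∈S
    old₁? = _∈F? rows S
    old₂? = _∈F? columns S
    N  = length (new (X , Y) S)
    s  = length (filter old₁? X)
    s′ = length (filter (λ x → ¬? (old₁? x)) X)
    t  = length (filter old₂? Y)
    t′ = length (filter (λ y → ¬? (old₂? y)) Y)
    N<r² : suc N ≤ r * r
    N<r² = subst (suc N ≤_) (length-mem (inc-∈Es nothing K∈)) (filter-notAll (_∉? S) (mem (X , Y)) (lose v∈K (λ v∉S → v∉S v∈S)))
    cover : r * r ≤ N + s * t
    cover = subst (_≤ N + s * t) (cong₂ _*_ length₁ length₂) (length-new old₁? old₂? (_∉? S)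
      (λ {x} {y} ¬∉ → let ∈S = decidable-stable (_∈?_ (x , y) S) ¬∉ in ∈-map⁺ proj₁ ∈S , ∈-map⁺ proj₂ ∈S) X Y)
      where open import Data.List.Membership.DecPropositional _≟V_ using (_∈?_)
    two : ∀ {Z : List (Fin m)} {z} T → z ∈ Z → z ∈ T → ¬ All (λ x → x ∈ T → x ≡ z) Z → 2 ≤ length (filter (_∈F? T) Z)
    two {Z} {z} T z∈Z z∈T ¬all with find (Allₚ.¬All⇒Any¬ (λ x → (x ∈F? T) →-dec (x Fin.≟ z)) Z ¬all)
    ... | x , x∈Z , ¬imp with x ∈F? T
    ... | no x∉T  = contradiction (λ x∈T → contradiction x∈T x∉T) ¬imp
    ... | yes x∈T = two-members (λ z≡x → ¬imp (λ _ → sym z≡x)) (∈-filter⁺ (_∈F? T) z∈Z z∈T) (∈-filter⁺ (_∈F? T) x∈Z x∈T)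
    nongeneric : ¬ Generic (X , Y) S (a , b) → 2 ≤ s ⊎ 2 ≤ t
    nongeneric ¬g with All.all? (λ x → (x ∈F? rows S) →-dec (x Fin.≟ a)) X
    ... | no ¬all  = inj₁ (two (rows S) a∈X a∈S ¬all)
    ... | yes all₁ = inj₂ (two (columns S) b∈Y b∈S (λ all₂ → ¬g (all₁ , all₂)))
    exponents : suc r * (s′ + t′) + c ≤ N + N
    exponents = strictly-balanced s s′ t t′ c (trans (length-filter-+ old₁? X) length₁) (trans (length-filter-+ old₂? Y) length₂)
      (filter-some old₁? (lose a∈X a∈S)) (filter-some old₂? (lose b∈Y b∈S)) (filter-some (_∉? S) escaping) cover
      (Sum.map₂ (λ { (c≡1 , ¬g) → c≡1 , nongeneric ¬g }) c-case)
    η-power : η ^ℚ (suc r * (s′ + t′) + c) ≡ (∏ X (ω (rows S)) *ℚ ∏ Y (ω (columns S))) *ℚ η ^ℚ c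
    η-power = trans (^-homo-* η (suc r * (s′ + t′)) c) (cong (_*ℚ η ^ℚ c)
      (trans (sym (^-assocʳ η (suc r) (s′ + t′))) (trans (cong (_^ℚ (s′ + t′)) (sym μ≡))
        (trans (^-homo-* μ s′ t′) (cong₂ _*ℚ_ (sym (∏-ω (rows S) X)) (sym (∏-ω (columns S) Y)))))))

  ∑-profile : ∀ M S K₀ v → suc (length S) ≤ M → ∑ (inc K₀ v) (profile S) ≤ℚ ι M ^ℚ r *ℚ ι M ^ℚ r
  ∑-profile M S K₀ v |S|<M = ℚₚ.≤-trans (inc≤ K₀) (ℚₚ.≤-trans (∑-filter-≤ copy? pairs (profile-nonneg S))
    (ℚₚ.≤-trans (ℚₚ.≤-reflexive
      (trans (∑-cartesianProduct (words m r) (words m r) (profile S))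
        (trans (∑-cong (words m r) (λ {X} _ → ∑-*ˡ (words m r) (∏ X (ω (rows S))) (λ Y → ∏ Y (ω (columns S)))))
          (trans (∑-*ʳ (words m r) (∑ (words m r) (λ Y → ∏ Y (ω (columns S)))) (λ X → ∏ X (ω (rows S))))
            (cong₂ _*ℚ_ (∑-words m r (ω (rows S))) (∑-words m r (ω (columns S))))))))
      (*-mono (0≤^ r (∑-nonneg (allFin m) (λ {a} _ → ω-nonneg (rows S) a))) (0≤^ r (0≤ι M))
        (^-mono r (∑-nonneg (allFin m) (λ {a} _ → ω-nonneg (rows S) a)) (total proj₁))
        (^-mono r (∑-nonneg (allFin m) (λ {a} _ → ω-nonneg (columns S) a)) (total proj₂)))))
    where
    total : ∀ (f : V → Fin m) → ∑ (allFin m) (ω (map f S)) ≤ℚ ι M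
    total f = ℚₚ.≤-trans (∑-ω (map f S)) (ι-mono (subst (λ n → suc n ≤ M) (sym (length-map f S)) |S|<M))
    at : ∑ (inc nothing v) (profile S) ≤ℚ ∑ copies (profile S)
    at = ∑-filter-≤ (λ K → _∈?_ v (mem K)) copies (profile-nonneg S)
      where open import Data.List.Membership.DecPropositional _≟V_ using (_∈?_)
    inc≤ : ∀ K₀ → ∑ (inc K₀ v) (profile S) ≤ℚ ∑ copies (profile S)
    inc≤ nothing   = at
    inc≤ (just K₀) = ℚₚ.≤-trans (∑-filter-≤ (λ K → ¬? (K ≟E K₀)) (inc nothing v) (profile-nonneg S)) at

  0≤p : 0ℚ ≤ℚ p
  0≤p = subst (0ℚ ≤ℚ_) (sym p≡) (*-nonneg 0≤D (*-nonneg 0≤η 0≤η))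

  deg-bound : ∀ v → deg uniform v ≤ℚ Dᵏ *ℚ (ι 2 ^ℚ r *ℚ ι 2 ^ℚ r)
  deg-bound v = ℚₚ.≤-trans
    (∑-mono (inc nothing v) {g = λ K → (Dᵏ *ℚ 1ℚ) *ℚ profile (v ∷ []) K}
      (λ {K} K∈ → weight-bound 0 K∈ (here refl) (escaping-start v K∈) (inj₁ refl)))
    (ℚₚ.≤-trans (ℚₚ.≤-reflexive (trans (∑-*ˡ (inc nothing v) (Dᵏ *ℚ 1ℚ) (profile (v ∷ []))) (cong (_*ℚ ∑ (inc nothing v) (profile (v ∷ []))) (ℚₚ.*-identityʳ Dᵏ))))
      (*-monoˡ 0≤Dᵏ (∑-profile 2 (v ∷ []) nothing v ℕₚ.≤-refl)))

  module _ (M : ℕ) where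

    Q : ℚ
    Q = Dᵏ *ℚ (ι M ^ℚ r *ℚ ι M ^ℚ r)

    -- Counts bad walks up to the factor η: `Q` bounds the weighted number of hyperedges at a point,
    -- and each either ends the walk or leads to at most r² points.
    growth : ℕ → ℚ
    growth zero    = 0ℚ
    growth (suc n) = Q *ℚ (1ℚ +ℚ ι (r * r) *ℚ growth n)

    0≤Q : 0ℚ ≤ℚ Q
    0≤Q = *-nonneg 0≤Dᵏ (*-nonneg (0≤^ r (0≤ι M)) (0≤^ r (0≤ι M)))

    growth-nonneg : ∀ n → 0ℚ ≤ℚ growth n
    growth-nonneg zero    = ℚₚ.≤-refl
    growth-nonneg (suc n) = *-nonneg 0≤Q (+-nonneg 0≤1 (*-nonneg (0≤ι (r * r)) (growth-nonneg n)))

    -- Only the last hyperedge of a bad walk is nongeneric, whence a single factor η. The condition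
    -- on `length S` keeps M above the number of points seen during all remaining steps.
    bad-bound : ∀ n S K₀ v → v ∈ S → Escaping S K₀ v → length S + n * (r * r) < M →
      bad uniform n S K₀ v ≤ℚ η *ℚ growth n
    bad-bound zero    S K₀ v v∈S esc |S|<M = ℚₚ.≤-reflexive (sym (ℚₚ.*-zeroʳ η))
    bad-bound (suc n) S K₀ v v∈S esc |S|<M = ℚₚ.≤-trans (∑-mono (inc K₀ v) term-bound)
      (ℚₚ.≤-trans (ℚₚ.≤-reflexive (∑-*ˡ (inc K₀ v) (Dᵏ *ℚ (η *ℚ total)) (profile S)))
        (ℚₚ.≤-trans (*-monoˡ (*-nonneg 0≤Dᵏ (*-nonneg 0≤η 0≤total)) (∑-profile M S K₀ v (ℕₚ.≤-trans (s≤s (ℕₚ.m≤m+n (length S) _)) |S|<M)))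
          (ℚₚ.≤-reflexive (solve 4 (λ d e b q → (d :* (e :* b)) :* q := e :* ((d :* q) :* b)) refl Dᵏ η total (ι M ^ℚ r *ℚ ι M ^ℚ r)))))
      where
      total : ℚ
      total = 1ℚ +ℚ ι (r * r) *ℚ growth n
      0≤total : 0ℚ ≤ℚ total
      0≤total = +-nonneg 0≤1 (*-nonneg (0≤ι (r * r)) (growth-nonneg n))
      term-bound : ∀ {K} → K ∈ inc K₀ v → weight uniform K S *ℚ
        branch (generic? K S v) (∑ (oth K v) (bad uniform n (mem K ++ S) (just K))) 1ℚ ≤ℚ (Dᵏ *ℚ (η *ℚ total)) *ℚ profile S K
      term-bound {K} K∈ with generic? K S v
      ... | no ¬generic = ℚₚ.≤-trans (ℚₚ.≤-reflexive (ℚₚ.*-identityʳ (weight uniform K S)))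
              (ℚₚ.≤-trans (weight-bound 1 (inc⇒ K₀ K∈) v∈S (esc K∈) (inj₂ (refl , ¬generic)))
                (*-monoʳ (profile-nonneg S K) (*-monoˡ 0≤Dᵏ (*-monoˡ 0≤η (p≤p+q (*-nonneg (0≤ι (r * r)) (growth-nonneg n)))))))
      ... | yes generic = ℚₚ.≤-trans
              (*-mono (∏-nonneg (new K S) (λ _ → 0≤p)) (*-nonneg 0≤η 0≤total)
                (weight-bound 0 (inc⇒ K₀ K∈) v∈S (esc K∈) (inj₁ refl)) children)
              (ℚₚ.≤-reflexive (solve 4 (λ d e b q → ((d :* con 1ℚ) :* q) :* (e :* b) := (d :* (e :* b)) :* q) refl Dᵏ η total (profile S K)))
        where
        |mem| = length-mem (inc-∈Es K₀ K∈)
        children : ∑ (oth K v) (bad uniform n (mem K ++ S) (just K)) ≤ℚ η *ℚ total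
        children = ℚₚ.≤-trans
          (∑-mono (oth K v) (λ {u} u∈ → bad-bound n (mem K ++ S) (just K) u (∈-++⁺ˡ (oth-∈mem {K} u∈))
            (escaping-step {K} {S} {K₀} K∈ generic u∈) (subst (_< M) size |S|<M)))
          (ℚₚ.≤-trans (ℚₚ.≤-reflexive (∑-const (oth K v) (η *ℚ growth n)))
            (ℚₚ.≤-trans (*-monoʳ (*-nonneg 0≤η (growth-nonneg n)) (ι-mono (ℕₚ.≤-trans (length-filter (λ u → ¬? (u ≟V v)) (mem K)) (ℕₚ.≤-reflexive |mem|))))
              (ℚₚ.≤-trans (ℚₚ.≤-reflexive (solve 3 (λ k e g → k :* (e :* g) := e :* (k :* g)) refl (ι (r * r)) η (growth n)))
                (*-monoˡ 0≤η (p≤q+p 0≤1)))))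
          where
          size : length S + suc n * (r * r) ≡ length (mem K ++ S) + n * (r * r)
          size = trans (rearrange (length S) (r * r) (n * (r * r))) (cong (_+ n * (r * r)) (sym (trans (length-++ (mem K)) (cong (_+ length S) |mem|))))
            where
            rearrange : ∀ a b c → a + (b + c) ≡ (b + a) + c
            rearrange = solve-∀

    growth-bound : 1ℚ ≤ℚ Q → 1 ≤ r * r → ∀ n → growth n ≤ℚ ((ι (r * r) +ℚ 1ℚ) *ℚ Q) ^ℚ n
    growth-bound 1≤Q 1≤k zero    = 0≤1
    growth-bound 1≤Q 1≤k (suc n) = ℚₚ.≤-trans
      (*-monoˡ 0≤Q (ℚₚ.+-mono-≤ (1≤^ n 1≤base) (*-monoˡ (0≤ι (r * r)) (growth-bound 1≤Q 1≤k n))))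
      (ℚₚ.≤-reflexive (solve 3 (λ q k x → q :* (x :+ k :* x) := ((k :+ con 1ℚ) :* q) :* x) refl Q (ι (r * r)) (base ^ℚ n)))
      where
      base = (ι (r * r) +ℚ 1ℚ) *ℚ Q
      1≤base : 1ℚ ≤ℚ base
      1≤base = ℚₚ.≤-trans 1≤Q (subst (_≤ℚ base) (ℚₚ.*-identityˡ Q) (*-monoʳ 0≤Q (p≤q+p (0≤ι (r * r)))))

-- The bipartite graph on h^(r+1) + h^(r+1) vertices

^-distribʳ-* : ∀ m n o → (m * n) ^ o ≡ m ^ o * n ^ o
^-distribʳ-* m n zero    = refl
^-distribʳ-* m n (suc o) = trans (cong ((m * n) *_) (^-distribʳ-* m n o)) (rearrange m n (m ^ o) (n ^ o))
  where
  rearrange : ∀ a b c d → (a * b) * (c * d) ≡ (a * c) * (b * d)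
  rearrange = solve-∀

-- With m = h^(r+1) rows and columns and density p = D / h², a pair lies in about D^k copies of K_{r,r}.  The
-- selection has ρ rounds with acceptance probability Γ = 1 / ρ; j makes the survival probability 2^(-j) at
-- least Γ.  Closed walks of length at most L, which see fewer than M points, have to be excluded.
module Parameters (r g : ℕ) where

  k j E ρ L D M base : ℕ
  k    = r * r ∸ 1
  -- As D = 10 g E, this makes `j * E ^ k` equal to 4 D^k 4^r, four times the bound on the expected
  -- degree.
  j    = 4 * ((10 * g) ^ k * (2 ^ r * 2 ^ r))
  E    = 2 ^ j
  -- With ζ = 5 / ρ the factor 10 makes E ζ equal to 1/2.
  ρ    = 10 * E
  L    = ρ + ρ
  D    = g * ρ
  -- The starting point, r² points for each of L steps, and one more because the bound is strict.
  M    = 2 + L * (r * r)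
  base = (r * r + 1) * (D ^ k * (M ^ r * M ^ r))

  threshold : ℕ
  -- The 4 limits the expected number of bad walks to 1/4; the degree term takes the other quarter
  -- of a penalty of 1/2.
  threshold = 4 * base ^ L

module _ (r : ℕ) (2≤r : 2 ≤ r) where

  open Copies using (copies; mem)

  -- Of the h^(2r+2) pairs a proportion p Γ = (g ρ / h²) (1 / ρ) is selected, up to the factor 2.
  bipartite-graph : ∀ g → 1 ≤ g → ∀ h → Parameters.threshold r g ≤ h → let m = h ^ suc r in
    Σ (Fin m × Fin m → Set) λ I → Σ (∀ v → Dec (I v)) λ I? →
      (∀ K v → K ∈ copies m r 2≤r → v ∈ mem m r 2≤r K → ¬ (∀ {u} → u ∈ mem m r 2≤r K → I u)) ×
      g * h ^ (r + r) ≤ 2 * length (filter I? (cartesianProduct (allFin m) (allFin m)))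
  bipartite-graph g 1≤g h threshold≤h = I , I? , free , ι-reflect (ℚₚ.≤-trans (ℚₚ.≤-reflexive size) (ℚₚ.≤-trans bound
      (ℚₚ.≤-reflexive (trans (solve 1 (λ x → x :+ x := con (ι 2) :* x) refl (ι (length (filter I? us)))) (sym (ι-* 2 (length (filter I? us))))))))
    where
    open Parameters r g
    m = h ^ suc r
    1≤E : 1 ≤ E
    1≤E = ℕₚ.m^n>0 2 j
    1≤ρ : 1 ≤ ρ
    1≤ρ = ℕₚ.≤-trans 1≤E (ℕₚ.m≤m+n E _)
    1≤D : 1 ≤ D
    1≤D = ℕₚ.*-mono-≤ 1≤g 1≤ρ
    1≤M^ : 1 ≤ M ^ r * M ^ r
    1≤M^ = ℕₚ.*-mono-≤ (ℕₚ.m^n>0 M r) (ℕₚ.m^n>0 M r)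
    1≤k : 1 ≤ k
    1≤k = ℕₚ.∸-monoˡ-≤ {2} 1 (ℕₚ.≤-trans (s≤s (s≤s z≤n)) (ℕₚ.*-mono-≤ 2≤r 2≤r))
    D≤h : D ≤ h
    D≤h = begin
      D              ≡⟨ sym (ℕₚ.*-identityʳ D) ⟩
      D ^ 1          ≤⟨ ℕₚ.^-monoʳ-≤ D {{ℕ.>-nonZero 1≤D}} 1≤k ⟩
      D ^ k          ≤⟨ ℕₚ.m≤m*n (D ^ k) (M ^ r * M ^ r) {{ℕ.>-nonZero 1≤M^}} ⟩
      D ^ k * _      ≤⟨ ℕₚ.m≤n*m _ (r * r + 1) {{ℕ.>-nonZero (ℕₚ.m≤n+m 1 (r * r))}} ⟩
      base           ≡⟨ sym (ℕₚ.*-identityʳ base) ⟩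
      base ^ 1       ≤⟨ ℕₚ.^-monoʳ-≤ base {{ℕ.>-nonZero 1≤base}} (ℕₚ.≤-trans 1≤ρ (ℕₚ.m≤m+n ρ ρ)) ⟩
      base ^ L       ≤⟨ ℕₚ.m≤n*m (base ^ L) 4 ⟩
      4 * base ^ L   ≤⟨ threshold≤h ⟩
      h              ∎
      where
      open ℕₚ.≤-Reasoning
      1≤base : 1 ≤ base
      1≤base = ℕₚ.*-mono-≤ (ℕₚ.m≤n+m 1 (r * r)) (ℕₚ.*-mono-≤ (ℕₚ.m^n>0 D {{ℕ.>-nonZero 1≤D}} k) 1≤M^)
    1≤h : 1 ≤ h
    1≤h = ℕₚ.≤-trans 1≤D D≤h
    Δ = j * E ^ k
    1≤Δ : 1 ≤ Δ
    1≤Δ = ℕₚ.*-mono-≤ {1} {j} (ℕₚ.*-mono-≤ {1} {4} (s≤s z≤n)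
      (ℕₚ.*-mono-≤ (ℕₚ.m^n>0 (10 * g) {{ℕ.>-nonZero (ℕₚ.*-mono-≤ {1} {10} (s≤s z≤n) 1≤g)}} k) (ℕₚ.*-mono-≤ (ℕₚ.m^n>0 2 r) (ℕₚ.m^n>0 2 r))))
      (ℕₚ.m^n>0 E {{ℕ.>-nonZero 1≤E}} k)
    Γ-inverse = reciprocal ρ 1≤ρ
    Γ = proj₁ Γ-inverse
    0≤Γ = proj₁ (proj₂ Γ-inverse)
    ρΓ≡1 = proj₂ (proj₂ Γ-inverse)
    η-inverse = reciprocal h 1≤h
    η = proj₁ η-inverse
    0≤η = proj₁ (proj₂ η-inverse)
    hη≡1 = proj₂ (proj₂ η-inverse)
    δ-inverse = reciprocal Δ 1≤Δ
    δ = proj₁ δ-inverse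
    0≤δ = proj₁ (proj₂ δ-inverse)
    δΔ≡1 : δ *ℚ ι Δ ≡ 1ℚ
    δΔ≡1 = trans (ℚₚ.*-comm δ (ι Δ)) (proj₂ (proj₂ δ-inverse))
    μ = η ^ℚ suc r
    p = ι D *ℚ (η *ℚ η)
    mμ≡1 : ι m *ℚ μ ≡ 1ℚ
    mμ≡1 = trans (cong (_*ℚ μ) (ι-^ h (suc r))) (trans (sym (*-^ (ι h) η (suc r))) (trans (cong (_^ℚ suc r) hη≡1) (1^ (suc r))))
    open Weights m r 2≤r (ι D) η μ p (1≤ι 1≤D) 0≤η (x≤1 1≤h 0≤η hη≡1) refl mμ≡1 refl hiding (E)
    us = cartesianProduct (allFin m) (allFin m)
    ζ = ((Γ +ℚ Γ) +ℚ (Γ +ℚ Γ)) +ℚ Γ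
    0≤ζ : 0ℚ ≤ℚ ζ
    0≤ζ = +-nonneg (+-nonneg (+-nonneg 0≤Γ 0≤Γ) (+-nonneg 0≤Γ 0≤Γ)) 0≤Γ
    -- x = E ζ = 1/2.
    x = ι E *ℚ ζ
    0≤x : 0ℚ ≤ℚ x
    0≤x = *-nonneg (0≤ι E) 0≤ζ
    x+x≡1 : x +ℚ x ≡ 1ℚ
    x+x≡1 = trans (solve 2 (λ e g → e :* (((g :+ g) :+ (g :+ g)) :+ g) :+ e :* (((g :+ g) :+ (g :+ g)) :+ g) := (con (ι 10) :* e) :* g) refl (ι E) Γ)
      (trans (cong (_*ℚ Γ) (sym (ι-* 10 E))) ρΓ≡1)
    x≤1ℚ : x ≤ℚ 1ℚ
    x≤1ℚ = ℚₚ.≤-trans (p≤p+q 0≤x) (ℚₚ.≤-reflexive x+x≡1)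
    ζ≤x : ζ ≤ℚ x
    ζ≤x = subst (_≤ℚ x) (ℚₚ.*-identityˡ ζ) (*-monoʳ 0≤ζ (1≤ι 1≤E))
    ζ≤1 : ζ ≤ℚ 1ℚ
    ζ≤1 = ℚₚ.≤-trans ζ≤x x≤1ℚ
    ^k≤ : ∀ {q} → 0ℚ ≤ℚ q → q ≤ℚ 1ℚ → q ^ℚ k ≤ℚ q
    ^k≤ {q} 0≤q q≤1 = ℚₚ.≤-trans (^-antitone 0≤q q≤1 1≤k) (ℚₚ.≤-reflexive (ℚₚ.*-identityʳ q))
    ε = ζ ^ℚ k
    ε≤x : ε ≤ℚ x
    ε≤x = ℚₚ.≤-trans (^k≤ 0≤ζ ζ≤1) ζ≤x
    ε≤½ : ε +ℚ ε ≤ℚ 1ℚ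
    ε≤½ = ℚₚ.≤-trans (ℚₚ.+-mono-≤ ε≤x ε≤x) (ℚₚ.≤-reflexive x+x≡1)
    -- E^k hyperedges together cost at most a factor 1/2 by Bernoulli, as E^k ε = (E ζ)^k. The Δ
    -- hyperedges form j such groups, leaving 2^(-j) = 1 / E, which is at least Γ.
    Γ≤survival : Γ ≤ℚ (1ℚ -ℚ ε) ^ℚ Δ
    Γ≤survival = begin
      Γ                                      ≡⟨ sym (ℚₚ.*-identityʳ Γ) ⟩
      Γ *ℚ 1ℚ                                ≡⟨ cong (Γ *ℚ_) (sym Exʲ≡1) ⟩
      Γ *ℚ (ι E *ℚ x ^ℚ j)                   ≡⟨ sym (ℚₚ.*-assoc Γ (ι E) (x ^ℚ j)) ⟩
      (Γ *ℚ ι E) *ℚ x ^ℚ j                   ≤⟨ *-monoʳ (0≤^ j 0≤x) ΓE≤1 ⟩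
      1ℚ *ℚ x ^ℚ j                           ≡⟨ ℚₚ.*-identityˡ (x ^ℚ j) ⟩
      x ^ℚ j                                 ≤⟨ ^-mono j 0≤x half ⟩
      ((1ℚ -ℚ ε) ^ℚ (E ^ k)) ^ℚ j            ≡⟨ ^-assocʳ (1ℚ -ℚ ε) (E ^ k) j ⟩
      (1ℚ -ℚ ε) ^ℚ (E ^ k * j)               ≡⟨ cong ((1ℚ -ℚ ε) ^ℚ_) (ℕₚ.*-comm (E ^ k) j) ⟩
      (1ℚ -ℚ ε) ^ℚ Δ                         ∎
      where
      open ℚₚ.≤-Reasoning
      Exʲ≡1 : ι E *ℚ x ^ℚ j ≡ 1ℚ
      Exʲ≡1 = trans (cong (_*ℚ x ^ℚ j) (ι-^ 2 j)) (trans (sym (*-^ (ι 2) x j))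
        (trans (cong (_^ℚ j) (trans (solve 1 (λ x → con (ι 2) :* x := x :+ x) refl x) x+x≡1)) (1^ j)))
      ΓE≤1 : Γ *ℚ ι E ≤ℚ 1ℚ
      ΓE≤1 = ℚₚ.≤-trans (*-monoˡ 0≤Γ (ι-mono (ℕₚ.m≤m+n E (9 * E)))) (ℚₚ.≤-reflexive (trans (ℚₚ.*-comm Γ (ι ρ)) ρΓ≡1))
      half : x ≤ℚ (1ℚ -ℚ ε) ^ℚ (E ^ k)
      half = begin
        x                            ≡⟨ solve 1 (λ x → x := (x :+ x) :- x) refl x ⟩
        (x +ℚ x) -ℚ x                ≡⟨ cong (_-ℚ x) x+x≡1 ⟩
        1ℚ -ℚ x                      ≤⟨ sub-mono {1ℚ} ℚₚ.≤-refl (^k≤ 0≤x x≤1ℚ) ⟩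
        1ℚ -ℚ x ^ℚ k                 ≡⟨ cong (1ℚ -ℚ_) (trans (*-^ (ι E) ζ k) (cong (_*ℚ ε) (sym (ι-^ E k)))) ⟩
        1ℚ -ℚ ι (E ^ k) *ℚ ε         ≤⟨ bernoulli (E ^ k) (0≤^ k 0≤ζ) (^≤1 k 0≤ζ ζ≤1) ⟩
        (1ℚ -ℚ ε) ^ℚ (E ^ k)         ∎
    p≤1 : p ≤ℚ 1ℚ
    p≤1 = begin
      ι D *ℚ (η *ℚ η)   ≡⟨ sym (ℚₚ.*-assoc (ι D) η η) ⟩
      (ι D *ℚ η) *ℚ η   ≤⟨ *-mono (*-nonneg (0≤ι D) 0≤η) 0≤1 (ℚₚ.≤-trans (*-monoʳ 0≤η (ι-mono D≤h)) (ℚₚ.≤-reflexive hη≡1)) (x≤1 1≤h 0≤η hη≡1) ⟩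
      1ℚ *ℚ 1ℚ          ≡⟨ refl ⟩
      1ℚ                ∎
      where open ℚₚ.≤-Reasoning
    module S = Selection p δ Γ 0≤p p≤1 0≤δ 0≤Γ ρ Δ k δΔ≡1 ρΓ≡1 k≤oth us
      (λ v → ∈-cartesianProduct⁺ (∈-allFin (proj₁ v)) (∈-allFin (proj₂ v)))
    quarter-bad : ∀ v → ι 4 *ℚ bad uniform L (v ∷ []) nothing v ≤ℚ 1ℚ
    quarter-bad v = begin
      ι 4 *ℚ bad uniform L (v ∷ []) nothing v
        ≤⟨ *-monoˡ (0≤ι 4) (bad-bound M L (v ∷ []) nothing v (here refl) (escaping-start v) ℕₚ.≤-refl) ⟩
      ι 4 *ℚ (η *ℚ growth M L)
        ≤⟨ *-monoˡ (0≤ι 4) (*-monoˡ 0≤η (growth-bound M 1≤Q 1≤r² L)) ⟩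
      ι 4 *ℚ (η *ℚ ((ι (r * r) +ℚ 1ℚ) *ℚ Q M) ^ℚ L)
        ≡⟨ cong (λ b → ι 4 *ℚ (η *ℚ b ^ℚ L)) base≡ ⟩
      ι 4 *ℚ (η *ℚ ι base ^ℚ L)
        ≡⟨ solve 3 (λ a e b → a :* (e :* b) := (a :* b) :* e) refl (ι 4) η (ι base ^ℚ L) ⟩
      (ι 4 *ℚ ι base ^ℚ L) *ℚ η
        ≡⟨ cong (_*ℚ η) (sym (trans (ι-* 4 (base ^ L)) (cong (ι 4 *ℚ_) (ι-^ base L)))) ⟩
      ι threshold *ℚ η
        ≤⟨ *-monoʳ 0≤η (ι-mono threshold≤h) ⟩
      ι h *ℚ η
        ≡⟨ hη≡1 ⟩
      1ℚ ∎
      where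
      open ℚₚ.≤-Reasoning
      1≤r² : 1 ≤ r * r
      1≤r² = ℕₚ.≤-trans (s≤s z≤n) (ℕₚ.*-mono-≤ 2≤r 2≤r)
      Q≡ : ι (D ^ k * (M ^ r * M ^ r)) ≡ Q M
      Q≡ = trans (ι-* (D ^ k) (M ^ r * M ^ r)) (cong₂ _*ℚ_ (ι-^ D k) (trans (ι-* (M ^ r) (M ^ r)) (cong₂ _*ℚ_ (ι-^ M r) (ι-^ M r))))
      1≤Q : 1ℚ ≤ℚ Q M
      1≤Q = subst (1ℚ ≤ℚ_) Q≡ (1≤ι (ℕₚ.*-mono-≤ (ℕₚ.m^n>0 D {{ℕ.>-nonZero 1≤D}} k) 1≤M^))
      base≡ : (ι (r * r) +ℚ 1ℚ) *ℚ Q M ≡ ι base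
      base≡ = sym (trans (ι-* (r * r + 1) (D ^ k * (M ^ r * M ^ r))) (cong₂ _*ℚ_ (ι-+ (r * r) 1) Q≡))
    quarter-deg : ∀ v → ι 4 *ℚ (δ *ℚ deg uniform v) ≤ℚ 1ℚ
    quarter-deg v = begin
      ι 4 *ℚ (δ *ℚ deg uniform v)
        ≤⟨ *-monoˡ (0≤ι 4) (*-monoˡ 0≤δ (deg-bound v)) ⟩
      ι 4 *ℚ (δ *ℚ (ι D ^ℚ k *ℚ (ι 2 ^ℚ r *ℚ ι 2 ^ℚ r)))
        ≡⟨ solve 3 (λ a d c → a :* (d :* c) := d :* (a :* c)) refl (ι 4) δ (ι D ^ℚ k *ℚ (ι 2 ^ℚ r *ℚ ι 2 ^ℚ r)) ⟩
      δ *ℚ (ι 4 *ℚ (ι D ^ℚ k *ℚ (ι 2 ^ℚ r *ℚ ι 2 ^ℚ r)))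
        ≡⟨ cong (δ *ℚ_) Δ≡ ⟩
      δ *ℚ ι Δ
        ≡⟨ δΔ≡1 ⟩
      1ℚ ∎
      where
      open ℚₚ.≤-Reasoning
      D^k : D ^ k ≡ (10 * g) ^ k * E ^ k
      D^k = trans (cong (_^ k) (rearrange g E)) (^-distribʳ-* (10 * g) E k)
        where
        rearrange : ∀ g e → g * (10 * e) ≡ (10 * g) * e
        rearrange = solve-∀
      Δ≡ : ι 4 *ℚ (ι D ^ℚ k *ℚ (ι 2 ^ℚ r *ℚ ι 2 ^ℚ r)) ≡ ι Δ
      Δ≡ = trans (sym (trans (ι-* 4 (D ^ k * (2 ^ r * 2 ^ r))) (cong (ι 4 *ℚ_) (trans (ι-* (D ^ k) (2 ^ r * 2 ^ r))
          (cong₂ _*ℚ_ (ι-^ D k) (trans (ι-* (2 ^ r) (2 ^ r)) (cong₂ _*ℚ_ (ι-^ 2 r) (ι-^ 2 r))))))))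
        (cong ι (trans (cong (λ z → 4 * (z * (2 ^ r * 2 ^ r))) D^k) (rearrange ((10 * g) ^ k) (E ^ k) (2 ^ r * 2 ^ r))))
        where
        rearrange : ∀ a b c → 4 * ((a * b) * c) ≡ (4 * (a * c)) * b
        rearrange = solve-∀
    penalty≤½ : ∀ v → S.uniform-penalty v +ℚ S.uniform-penalty v ≤ℚ 1ℚ
    penalty≤½ v = begin
      (a +ℚ b) +ℚ (a +ℚ b)              ≡⟨ sym (ℚₚ.*-identityˡ _) ⟩
      1ℚ *ℚ ((a +ℚ b) +ℚ (a +ℚ b))      ≡⟨ cong (_*ℚ ((a +ℚ b) +ℚ (a +ℚ b))) (sym x+x≡1) ⟩
      (x +ℚ x) *ℚ ((a +ℚ b) +ℚ (a +ℚ b)) ≡⟨ solve 3 (λ x a b → (x :+ x) :* ((a :+ b) :+ (a :+ b)) := x :* (con (ι 4) :* a :+ con (ι 4) :* b)) refl x a b ⟩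
      x *ℚ (ι 4 *ℚ a +ℚ ι 4 *ℚ b)       ≤⟨ *-monoˡ 0≤x (ℚₚ.+-mono-≤ (quarter-bad v) (quarter-deg v)) ⟩
      x *ℚ (1ℚ +ℚ 1ℚ)                   ≡⟨ solve 1 (λ x → x :* (con 1ℚ :+ con 1ℚ) := x :+ x) refl x ⟩
      x +ℚ x                            ≡⟨ x+x≡1 ⟩
      1ℚ                                ∎
      where
      open ℚₚ.≤-Reasoning
      a = bad uniform L (v ∷ []) nothing v
      b = δ *ℚ deg uniform v
    outcome = S.independent-set ζ≤1 ε≤½ Γ≤survival penalty≤½
    I  = proj₁ outcome
    I? = proj₁ (proj₂ outcome)
    free = proj₁ (proj₂ (proj₂ outcome))
    bound = proj₂ (proj₂ (proj₂ outcome))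
    size : ι (g * h ^ (r + r)) ≡ ι (length us) *ℚ (p *ℚ Γ)
    size = sym (begin
      ι (length us) *ℚ (p *ℚ Γ)
        ≡⟨ cong₂ (λ n d → ι n *ℚ ((d *ℚ (η *ℚ η)) *ℚ Γ)) |us| (ι-* g ρ) ⟩
      ι ((h * h) * h ^ (r + r)) *ℚ (((ι g *ℚ ι ρ) *ℚ (η *ℚ η)) *ℚ Γ)
        ≡⟨ cong (_*ℚ (((ι g *ℚ ι ρ) *ℚ (η *ℚ η)) *ℚ Γ)) (trans (ι-* (h * h) (h ^ (r + r))) (cong (_*ℚ ι (h ^ (r + r))) (ι-* h h))) ⟩
      ((ι h *ℚ ι h) *ℚ ι (h ^ (r + r))) *ℚ (((ι g *ℚ ι ρ) *ℚ (η *ℚ η)) *ℚ Γ)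
        ≡⟨ solve 6 (λ h z g ρ η Γ → ((h :* h) :* z) :* (((g :* ρ) :* (η :* η)) :* Γ) := ((h :* η) :* (h :* η)) :* (ρ :* Γ) :* (g :* z)) refl
             (ι h) (ι (h ^ (r + r))) (ι g) (ι ρ) η Γ ⟩
      ((ι h *ℚ η) *ℚ (ι h *ℚ η)) *ℚ (ι ρ *ℚ Γ) *ℚ (ι g *ℚ ι (h ^ (r + r)))
        ≡⟨ cong₂ (λ a b → (a *ℚ a) *ℚ b *ℚ (ι g *ℚ ι (h ^ (r + r)))) hη≡1 ρΓ≡1 ⟩
      (1ℚ *ℚ 1ℚ) *ℚ 1ℚ *ℚ (ι g *ℚ ι (h ^ (r + r)))
        ≡⟨ ℚₚ.*-identityˡ (ι g *ℚ ι (h ^ (r + r))) ⟩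
      ι g *ℚ ι (h ^ (r + r))
        ≡⟨ sym (ι-* g (h ^ (r + r))) ⟩
      ι (g * h ^ (r + r)) ∎)
      where
      open ≡-Reasoning
      |allFin| : length (allFin m) ≡ m
      |allFin| = length-tabulate {n = m} (id {A = Fin m})
      |us| : length us ≡ (h * h) * h ^ (r + r)
      |us| = trans (length-cartesianProduct (allFin m) (allFin m)) (trans (cong₂ _*_ |allFin| |allFin|)
        (trans (rearrange h (h ^ r)) (cong ((h * h) *_) (sym (ℕₚ.^-distribˡ-+-* h r r)))))
        where
        rearrange : ∀ h z → (h * z) * (h * z) ≡ (h * h) * (z * z)
        rearrange = solve-∀

-- From an independent set of pairs to a graph without K_{r,r}

insert : ∀ {m} (a : Fin m) {xs} → Increasing xs → a ∉ xs →
  ∃ λ ys → Increasing ys × length ys ≡ suc (length xs) × (∀ {y} → y ∈ ys → y ≡ a ⊎ y ∈ xs)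
insert a {[]} [] _ = a ∷ [] , [] ∷ [] , refl , λ { (here eq) → inj₁ eq }
insert a {x ∷ xs} (x< ∷ ixs) a∉ with Finₚ.<-cmp a x
... | tri< a<x _ _ = a ∷ x ∷ xs , (a<x ∷ All.map (Finₚ.<-trans a<x) x<) ∷ x< ∷ ixs , refl ,
      λ { (here eq) → inj₁ eq ; (there y∈) → inj₂ y∈ }
... | tri≈ _ refl _ = contradiction (here refl) a∉
... | tri> _ _ x<a =
      let ys , iys , len , ⊆ = insert a ixs (λ a∈ → a∉ (there a∈))
      in x ∷ ys , All.tabulate (λ y∈ → bound (⊆ y∈)) ∷ iys , cong suc len ,
         λ { (here eq) → inj₂ (here eq) ; (there y∈) → Sum.map₂ there (⊆ y∈) }
      where
      bound : ∀ {y} → y ≡ a ⊎ y ∈ xs → x Fin.< y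
      bound (inj₁ refl) = x<a
      bound (inj₂ y∈)   = All.lookup x< y∈

-- Sorts the injections of `ContainsKrr` into the increasing lists that index hyperedges.
increasing-image : ∀ {m} n (f : Fin n → Fin m) → Injective _≡_ _≡_ f →
  ∃ λ xs → Increasing xs × length xs ≡ n × (∀ {x} → x ∈ xs → ∃ λ i → x ≡ f i)
increasing-image zero    f f-inj = [] , [] , refl , λ ()
increasing-image (suc n) f f-inj =
  let xs , ixs , len , image = increasing-image n (f ∘ Fin.suc) (λ eq → Finₚ.suc-injective (f-inj eq))
      ys , iys , len′ , ⊆ = insert (f Fin.zero) ixs
        (λ f0∈ → contradiction (f-inj (proj₂ (image f0∈))) (λ ()))
  in ys , iys , trans len′ (cong suc len) ,
     λ y∈ → Sum.[ (λ eq → Fin.zero , eq) , (λ x∈ → let i , eq = image x∈ in Fin.suc i , eq) ] (⊆ y∈)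

sum-mono : ∀ {A : Set} (xs : List A) {f g : A → ℕ} → (∀ x → f x ≤ g x) → sum (map f xs) ≤ sum (map g xs)
sum-mono []       h = z≤n
sum-mono (x ∷ xs) h = ℕₚ.+-mono-≤ (h x) (sum-mono xs h)

sum-allFin-+ : ∀ m n (g : Fin (m + n) → ℕ) →
  sum (map g (allFin (m + n))) ≡ sum (map (g ∘ (Fin._↑ˡ n)) (allFin m)) + sum (map (g ∘ (m Fin.↑ʳ_)) (allFin n))
sum-allFin-+ m n g = trans (cong sum (map-tabulate id g)) (trans (go m g)
  (cong₂ _+_ (cong sum (sym (map-tabulate id (g ∘ (Fin._↑ˡ n))))) (cong sum (sym (map-tabulate id (g ∘ (m Fin.↑ʳ_)))))))
  where
  go : ∀ m (g : Fin (m + n) → ℕ) → sum (tabulate g) ≡ sum (tabulate (g ∘ (Fin._↑ˡ n))) + sum (tabulate (g ∘ (m Fin.↑ʳ_)))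
  go zero    g = refl
  go (suc m) g = trans (cong (g Fin.zero +_) (go m (g ∘ Fin.suc))) (sym (ℕₚ.+-assoc (g Fin.zero) _ _))

length-filter-cartesianProduct : ∀ {A B : Set} {P : A × B → Set} (P? : Decidable P) (xs : List A) (ys : List B) →
  length (filter P? (cartesianProduct xs ys)) ≡ sum (map (λ x → sum (map (λ y → if does (P? (x , y)) then 1 else 0) ys)) xs)
length-filter-cartesianProduct P? []       ys = refl
length-filter-cartesianProduct P? (x ∷ xs) ys = trans (cong length (filter-++ P? (map (x ,_) ys) (cartesianProduct xs ys)))
  (trans (length-++ (filter P? (map (x ,_) ys))) (cong₂ _+_ (row ys) (length-filter-cartesianProduct P? xs ys)))
  where
  row : ∀ ys → length (filter P? (map (x ,_) ys)) ≡ sum (map (λ y → if does (P? (x , y)) then 1 else 0) ys)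
  row [] = refl
  row (y ∷ ys) with does (P? (x , y))
  ... | true  = cong suc (row ys)
  ... | false = row ys

-- The last s vertices are isolated; they pad the bipartite graph to an arbitrary number of
-- vertices.
module Bipartite (m s : ℕ) {I : Fin m × Fin m → Set} (I? : ∀ v → Dec (I v)) where

  n : ℕ
  n = m + (m + s)

  Side : Set
  Side = Fin m ⊎ (Fin m ⊎ Fin s)

  side : Fin n → Side
  side i = Sum.map₂ (Fin.splitAt m) (Fin.splitAt m i)

  place : Side → Fin n
  place (inj₁ a)        = a Fin.↑ˡ (m + s)
  place (inj₂ (inj₁ b)) = m Fin.↑ʳ (b Fin.↑ˡ s)
  place (inj₂ (inj₂ c)) = m Fin.↑ʳ (m Fin.↑ʳ c)

  place-side : ∀ i → place (side i) ≡ i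
  place-side i with Fin.splitAt m i in eq
  ... | inj₁ a = Finₚ.splitAt⁻¹-↑ˡ eq
  ... | inj₂ j with Fin.splitAt m j in eq′
  ...   | inj₁ b = trans (cong (m Fin.↑ʳ_) (Finₚ.splitAt⁻¹-↑ˡ eq′)) (Finₚ.splitAt⁻¹-↑ʳ eq)
  ...   | inj₂ c = trans (cong (m Fin.↑ʳ_) (Finₚ.splitAt⁻¹-↑ʳ eq′)) (Finₚ.splitAt⁻¹-↑ʳ eq)

  side-row : ∀ a → side (place (inj₁ a)) ≡ inj₁ a
  side-row a = cong (Sum.map₂ (Fin.splitAt m)) (Finₚ.splitAt-↑ˡ m a (m + s))

  side-column : ∀ b → side (place (inj₂ (inj₁ b))) ≡ inj₂ (inj₁ b)
  side-column b = trans (cong (Sum.map₂ (Fin.splitAt m)) (Finₚ.splitAt-↑ʳ m (m + s) (b Fin.↑ˡ s))) (cong inj₂ (Finₚ.splitAt-↑ˡ m b s))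

  adjacent : Side → Side → Bool
  adjacent (inj₁ a)        (inj₂ (inj₁ b)) = does (I? (a , b))
  adjacent (inj₂ (inj₁ b)) (inj₁ a)        = does (I? (a , b))
  adjacent _               _               = false

  adjacent-sym : ∀ x y → adjacent x y ≡ adjacent y x
  adjacent-sym (inj₁ _)        (inj₁ _)        = refl
  adjacent-sym (inj₁ _)        (inj₂ (inj₁ _)) = refl
  adjacent-sym (inj₁ _)        (inj₂ (inj₂ _)) = refl
  adjacent-sym (inj₂ (inj₁ _)) (inj₁ _)        = refl
  adjacent-sym (inj₂ (inj₁ _)) (inj₂ (inj₁ _)) = refl
  adjacent-sym (inj₂ (inj₁ _)) (inj₂ (inj₂ _)) = refl
  adjacent-sym (inj₂ (inj₂ _)) (inj₁ _)        = refl
  adjacent-sym (inj₂ (inj₂ _)) (inj₂ (inj₁ _)) = refl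
  adjacent-sym (inj₂ (inj₂ _)) (inj₂ (inj₂ _)) = refl

  adjacent-irrefl : ∀ x → adjacent x x ≡ false
  adjacent-irrefl (inj₁ _)        = refl
  adjacent-irrefl (inj₂ (inj₁ _)) = refl
  adjacent-irrefl (inj₂ (inj₂ _)) = refl

  graph : SimpleGraph n
  graph = record
    { adj   = λ i j → adjacent (side i) (side j)
    ; sym   = λ i j → adjacent-sym (side i) (side j)
    ; irref = λ i → adjacent-irrefl (side i)
    }

  row-neighbour : ∀ {a y} → adjacent (inj₁ a) y ≡ true → ∃ λ b → y ≡ inj₂ (inj₁ b) × I (a , b)
  row-neighbour {a} {inj₂ (inj₁ b)} eq with I? (a , b)
  ... | yes Iab = b , refl , Iab
  row-neighbour {a} {inj₂ (inj₁ b)} () | no _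

  column-neighbour : ∀ {b x} → adjacent x (inj₂ (inj₁ b)) ≡ true → ∃ λ a → x ≡ inj₁ a × I (a , b)
  column-neighbour {b} {inj₁ a} eq with I? (a , b)
  ... | yes Iab = a , refl , Iab
  column-neighbour {b} {inj₁ a} () | no _
  column-neighbour {b} {inj₂ (inj₁ _)} ()
  column-neighbour {b} {inj₂ (inj₂ _)} ()

  edgeCount-≥ : length (filter I? (cartesianProduct (allFin m) (allFin m))) ≤ edgeCount graph
  edgeCount-≥ = begin
    length (filter I? (cartesianProduct (allFin m) (allFin m)))
      ≡⟨ length-filter-cartesianProduct I? (allFin m) (allFin m) ⟩
    sum (map (λ a → sum (map (λ b → if does (I? (a , b)) then 1 else 0) (allFin m))) (allFin m))
      ≤⟨ sum-mono (allFin m) (λ a → ℕₚ.≤-trans (sum-mono (allFin m) (λ b → ℕₚ.≤-reflexive (entry a b))) (columns-≤ a)) ⟩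
    sum (map (λ a → sum (map (F (a Fin.↑ˡ (m + s))) (allFin n))) (allFin m))
      ≤⟨ ℕₚ.≤-trans (ℕₚ.m≤m+n _ _) (ℕₚ.≤-reflexive (sym (sum-allFin-+ m (m + s) (λ i → sum (map (F i) (allFin n)))))) ⟩
    edgeCount graph ∎
    where
    open ℕₚ.≤-Reasoning
    F : Fin n → Fin n → ℕ
    F i j = if ⌊ i Finₚ.<? j ⌋ then (if adj graph i j then 1 else 0) else 0
    columns-≤ : ∀ a → sum (map (λ b → F (place (inj₁ a)) (place (inj₂ (inj₁ b)))) (allFin m)) ≤ sum (map (F (a Fin.↑ˡ (m + s))) (allFin n))
    columns-≤ a = ℕₚ.≤-trans (ℕₚ.≤-trans (ℕₚ.m≤m+n _ _) (ℕₚ.≤-reflexive (sym (sum-allFin-+ m s (λ j → F (a Fin.↑ˡ (m + s)) (m Fin.↑ʳ j))))))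
      (ℕₚ.≤-trans (ℕₚ.m≤n+m _ _) (ℕₚ.≤-reflexive (sym (sum-allFin-+ m (m + s) (F (a Fin.↑ˡ (m + s)))))))
    entry : ∀ a b → (if does (I? (a , b)) then 1 else 0) ≡ F (place (inj₁ a)) (place (inj₂ (inj₁ b)))
    entry a b with place (inj₁ a) Finₚ.<? place (inj₂ (inj₁ b))
    ... | yes _ = cong (λ t → if t then 1 else 0) (sym (cong₂ adjacent (side-row a) (side-column b)))
    ... | no a≮b = contradiction (begin-strict
        Fin.toℕ (place (inj₁ a))         ≡⟨ Finₚ.toℕ-↑ˡ a (m + s) ⟩
        Fin.toℕ a                        <⟨ Finₚ.toℕ<n a ⟩
        m                                ≤⟨ ℕₚ.m≤m+n m _ ⟩
        m + Fin.toℕ (b Fin.↑ˡ s)         ≡⟨ sym (Finₚ.toℕ-↑ʳ m (b Fin.↑ˡ s)) ⟩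
        Fin.toℕ (place (inj₂ (inj₁ b)))  ∎) a≮b

  module _ (r : ℕ) (2≤r : 2 ≤ r)
    (free : ∀ K v → K ∈ Copies.copies m r 2≤r → v ∈ Copies.mem m r 2≤r K → ¬ (∀ {u} → u ∈ Copies.mem m r 2≤r K → I u)) where

    no-grid : (f g : Fin r → Fin m) → Injective _≡_ _≡_ f → Injective _≡_ _≡_ g → ¬ (∀ i j → I (f i , g j))
    no-grid f g f-inj g-inj grid =
      let xs , ixs , xs-length , xs-image = increasing-image r f f-inj
          ys , iys , ys-length , ys-image = increasing-image r g g-inj
          x , x∈ = member xs (ℕₚ.≤-trans (s≤s z≤n) (subst (2 ≤_) (sym xs-length) 2≤r))
          y , y∈ = member ys (ℕₚ.≤-trans (s≤s z≤n) (subst (2 ≤_) (sym ys-length) 2≤r))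
      in free (xs , ys) (x , y) (Copies.∈-copies m r 2≤r ixs iys xs-length ys-length) (∈-cartesianProduct⁺ x∈ y∈)
           (λ {u} u∈ → let x∈ , y∈ = ∈-cartesianProduct⁻ xs ys u∈
                           i , x≡ = xs-image x∈
                           j , y≡ = ys-image y∈
                       in subst I (sym (cong₂ _,_ x≡ y≡)) (grid i j))
      where
      member : ∀ (zs : List (Fin m)) → 1 ≤ length zs → ∃ λ z → z ∈ zs
      member (z ∷ zs) _ = z , here refl

    -- One row in the first part forces the second part to consist of columns, and then the whole
    -- first part to consist of rows.
    oriented : (l l′ : Fin r → Fin n) → Injective _≡_ _≡_ l → Injective _≡_ _≡_ l′ →
      (∀ i j → adjacent (side (l i)) (side (l′ j)) ≡ true) → ∀ i₀ {a₀} → side (l i₀) ≡ inj₁ a₀ → ⊥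
    oriented l l′ l-inj l′-inj complete i₀ {a₀} eq₀ = no-grid row column row-inj column-inj grid
      where
      right : ∀ j → ∃ λ b → side (l′ j) ≡ inj₂ (inj₁ b) × I (a₀ , b)
      right j = row-neighbour (subst (λ z → adjacent z (side (l′ j)) ≡ true) eq₀ (complete i₀ j))
      column : Fin r → Fin m
      column j = proj₁ (right j)
      left : ∀ i j → ∃ λ a → side (l i) ≡ inj₁ a × I (a , column j)
      left i j = column-neighbour (subst (λ z → adjacent (side (l i)) z ≡ true) (proj₁ (proj₂ (right j))) (complete i j))
      row : Fin r → Fin m
      row i = proj₁ (left i i₀)
      injective-via : ∀ {k k′ : Fin n} {x} → side k ≡ x → side k′ ≡ x → k ≡ k′
      injective-via {k} {k′} eq eq′ = trans (sym (place-side k)) (trans (cong place (trans eq (sym eq′))) (place-side k′))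
      row-inj : Injective _≡_ _≡_ row
      row-inj {i} {i′} eq = l-inj (injective-via (trans (proj₁ (proj₂ (left i i₀))) (cong inj₁ eq)) (proj₁ (proj₂ (left i′ i₀))))
      column-inj : Injective _≡_ _≡_ column
      column-inj {j} {j′} eq = l′-inj (injective-via (trans (proj₁ (proj₂ (right j))) (cong (inj₂ ∘ inj₁) eq)) (proj₁ (proj₂ (right j′))))
      grid : ∀ i j → I (row i , column j)
      grid i j with left i j | left i i₀
      ... | a , eq , Iab | a′ , eq′ , _ with refl ← Sumₚ.inj₁-injective (trans (sym eq) eq′) = Iab

    graph-free : ¬ ContainsKrr r graph
    graph-free c = cases (side (left i₀)) refl
      where
      open ContainsKrr c
      i₀ : Fin r
      i₀ = Fin.fromℕ< (ℕₚ.≤-trans (s≤s z≤n) 2≤r)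
      cases : ∀ z → side (left i₀) ≡ z → ⊥
      cases (inj₁ a) eq = oriented left right left-inj right-inj complete i₀ eq
      cases (inj₂ (inj₂ _)) eq = contradiction (subst (λ z → adjacent z (side (right i₀)) ≡ true) eq (complete i₀ i₀)) (λ ())
      -- A column on the left has only rows as neighbours, so the two parts are exchanged.
      cases (inj₂ (inj₁ b)) eq =
        let a , eq′ , _ = column-neighbour (trans (adjacent-sym (side (right i₀)) (inj₂ (inj₁ b)))
              (subst (λ z → adjacent z (side (right i₀)) ≡ true) eq (complete i₀ i₀)))
        in oriented right left right-inj left-inj
             (λ i j → trans (adjacent-sym (side (right i)) (side (left j))) (complete j i)) i₀ eq′

-- Choice of parameters for given n

*-≤2^ : ∀ {m n} a b → m ≤ 2 ^ a → n ≤ 2 ^ b → m * n ≤ 2 ^ (a + b)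
*-≤2^ a b m≤ n≤ = ℕₚ.≤-trans (ℕₚ.*-mono-≤ m≤ n≤) (ℕₚ.≤-reflexive (sym (ℕₚ.^-distribˡ-+-* 2 a b)))

+-≤2^ : ∀ {m n} a → m ≤ 2 ^ a → n ≤ 2 ^ a → m + n ≤ 2 ^ suc a
+-≤2^ a m≤ n≤ = ℕₚ.≤-trans (ℕₚ.+-mono-≤ m≤ n≤) (ℕₚ.≤-reflexive (cong (2 ^ a +_) (sym (ℕₚ.+-identityʳ (2 ^ a)))))

^-≤2^ : ∀ {m} a n → m ≤ 2 ^ a → m ^ n ≤ 2 ^ (a * n)
^-≤2^ a n m≤ = ℕₚ.≤-trans (ℕₚ.^-monoˡ-≤ n m≤) (ℕₚ.≤-reflexive (ℕₚ.^-*-assoc 2 a n))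

n<2^n : ∀ n → n < 2 ^ n
n<2^n zero    = s≤s z≤n
n<2^n (suc n) = ℕₚ.≤-trans (s≤s (n<2^n n)) (+-≤2^ n (ℕₚ.m^n>0 2 n) ℕₚ.≤-refl)

n≤2^n : ∀ n → n ≤ 2 ^ n
n≤2^n n = ℕₚ.<⇒≤ (n<2^n n)

m≤m^n : ∀ {m n} → 1 ≤ m → 1 ≤ n → m ≤ m ^ n
m≤m^n {m} 1≤m 1≤n = ℕₚ.≤-trans (ℕₚ.≤-reflexive (sym (ℕₚ.^-identityʳ m))) (ℕₚ.^-monoʳ-≤ m {{ℕ.>-nonZero 1≤m}} 1≤n)

-- A discrete inverse, found by searching downwards from an argument where f exceeds x. It inverts
-- both the number of vertices as a function of h and `tower`.
crossing : ∀ (f : ℕ → ℕ) {x} → f 1 ≤ x → ∀ n → x < f (suc n) → ∃ λ g → 1 ≤ g × f g ≤ x × x < f (suc g)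
crossing f f1≤x zero    x<f = contradiction f1≤x (ℕₚ.<⇒≱ x<f)
crossing f {x} f1≤x (suc n) x<f with f (suc n) ℕ.≤? x
... | yes f≤x = suc n , s≤s z≤n , f≤x , x<f
... | no f≰x  = crossing f f1≤x n (ℕₚ.≰⇒> f≰x)

r²-1 : ∀ r → 1 ≤ r → r * r ∸ 1 ≡ (r + 1) * (r ∸ 1)
r²-1 (suc q) _ = identity q
  where
  identity : ∀ q → q + q * (1 + q) ≡ (1 + q + 1) * q
  identity = solve-∀

module Thresholds (r : ℕ) (2≤r : 2 ≤ r) where

  -- `c₀` is the factor in j = c₀ g^k, and c₁ j bounds the binary logarithm of `base`. The 8 absorbs
  -- L, the factor 4 of the threshold and the rounding to powers of two.
  k c₀ c₁ c : ℕ
  k  = r * r ∸ 1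
  c₀ = 4 * (10 ^ k * (2 ^ r * 2 ^ r))
  c₁ = r * r + (6 * k + ((7 + r * r) * r + (7 + r * r) * r))
  c  = (c₁ + 8) * c₀

  tower : ℕ → ℕ
  tower g = 2 ^ (2 ^ (c * g ^ k))

  1≤k : 1 ≤ k
  1≤k = ℕₚ.∸-monoˡ-≤ {2} 1 (ℕₚ.≤-trans (s≤s (s≤s z≤n)) (ℕₚ.*-mono-≤ 2≤r 2≤r))

  1≤c₀ : 1 ≤ c₀
  1≤c₀ = ℕₚ.*-mono-≤ {1} {4} (s≤s z≤n) (ℕₚ.*-mono-≤ (ℕₚ.m^n>0 10 k) (ℕₚ.*-mono-≤ (ℕₚ.m^n>0 2 r) (ℕₚ.m^n>0 2 r)))

  -- `base` is a power of two with exponent O(j) and L is O(2^j), so the iterated logarithm of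
  -- `base ^ L` is O(j) = O(g^k).
  threshold≤tower : ∀ g → 1 ≤ g → Parameters.threshold r g ≤ tower g
  threshold≤tower g 1≤g = ℕₚ.≤-trans
    (*-≤2^ 2 (X * L) (ℕₚ.≤-refl {4}) (^-≤2^ X L base≤))
    (ℕₚ.^-monoʳ-≤ 2 (ℕₚ.≤-trans exponent≤ (ℕₚ.^-monoʳ-≤ 2 (ℕₚ.≤-reflexive (trans (cong ((c₁ + 8) *_) j≡) (sym (ℕₚ.*-assoc (c₁ + 8) c₀ (g ^ k))))))))
    where
    open Parameters r g hiding (k)
    X : ℕ
    X = r * r + ((j + (4 + j)) * k + ((1 + (5 + j + r * r)) * r + (1 + (5 + j + r * r)) * r))
    j≡ : j ≡ c₀ * g ^ k
    j≡ = trans (cong (λ z → 4 * (z * (2 ^ r * 2 ^ r))) (^-distribʳ-* 10 g k)) (rearrange (10 ^ k) (g ^ k) (2 ^ r * 2 ^ r))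
      where
      rearrange : ∀ a b d → 4 * ((a * b) * d) ≡ (4 * (a * d)) * b
      rearrange = solve-∀
    g≤j : g ≤ j
    g≤j = ℕₚ.≤-trans (m≤m^n 1≤g 1≤k) (ℕₚ.≤-trans (ℕₚ.m≤n*m (g ^ k) c₀ {{ℕ.>-nonZero 1≤c₀}}) (ℕₚ.≤-reflexive (sym j≡)))
    1≤j : 1 ≤ j
    1≤j = ℕₚ.≤-trans 1≤g g≤j
    ρ≤ : ρ ≤ 2 ^ (4 + j)
    ρ≤ = *-≤2^ 4 j (ℕₚ.m≤m+n 10 6) ℕₚ.≤-refl
    L≤ : L ≤ 2 ^ (5 + j)
    L≤ = +-≤2^ (4 + j) ρ≤ ρ≤
    r²≤ : r * r ≤ 2 ^ (r * r)
    r²≤ = n≤2^n (r * r)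
    base≤ : base ≤ 2 ^ X
    base≤ = *-≤2^ (r * r) _ r²+1≤ (*-≤2^ ((j + (4 + j)) * k) _
      (^-≤2^ (j + (4 + j)) k (*-≤2^ j (4 + j) (ℕₚ.≤-trans g≤j (n≤2^n j)) ρ≤))
      (*-≤2^ ((1 + (5 + j + r * r)) * r) _ M^r≤ M^r≤))
      where
      r²+1≤ : r * r + 1 ≤ 2 ^ (r * r)
      r²+1≤ = ℕₚ.≤-trans (ℕₚ.≤-reflexive (ℕₚ.+-comm (r * r) 1)) (n<2^n (r * r))
      M^r≤ : M ^ r ≤ 2 ^ ((1 + (5 + j + r * r)) * r)
      M^r≤ = ^-≤2^ (1 + (5 + j + r * r)) r (+-≤2^ (5 + j + r * r)
        (ℕₚ.^-monoʳ-≤ 2 {1} {5 + j + r * r} (s≤s z≤n)) (*-≤2^ (5 + j) (r * r) L≤ r²≤))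
    exponent≤ : 2 + X * L ≤ 2 ^ ((c₁ + 8) * j)
    exponent≤ = ℕₚ.≤-trans
      (+-≤2^ (j + c₁ + (5 + j)) (ℕₚ.^-monoʳ-≤ 2 {1} (ℕₚ.≤-trans (s≤s z≤n) (ℕₚ.m≤n+m (5 + j) (j + c₁))))
        (*-≤2^ (j + c₁) (5 + j) (ℕₚ.≤-trans (X≤ j 1≤j) (*-≤2^ j c₁ (n≤2^n j) (n≤2^n c₁))) L≤))
      (ℕₚ.^-monoʳ-≤ 2 (final j 1≤j))
      where
      X≤ : ∀ j → 1 ≤ j → r * r + ((j + (4 + j)) * k + ((1 + (5 + j + r * r)) * r + (1 + (5 + j + r * r)) * r)) ≤ j * c₁
      X≤ (suc i) _ = ℕₚ.≤-trans (ℕₚ.m≤m+n _ (r * r * i + 4 * i * k + ((6 * i + r * r * i) * r + (6 * i + r * r * i) * r)))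
        (ℕₚ.≤-reflexive (identity i k (r * r) r))
        where
        identity : ∀ i k q r → q + (((1 + i) + (4 + (1 + i))) * k + ((1 + (5 + (1 + i) + q)) * r + (1 + (5 + (1 + i) + q)) * r))
          + (q * i + 4 * i * k + ((6 * i + q * i) * r + (6 * i + q * i) * r))
          ≡ (1 + i) * (q + (6 * k + ((7 + q) * r + (7 + q) * r)))
        identity = solve-∀
      final : ∀ j → 1 ≤ j → suc (j + c₁ + (5 + j)) ≤ (c₁ + 8) * j
      final (suc i) _ = ℕₚ.≤-trans (ℕₚ.m≤m+n _ (c₁ * i + 6 * i)) (ℕₚ.≤-reflexive (identity i c₁))
        where
        identity : ∀ i c → (1 + ((1 + i) + c + (5 + (1 + i)))) + (c * i + 6 * i) ≡ (c + 8) * (1 + i)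
        identity = solve-∀

  -- Stopping at the last usable g costs only a constant: (g + 1)^k is at most 2^k g^k for positive
  -- g.
  loglog-bound : ∀ {n} g → 1 ≤ g → n ≤ 2 * tower (suc g) ^ suc r → loglog n ≤ (c * 2 ^ k + (r + 2)) * g ^ k
  loglog-bound {n} g 1≤g n≤ = begin
    loglog n                      ≤⟨ ⌊log₂⌋-mono-≤ log≤ ⟩
    ⌊log₂ 2 ^ (T + (r + 2)) ⌋     ≡⟨ ⌊log₂[2^n]⌋≡n (T + (r + 2)) ⟩
    T + (r + 2)                   ≤⟨ ℕₚ.+-mono-≤ T≤ (ℕₚ.m≤m*n (r + 2) (g ^ k) {{ℕ.>-nonZero (ℕₚ.m^n>0 g {{ℕ.>-nonZero 1≤g}} k)}}) ⟩
    c * 2 ^ k * g ^ k + (r + 2) * g ^ k ≡⟨ sym (ℕₚ.*-distribʳ-+ (g ^ k) (c * 2 ^ k) (r + 2)) ⟩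
    (c * 2 ^ k + (r + 2)) * g ^ k ∎
    where
    open ℕₚ.≤-Reasoning
    T : ℕ
    T = c * suc g ^ k
    T≤ : T ≤ c * 2 ^ k * g ^ k
    T≤ = begin
      c * suc g ^ k        ≤⟨ ℕₚ.*-monoʳ-≤ c (ℕₚ.^-monoˡ-≤ k (ℕₚ.+-mono-≤ 1≤g (ℕₚ.≤-reflexive (sym (ℕₚ.+-identityʳ g))))) ⟩
      c * (2 * g) ^ k      ≡⟨ cong (c *_) (^-distribʳ-* 2 g k) ⟩
      c * (2 ^ k * g ^ k)  ≡⟨ sym (ℕₚ.*-assoc c (2 ^ k) (g ^ k)) ⟩
      c * 2 ^ k * g ^ k    ∎
    log≤ : ⌊log₂ n ⌋ ≤ 2 ^ (T + (r + 2))
    log≤ = begin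
      ⌊log₂ n ⌋                                  ≤⟨ ⌊log₂⌋-mono-≤ (ℕₚ.≤-trans n≤ (*-≤2^ 1 (2 ^ T * suc r) (ℕₚ.≤-refl {2}) (^-≤2^ (2 ^ T) (suc r) ℕₚ.≤-refl))) ⟩
      ⌊log₂ 2 ^ (1 + 2 ^ T * suc r) ⌋            ≡⟨ ⌊log₂[2^n]⌋≡n (1 + 2 ^ T * suc r) ⟩
      1 + 2 ^ T * suc r                          ≤⟨ ℕₚ.+-monoˡ-≤ (2 ^ T * suc r) (ℕₚ.m^n>0 2 T) ⟩
      2 ^ T + 2 ^ T * suc r                      ≡⟨ sym (ℕₚ.*-suc (2 ^ T) (suc r)) ⟩
      2 ^ T * suc (suc r)                        ≤⟨ ℕₚ.*-monoʳ-≤ (2 ^ T) (ℕₚ.≤-trans (ℕₚ.≤-reflexive (ℕₚ.+-comm 2 r)) (n≤2^n (r + 2))) ⟩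
      2 ^ T * 2 ^ (r + 2)                        ≡⟨ sym (ℕₚ.^-distribˡ-+-* 2 T (r + 2)) ⟩
      2 ^ (T + (r + 2))                          ∎

  P : ℕ
  P = (r + 1) * (r ∸ 1)

  k≡P : k ≡ P
  k≡P = r²-1 r (ℕₚ.≤-trans (s≤s z≤n) 2≤r)

  C′ C N : ℕ
  C′ = c * 2 ^ k + (r + 2)
  C  = (2 * 2 ^ suc r) ^ (2 * r * P) * C′ ^ (r + 1) * 2 ^ (P * (r + 1))
  N  = 2 * tower 1 ^ suc r

  1≤tower : ∀ g → 1 ≤ tower g
  1≤tower g = ℕₚ.m^n>0 2 (2 ^ (c * g ^ k))

  n<tower : ∀ {n} → n < tower n
  n<tower {zero}  = 1≤tower 0
  n<tower {suc n} = ℕₚ.<-≤-trans (n<2^n (suc n)) (ℕₚ.^-monoʳ-≤ 2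
    (ℕₚ.≤-trans (m≤m^n {suc n} (s≤s z≤n) 1≤k)
      (ℕₚ.≤-trans (ℕₚ.m≤n*m (suc n ^ k) c {{ℕ.>-nonZero 1≤c}}) (n≤2^n (c * suc n ^ k)))))
    where
    1≤c : 1 ≤ c
    1≤c = ℕₚ.*-mono-≤ {1} {c₁ + 8} (ℕₚ.≤-trans (s≤s z≤n) (ℕₚ.m≤n+m 8 c₁)) 1≤c₀

  -- The edge bound is raised to the power P (r + 1). Then h has the exponent it has in n^(2rP) with
  -- n of order h^(r+1), and g appears as (g^k)^(r+1), which dominates the power of `loglog n`.
  final-bound : ∀ {n h g e} → 1 ≤ h → n ≤ 2 * suc h ^ suc r → loglog n ≤ C′ * g ^ k → g * h ^ (r + r) ≤ 2 * e →
    n ^ (2 * r * P) * loglog n ^ (r + 1) ≤ C * e ^ ((r + 1) * (r + 1) * (r ∸ 1))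
  final-bound {n} {h} {g} {e} 1≤h n≤ loglog≤ edges = begin
    n ^ a * loglog n ^ b
      ≤⟨ ℕₚ.*-mono-≤ (ℕₚ.^-monoˡ-≤ a n≤′) (ℕₚ.^-monoˡ-≤ b loglog≤) ⟩
    (2 * 2 ^ suc r * h ^ suc r) ^ a * (C′ * g ^ k) ^ b
      ≡⟨ cong₂ _*_ (trans (^-distribʳ-* (2 * 2 ^ suc r) (h ^ suc r) a) (cong ((2 * 2 ^ suc r) ^ a *_) (ℕₚ.^-*-assoc h (suc r) a)))
                   (trans (^-distribʳ-* C′ (g ^ k) b) (cong (C′ ^ b *_) (ℕₚ.^-*-assoc g k b))) ⟩
    (2 * 2 ^ suc r) ^ a * h ^ (suc r * a) * (C′ ^ b * g ^ (k * b))
      ≡⟨ cong₂ (λ x y → (2 * 2 ^ suc r) ^ a * h ^ x * (C′ ^ b * g ^ (y * b))) (exponent₁ r P) k≡P ⟩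
    (2 * 2 ^ suc r) ^ a * h ^ ((r + r) * (P * b)) * (C′ ^ b * g ^ (P * b))
      ≡⟨ rearrange ((2 * 2 ^ suc r) ^ a) (h ^ ((r + r) * (P * b))) (C′ ^ b) (g ^ (P * b)) ⟩
    (2 * 2 ^ suc r) ^ a * C′ ^ b * (g ^ (P * b) * h ^ ((r + r) * (P * b)))
      ≡⟨ cong ((2 * 2 ^ suc r) ^ a * C′ ^ b *_) (trans (cong (g ^ (P * b) *_) (sym (ℕₚ.^-*-assoc h (r + r) (P * b)))) (sym (^-distribʳ-* g (h ^ (r + r)) (P * b)))) ⟩
    (2 * 2 ^ suc r) ^ a * C′ ^ b * (g * h ^ (r + r)) ^ (P * b)
      ≤⟨ ℕₚ.*-monoʳ-≤ ((2 * 2 ^ suc r) ^ a * C′ ^ b) (ℕₚ.^-monoˡ-≤ (P * b) edges) ⟩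
    (2 * 2 ^ suc r) ^ a * C′ ^ b * (2 * e) ^ (P * b)
      ≡⟨ cong ((2 * 2 ^ suc r) ^ a * C′ ^ b *_) (^-distribʳ-* 2 e (P * b)) ⟩
    (2 * 2 ^ suc r) ^ a * C′ ^ b * (2 ^ (P * b) * e ^ (P * b))
      ≡⟨ sym (ℕₚ.*-assoc ((2 * 2 ^ suc r) ^ a * C′ ^ b) (2 ^ (P * b)) (e ^ (P * b))) ⟩
    C * e ^ (P * b)
      ≡⟨ cong (λ x → C * e ^ x) (exponent₂ r (r ∸ 1)) ⟩
    C * e ^ ((r + 1) * (r + 1) * (r ∸ 1)) ∎
    where
    open ℕₚ.≤-Reasoning
    a b : ℕ
    a = 2 * r * P
    b = r + 1
    n≤′ : n ≤ 2 * 2 ^ suc r * h ^ suc r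
    n≤′ = begin
      n                               ≤⟨ n≤ ⟩
      2 * suc h ^ suc r               ≤⟨ ℕₚ.*-monoʳ-≤ 2 (ℕₚ.^-monoˡ-≤ (suc r) (ℕₚ.+-mono-≤ 1≤h (ℕₚ.≤-reflexive (sym (ℕₚ.+-identityʳ h))))) ⟩
      2 * (2 * h) ^ suc r             ≡⟨ cong (2 *_) (^-distribʳ-* 2 h (suc r)) ⟩
      2 * (2 ^ suc r * h ^ suc r)     ≡⟨ sym (ℕₚ.*-assoc 2 (2 ^ suc r) (h ^ suc r)) ⟩
      2 * 2 ^ suc r * h ^ suc r       ∎
    exponent₁ : ∀ r P → (1 + r) * (2 * r * P) ≡ (r + r) * (P * (r + 1))
    exponent₁ = solve-∀
    exponent₂ : ∀ r q → (r + 1) * q * (r + 1) ≡ (r + 1) * (r + 1) * q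
    exponent₂ = solve-∀
    rearrange : ∀ a b c d → a * b * (c * d) ≡ a * c * (d * b)
    rearrange = solve-∀

-- The asymptotic bound raised to the power (r + 1)(r² - 1), which clears the fractional exponents:
-- 2 - 2/(r+1) = 2r/(r+1) becomes 2r(r² - 1), and 1/(r² - 1) becomes r + 1.
theorem2 : (r : ℕ) → 5 ≤ r →
    Σ ℕ λ C → Σ ℕ λ N → (n : ℕ) → N ≤ n →
    Σ (SimpleGraph n) λ G → (¬ ContainsKrr r G) ×
    (n ^ (2 * r * ((r + 1) * (r ∸ 1))) * loglog n ^ (r + 1)
    ≤ C * edgeCount G ^ ((r + 1) * (r + 1) * (r ∸ 1)))
theorem2 r 5≤r = C , N , construct
  where
  2≤r : 2 ≤ r
  2≤r = ℕₚ.≤-trans (s≤s (s≤s z≤n)) 5≤r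
  open Thresholds r 2≤r
  construct : ∀ n → N ≤ n → Σ (SimpleGraph n) λ G → (¬ ContainsKrr r G) ×
    (n ^ (2 * r * P) * loglog n ^ (r + 1) ≤ C * edgeCount G ^ ((r + 1) * (r + 1) * (r ∸ 1)))
  construct n N≤n = build (m≤n⇒∃ 2m≤n)
    where
    2≤n : 2 * 1 ^ suc r ≤ n
    2≤n = ℕₚ.≤-trans (ℕₚ.*-monoʳ-≤ 2 (ℕₚ.^-monoˡ-≤ (suc r) (1≤tower 1))) N≤n
    n<2[1+n] : n < 2 * suc n ^ suc r
    n<2[1+n] = ℕₚ.≤-trans (m≤m^n {suc n} {suc r} (s≤s z≤n) (s≤s z≤n)) (ℕₚ.m≤m+n (suc n ^ suc r) _)
    h-choice = crossing (λ h → 2 * h ^ suc r) 2≤n n n<2[1+n]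
    h = proj₁ h-choice
    1≤h = proj₁ (proj₂ h-choice)
    2m≤n : 2 * h ^ suc r ≤ n
    2m≤n = proj₁ (proj₂ (proj₂ h-choice))
    n< : n < 2 * suc h ^ suc r
    n< = proj₂ (proj₂ (proj₂ h-choice))
    -- The choice of `N` serves this bound, without which no positive g would be available.
    tower≤h : tower 1 ≤ h
    tower≤h with tower 1 ℕ.≤? h
    ... | yes p = p
    ... | no ¬p = contradiction (ℕₚ.≤-trans (ℕₚ.≤-trans n< (ℕₚ.*-monoʳ-≤ 2 (ℕₚ.^-monoˡ-≤ (suc r) (ℕₚ.≰⇒> ¬p)))) N≤n) ℕₚ.1+n≰n
    g-choice = crossing tower tower≤h h (ℕₚ.<-trans (ℕₚ.n<1+n h) n<tower)
    g = proj₁ g-choice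
    1≤g = proj₁ (proj₂ g-choice)
    tower-g≤h = proj₁ (proj₂ (proj₂ g-choice))
    h<tower = proj₂ (proj₂ (proj₂ g-choice))
    loglog≤ : loglog n ≤ C′ * g ^ k
    loglog≤ = loglog-bound g 1≤g (ℕₚ.≤-trans (ℕₚ.<⇒≤ n<) (ℕₚ.*-monoʳ-≤ 2 (ℕₚ.^-monoˡ-≤ (suc r) h<tower)))
    m = h ^ suc r
    m≤n⇒∃ : 2 * m ≤ n → ∃ λ s → m + (m + s) ≡ n
    m≤n⇒∃ 2m≤n = let s , eq = ℕₚ.m≤n⇒∃[o]m+o≡n 2m≤n in s , trans (rearrange m s) eq
      where
      rearrange : ∀ m s → m + (m + s) ≡ 2 * m + s
      rearrange = solve-∀
    build : (∃ λ s → m + (m + s) ≡ n) → Σ (SimpleGraph n) λ G → (¬ ContainsKrr r G) ×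
      (n ^ (2 * r * P) * loglog n ^ (r + 1) ≤ C * edgeCount G ^ ((r + 1) * (r + 1) * (r ∸ 1)))
    build (s , eq) =
      let I , I? , free , edges = bipartite-graph r 2≤r g 1≤g h (ℕₚ.≤-trans (threshold≤tower g 1≤g) tower-g≤h)
          open Bipartite m s I?
      in subst (λ n → Σ (SimpleGraph n) λ G → (¬ ContainsKrr r G) ×
             (n ^ (2 * r * P) * loglog n ^ (r + 1) ≤ C * edgeCount G ^ ((r + 1) * (r + 1) * (r ∸ 1)))) eq
           (graph , graph-free r 2≤r free ,
            final-bound {g = g} 1≤h (subst (_≤ 2 * suc h ^ suc r) (sym eq) (ℕₚ.<⇒≤ n<)) (subst (λ n → loglog n ≤ C′ * g ^ k) (sym eq) loglog≤)
              (ℕₚ.≤-trans edges (ℕₚ.*-monoʳ-≤ 2 edgeCount-≥)))
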